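{- There exists a deterministic single-pass semi-streaming algorithm that, given the edges of a (general) graph $G$ with $n$ vertices arriving in a uniformly random order, with high probability (in $n$) outputs a matching of $G$ of size at least $\big(\frac{6}{11}-o(1)\big)\mu(G)$, where $\mu(G)$ is the size of a maximum matching of $G$.
   Context: A graph stream for a graph $G=(V,E)$ with $n$ vertices and $m$ edges is a sequence $\langle e_1,\dots,e_m\rangle$ in which $(e_1,\dots,e_m)$ is a permutation of $E$; in the random-order model this permutation is chosen uniformly at random. A single-pass semi-streaming algorithm reads the stream once, in order, using memory $\tilde{O}(n)$ (i.e. $O(n\,\mathrm{polylog}\,n)$), and outputs a matching of $G$. "Deterministic" means the algorithm makes no random choices; the only randomness is the order of the stream. "With high probability" means with probability at least $1-1/\mathrm{poly}(n)$, and $o(1)$ denotes a quantity tending to $0$ as $n\to\infty$. -}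

module Defs where

open import Data.Nat using (ℕ; zero; suc; _+_; _*_; _∸_; _^_; _≤_)
open import Data.Nat.Logarithm using (⌊log₂_⌋)
open import Data.Fin as Fin using (Fin)
open import Data.Integer using (+_)
open import Data.Rational as ℚ using (ℚ; 0ℚ)
open import Data.List using (List; []; _∷_; length; foldl; concatMap; map; lookup)
open import Data.List.Membership.Propositional using (_∈_)
open import Data.List.Relation.Unary.All using (All)
open import Data.List.Relation.Unary.AllPairs using (AllPairs)
open import Data.List.Relation.Unary.Unique.Propositional using (Unique)
open import Data.Product using (_×_; Σ; ∃; proj₁; proj₂; _,_)
open import Relation.Binary.PropositionalEquality using (_≡_; _≢_)

-- An (undirected) edge on vertex set Fin n, written as (u , v) with u < v.
Edge : ℕ → Set
Edge n = Fin n × Fin n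

record Graph (n : ℕ) : Set where
  field
    edges   : List (Edge n)
    ordered : All (λ e → proj₁ e Fin.< proj₂ e) edges
    simple  : Unique edges
open Graph public

VertexDisjoint : ∀ {n} → Edge n → Edge n → Set
VertexDisjoint (a , b) (c , d) = a ≢ c × a ≢ d × b ≢ c × b ≢ d

IsMatching : ∀ {n} → Graph n → List (Edge n) → Set
IsMatching G M = All (_∈ edges G) M × AllPairs VertexDisjoint M

MaxMatchingSize : ∀ {n} → Graph n → ℕ → Set
MaxMatchingSize G k =
  (Σ (List _) λ M → IsMatching G M × length M ≡ k) ×
  (∀ M → IsMatching G M → length M ≤ k)

-- All orderings of a list (for a duplicate-free list: each permutation exactly once).
insertions : ∀ {A : Set} → A → List A → List (List A)
insertions x []       = (x ∷ []) ∷ []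
insertions x (y ∷ ys) = (x ∷ y ∷ ys) ∷ map (y ∷_) (insertions x ys)

permutations : ∀ {A : Set} → List A → List (List A)
permutations []       = [] ∷ []
permutations (x ∷ xs) = concatMap (insertions x) (permutations xs)

-- A deterministic single-pass streaming algorithm (uniform in n, as it is an
-- Agda term): for each number of vertices n a finite state space Fin (S n)
-- (i.e. memory of ⌈log₂ S n⌉ bits), an initial state, a deterministic
-- transition reading one edge, and an output (a list of edges) computed from
-- the final state.
record StreamAlg : Set where
  field
    S     : ℕ → ℕ
    init  : (n : ℕ) → Fin (S n)
    step  : (n : ℕ) → Fin (S n) → Edge n → Fin (S n)
    out   : (n : ℕ) → Fin (S n) → List (Edge n)
open StreamAlg public

run : StreamAlg → (n : ℕ) → List (Edge n) → List (Edge n)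
run A n σ = out A n (foldl (step A n) (init A n) σ)

-- Semi-streaming: memory O(n polylog n) bits, i.e. S n ≤ 2^(c·(n+1)·(log₂ n + 1)^k).
SemiStreaming : StreamAlg → Set
SemiStreaming A = ∃ λ c → ∃ λ k → ∀ n →
  S A n ≤ 2 ^ (c * suc n * (suc ⌊log₂ n ⌋) ^ k)

IsLittleO1 : (ℕ → ℚ) → Set
IsLittleO1 ε = ∀ (δ : ℚ) → 0ℚ ℚ.< δ → ∃ λ N → ∀ n → N ≤ n → ε n ℚ.≤ δ

toℚ : ℕ → ℚ
toℚ m = + m ℚ./ 1

Good : StreamAlg → (n : ℕ) → Graph n → ℚ → ℕ → List (Edge n) → Set
Good A n G ε μ σ =
  IsMatching G (run A n σ) × (+ 6 ℚ./ 11 ℚ.- ε) ℚ.* toℚ μ ℚ.≤ toℚ (length (run A n σ))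

-- Pr_{σ uniform over orderings of E(G)} [Good σ] ≥ 1 − 1/n^d, stated by counting:
-- there is a set I of (distinct) orderings, all good, with |I| · n^d ≥ (n^d − 1) · m!.
HighProb : ∀ {n} → Graph n → ℕ → (List (Edge n) → Set) → Set
HighProb {n} G d P =
  let perms = permutations (edges G) in
  Σ (List (Fin (length perms))) λ I →
    Unique I × All (λ i → P (lookup perms i)) I ×
    (n ^ d ∸ 1) * length perms ≤ length I * n ^ d

{-# OPTIONS --safe #-}
-- The algorithm keeps a set B of edges and the subgraph H ⊆ B maximising Φ(H) = 126 |H| − Σ deg², which forces
-- deg u + deg v ≤ 64 on the edges of H. An arriving edge with deg u + deg v < 62 is a mistake: adding it to B raises
-- max Φ by at least 2, so there are O(n) mistakes. Hence, for a streak length α of order m / n, within a small part of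
-- the stream α consecutive edges arrive without a mistake, and then, with high probability, only O(n log n) of the
-- edges to come violate deg u + deg v ≥ 62. From there on B is frozen and the violating edges are all stored.
--
-- Let T be the part of a maximum matching that arrives after the freeze. By a Tutte–Berge argument, remove vertices U
-- from the stored graph until every remaining vertex is missed by some maximum matching, and let M be a maximum matching
-- of the rest sharing the most edges with T. By Gallai's lemma a vertex covered by M has at most one neighbour among the
-- free vertices, and the edges of T between free vertices, or between a free and a covered one, have degree sum at least 62.
-- As degree sums in H are at most 64, counting the edges of H at their endpoints gives 5 |T| ≤ 8 (|U| + |M|). Since T
-- contains 7/8 of the maximum matching, the ratio is 35/64 > 6/11.
--
-- As m is unknown, all α ∈ {0, 1, 2, 4, …} run in parallel; α = 0 stores the whole graph when m = O(n log n).
module Submission where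

open import Defs
open import Data.Nat using (ℕ; zero; suc; pred; _+_; _*_; _∸_; _^_; _≤_; _<_; _/_; z≤n; s≤s; NonZero; nonZero; >-nonZero; _!; _≤?_; _<?_) renaming (_≟_ to _≟ℕ_)
open import Data.Nat.ListAction using (sum)
open import Data.Nat.Properties hiding (_≟_; ≡-irrelevant; ≡-decSetoid; 0≢1+n; suc-injective)
open import Data.Nat.Tactic.RingSolver using (solve-∀)
open import Data.Nat.DivMod using (m≡m%n+[m/n]*n; m%n<n; m/n*n≤m; m*n/n≡m; /-monoˡ-≤)
open import Data.Nat.Logarithm using (⌊log₂_⌋; ⌊log₂⌋-mono-≤; ⌊log₂[2^n]⌋≡n)
open import Data.Integer as ℤ using (ℤ) renaming (+_ to pos)
import Data.Integer.Properties as ℤ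
open import Data.Integer.Tactic.RingSolver using () renaming (solve-∀ to solveℤ)
open import Data.Rational as ℚ using (ℚ; 0ℚ)
import Data.Rational.Properties as ℚ
open import Data.Rational.Unnormalised as ℚᵘ using (mkℚᵘ)
import Data.Rational.Unnormalised.Properties as ℚᵘ
open import Data.Fin as Fin using (Fin; zero; suc)
open import Data.Fin.Properties using (_≟_; suc-injective; all?; ¬∀⟶∃¬)
open import Data.List using (List; []; _∷_; _++_; map; length; allFin; concatMap; filter; foldl; take; drop; lookup; cartesianProduct; upTo)
open import Data.List.Properties using (map-tabulate; tabulate-lookup; length-map; length-++; length-tabulate; length-upTo; map-∘; map-id; take++drop≡id)
open import Data.List.Extrema ℤ.≤-totalOrder using (argmax; f[xs]≤f[argmax]; argmax-all)
import Data.List.Extrema.Nat as Nat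
open import Data.List.Membership.Propositional using (_∈_; _∉_; lose; find)
open import Data.List.Membership.Propositional.Properties using (∈-map⁺; ∈-map⁻; ∈-++⁺ˡ; ∈-++⁺ʳ; ∈-++⁻; ∈-allFin; ∈-∃++; ∈-filter⁺; ∈-filter⁻; ∈-lookup; ∈-concat⁺′; ∈-concat⁻′; ∈-cartesianProduct⁺; ∈-cartesianProduct⁻; ∈-upTo⁺; ∈-upTo⁻)
open import Data.List.Relation.Unary.All as All using (All; []; _∷_)
import Data.List.Relation.Unary.All.Properties as All
open import Data.List.Relation.Unary.Any as Any using (here; there; index)
open import Data.List.Relation.Unary.Any.Properties using (lookup-index)
open import Data.List.Relation.Unary.AllPairs as AllPairs using (AllPairs; []; _∷_)
open import Data.List.Relation.Unary.Unique.Propositional using (Unique)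
import Data.List.Relation.Unary.Unique.Propositional.Properties as Unique
open import Data.List.Relation.Binary.Permutation.Propositional using (_↭_; ↭-sym; ↭-refl; ↭-trans; prep; swap; ↭⇒↭ₛ)
open import Data.List.Relation.Binary.Permutation.Propositional.Properties using (shift; ↭-length; All-resp-↭; ∈-resp-↭)
import Data.List.Relation.Binary.Permutation.Setoid.Properties as Permutation
open import Data.List.Relation.Binary.Sublist.Propositional as Sublist using (_⊆_; []; _∷_; _∷ʳ_; ⊆-refl; ⊆-trans; minimum)
open import Data.List.Relation.Binary.Sublist.Propositional.Properties using (++⁺; All-resp-⊆)
open import Data.Product using (_×_; Σ; ∃; ∃₂; _,_; proj₁; proj₂)
open import Data.Product.Properties using (≡-dec)
open import Data.Sum using (_⊎_; inj₁; inj₂; [_,_]′)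
open import Data.Empty using (⊥; ⊥-elim)
open import Function using (_∘_; id)
open import Relation.Nullary using (¬_; Dec; yes; no; contradiction; ¬?)
open import Relation.Nullary.Decidable using (_×-dec_; _⊎-dec_)
open import Relation.Unary using (Pred; Decidable)
open import Relation.Binary.PropositionalEquality using (_≡_; _≢_; refl; sym; trans; cong; cong₂; subst; setoid; module ≡-Reasoning)

-- As the degree bound grows, the degree count tends to 2 |T| ≤ 3 (|U| + |M|); the bound 64 with
-- slack 2 is just large enough that a fixed loss of 1/8 is affordable, so no error term is needed.
-- Losing at most 1/8 of the matching to the prefix with high probability requires μ to exceed a
-- multiple of log n. This is free: m ≤ 4 n μ, so a small μ forces a graph small enough to be stored
-- outright. Only memory is bounded, not time. Hence H and the final matching are found by
-- exhaustive search, and H, being determined by B, need not be stored. Probabilities are counts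
-- over `permutations` with denominators cleared: a bound on an expectation reads "sum over
-- orderings times denominator ≤ factorial times numerator", and a supermartingale becomes an
-- induction on the unread edges that averages over the next one.

private variable
  A B : Set
  n : ℕ

-- Finite sums

∑ : List A → (A → ℕ) → ℕ
∑ xs f = sum (map f xs)

∑-cong : (xs : List A) {f g : A → ℕ} → (∀ x → f x ≡ g x) → ∑ xs f ≡ ∑ xs g
∑-cong []       h = refl
∑-cong (x ∷ xs) h = cong₂ _+_ (h x) (∑-cong xs h)

∑-mono-∈ : (xs : List A) {f g : A → ℕ} → (∀ {x} → x ∈ xs → f x ≤ g x) → ∑ xs f ≤ ∑ xs g
∑-mono-∈ []       h = z≤n
∑-mono-∈ (x ∷ xs) h = +-mono-≤ (h (here refl)) (∑-mono-∈ xs (h ∘ there))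

∑-mono : (xs : List A) {f g : A → ℕ} → (∀ x → f x ≤ g x) → ∑ xs f ≤ ∑ xs g
∑-mono xs h = ∑-mono-∈ xs (λ {x} _ → h x)

interchange : ∀ a b c d → (a + b) + (c + d) ≡ (a + c) + (b + d)
interchange = solve-∀

∑-+ : (xs : List A) (f g : A → ℕ) → ∑ xs (λ x → f x + g x) ≡ ∑ xs f + ∑ xs g
∑-+ []       f g = refl
∑-+ (x ∷ xs) f g = trans (cong (f x + g x +_) (∑-+ xs f g)) (interchange (f x) (g x) (∑ xs f) (∑ xs g))

∑-*ˡ : (xs : List A) (c : ℕ) (f : A → ℕ) → ∑ xs (λ x → c * f x) ≡ c * ∑ xs f
∑-*ˡ []       c f = sym (*-zeroʳ c)
∑-*ˡ (x ∷ xs) c f = trans (cong (c * f x +_) (∑-*ˡ xs c f)) (sym (*-distribˡ-+ c (f x) (∑ xs f)))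

∑-*ʳ : (xs : List A) (f : A → ℕ) (c : ℕ) → ∑ xs (λ x → f x * c) ≡ ∑ xs f * c
∑-*ʳ xs f c = trans (∑-cong xs (λ x → *-comm (f x) c)) (trans (∑-*ˡ xs c f) (*-comm c (∑ xs f)))

∑-const : (xs : List A) (c : ℕ) → ∑ xs (λ _ → c) ≡ length xs * c
∑-const []       c = refl
∑-const (x ∷ xs) c = cong (c +_) (∑-const xs c)

∑-zero : (xs : List A) {f : A → ℕ} → (∀ x → f x ≡ 0) → ∑ xs f ≡ 0
∑-zero xs h = trans (∑-cong xs h) (trans (∑-const xs 0) (*-zeroʳ (length xs)))

∑-swap : (xs : List A) (ys : List B) (f : A → B → ℕ) →
         ∑ xs (λ x → ∑ ys (f x)) ≡ ∑ ys (λ y → ∑ xs (λ x → f x y))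
∑-swap []       ys f = sym (∑-zero ys (λ _ → refl))
∑-swap (x ∷ xs) ys f = trans (cong (∑ ys (f x) +_) (∑-swap xs ys f))
                             (sym (∑-+ ys (f x) (λ y → ∑ xs (λ x → f x y))))

∑-++ : (xs ys : List A) (f : A → ℕ) → ∑ (xs ++ ys) f ≡ ∑ xs f + ∑ ys f
∑-++ []       ys f = refl
∑-++ (x ∷ xs) ys f = trans (cong (f x +_) (∑-++ xs ys f)) (sym (+-assoc (f x) (∑ xs f) (∑ ys f)))

∑-map : (h : B → A) (xs : List B) (f : A → ℕ) → ∑ (map h xs) f ≡ ∑ xs (f ∘ h)
∑-map h []       f = refl
∑-map h (x ∷ xs) f = cong (f (h x) +_) (∑-map h xs f)

∑-concatMap : (h : B → List A) (xs : List B) (f : A → ℕ) →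
              ∑ (concatMap h xs) f ≡ ∑ xs (λ x → ∑ (h x) f)
∑-concatMap h []       f = refl
∑-concatMap h (x ∷ xs) f = trans (∑-++ (h x) (concatMap h xs) f) (cong (∑ (h x) f +_) (∑-concatMap h xs f))

∑-↭ : {xs ys : List A} (f : A → ℕ) → xs ↭ ys → ∑ xs f ≡ ∑ ys f
∑-↭ f _↭_.refl        = refl
∑-↭ f (prep x p)      = cong (f x +_) (∑-↭ f p)
∑-↭ f (swap {xs} {ys} x y p) = trans (cong (λ s → f x + (f y + s)) (∑-↭ f p)) (comm₁₂ (f x) (f y) (∑ ys f))
  where
  comm₁₂ : ∀ a b c → a + (b + c) ≡ b + (a + c)
  comm₁₂ = solve-∀
∑-↭ f (_↭_.trans p q) = trans (∑-↭ f p) (∑-↭ f q)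

∑-∈ : {xs : List A} {x : A} (f : A → ℕ) → x ∈ xs → f x ≤ ∑ xs f
∑-∈ f (here refl) = m≤m+n _ _
∑-∈ f (there p)   = ≤-trans (∑-∈ f p) (m≤n+m _ _)

∑≤1 : (xs : List A) {f : A → ℕ} → (∀ {x} → x ∈ xs → f x ≤ 1) →
      AllPairs (λ x y → f x ≡ 0 ⊎ f y ≡ 0) xs → ∑ xs f ≤ 1
∑≤1 []           h []       = z≤n
∑≤1 (x ∷ xs) {f} h (p ∷ ps) with f x ≟ℕ 0
... | yes fx≡0 = ≤-trans (≤-reflexive (cong (_+ ∑ xs f) fx≡0)) (∑≤1 xs (h ∘ there) ps)
... | no  fx≢0 = ≤-trans (≤-reflexive (trans (cong (f x +_) (zeros xs p)) (+-identityʳ (f x)))) (h (here refl))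
  where
  zeros : ∀ ys → All (λ y → f x ≡ 0 ⊎ f y ≡ 0) ys → ∑ ys f ≡ 0
  zeros []       []             = refl
  zeros (y ∷ ys) (inj₁ fx≡0 ∷ _) = contradiction fx≡0 fx≢0
  zeros (y ∷ ys) (inj₂ fy≡0 ∷ q) = cong₂ _+_ fy≡0 (zeros ys q)

∑-vertex : (Fin n → ℕ) → ℕ
∑-vertex {n} f = ∑ (allFin n) f

∑-vertex-suc : (f : Fin (suc n) → ℕ) → ∑-vertex f ≡ f zero + ∑-vertex (f ∘ suc)
∑-vertex-suc {n} f = cong (λ xs → f zero + sum xs) (trans (map-tabulate {n = n} suc f) (sym (map-tabulate {n = n} id (f ∘ suc))))

𝟙 : {P : Set} → Dec P → ℕ
𝟙 (yes _) = 1
𝟙 (no _)  = 0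

𝟙≤1 : {P : Set} (d : Dec P) → 𝟙 d ≤ 1
𝟙≤1 (yes _) = s≤s z≤n
𝟙≤1 (no _)  = z≤n

𝟙-yes : {P : Set} (d : Dec P) → P → 𝟙 d ≡ 1
𝟙-yes (yes _) _ = refl
𝟙-yes (no ¬p) p = contradiction p ¬p

𝟙-no : {P : Set} (d : Dec P) → ¬ P → 𝟙 d ≡ 0
𝟙-no (yes p) ¬p = contradiction p ¬p
𝟙-no (no _)  _  = refl

𝟙-⇔ : {P Q : Set} (d : Dec P) (d′ : Dec Q) → (P → Q) → (Q → P) → 𝟙 d ≡ 𝟙 d′
𝟙-⇔ (yes p) d′ f g = sym (𝟙-yes d′ (f p))
𝟙-⇔ (no ¬p) d′ f g = sym (𝟙-no d′ (¬p ∘ g))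

length-filter : {P : Pred A _} (P? : Decidable P) (xs : List A) → length (filter P? xs) ≡ ∑ xs (𝟙 ∘ P?)
length-filter P? []       = refl
length-filter P? (x ∷ xs) with P? x
... | yes _ = cong suc (length-filter P? xs)
... | no _  = length-filter P? xs

δ : Fin n → Fin n → ℕ
δ a v = 𝟙 (a ≟ v)

∑-δ : (a : Fin n) (g : Fin n → ℕ) → ∑-vertex (λ v → δ a v * g v) ≡ g a
∑-δ {suc n} zero    g = trans (∑-vertex-suc {n} (λ v → δ zero v * g v)) (trans (cong₂ _+_ (+-identityʳ (g zero)) (∑-zero (allFin n) (λ _ → refl))) (+-identityʳ _))
∑-δ {suc n} (suc a) g = trans (∑-vertex-suc {n} (λ v → δ (suc a) v * g v)) (trans (∑-cong (allFin n) shift-δ) (∑-δ a (g ∘ suc)))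
  where
  shift-δ : ∀ v → δ (suc a) (suc v) * g (suc v) ≡ δ a v * g (suc v)
  shift-δ v = cong (_* g (suc v)) (𝟙-⇔ (suc a ≟ suc v) (a ≟ v) suc-injective (cong suc))

-- Degrees and the potential Φ

Ordered : Edge n → Set
Ordered (a , b) = a Fin.< b

ends : Edge n → (Fin n → ℕ) → ℕ
ends (a , b) g = g a + g b

inc : Edge n → Fin n → ℕ
inc (a , b) v = δ a v + δ b v

deg : List (Edge n) → Fin n → ℕ
deg H v = ∑ H (λ e → inc e v)

∑-inc : (e : Edge n) (g : Fin n → ℕ) → ∑-vertex (λ v → inc e v * g v) ≡ ends e g
∑-inc {n} (a , b) g = trans (∑-cong (allFin n) (λ v → *-distribʳ-+ (g v) (δ a v) (δ b v)))
  (trans (∑-+ (allFin n) _ _) (cong₂ _+_ (∑-δ a g) (∑-δ b g)))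

handshake : (H : List (Edge n)) (g : Fin n → ℕ) → ∑-vertex (λ v → deg H v * g v) ≡ ∑ H (λ e → ends e g)
handshake {n} H g = trans (∑-cong (allFin n) (λ v → sym (∑-*ʳ H (λ e → inc e v) (g v))))
  (trans (∑-swap (allFin n) H _) (∑-cong H (λ e → ∑-inc e g)))

handshake₁ : (H : List (Edge n)) → ∑-vertex (deg H) ≡ 2 * length H
handshake₁ {n} H = trans (∑-cong (allFin n) (λ v → sym (*-identityʳ (deg H v))))
  (trans (handshake H (λ _ → 1)) (trans (∑-const H 2) (*-comm (length H) 2)))

inc-self : (e : Edge n) → Ordered e → ends e (inc e) ≡ 2
inc-self (a , b) a<b
  rewrite 𝟙-yes (a ≟ a) refl | 𝟙-yes (b ≟ b) refl
        | 𝟙-no (b ≟ a) (λ { refl → <-irrefl refl a<b }) | 𝟙-no (a ≟ b) (λ { refl → <-irrefl refl a<b }) = refl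

sqdeg : List (Edge n) → ℕ
sqdeg H = ∑-vertex (λ v → deg H v * deg H v)

sqdeg-∷ : (e : Edge n) → Ordered e → (H : List (Edge n)) → sqdeg (e ∷ H) ≡ (2 + 2 * ends e (deg H)) + sqdeg H
sqdeg-∷ {n} e o H = begin
  ∑-vertex (λ v → (inc e v + deg H v) * (inc e v + deg H v))
    ≡⟨ ∑-cong V (λ v → square (inc e v) (deg H v)) ⟩
  ∑-vertex (λ v → (inc e v * inc e v + 2 * (inc e v * deg H v)) + deg H v * deg H v)
    ≡⟨ ∑-+ V _ _ ⟩
  ∑-vertex (λ v → inc e v * inc e v + 2 * (inc e v * deg H v)) + sqdeg H
    ≡⟨ cong (_+ sqdeg H) (∑-+ V _ _) ⟩
  (∑-vertex (λ v → inc e v * inc e v) + ∑-vertex (λ v → 2 * (inc e v * deg H v))) + sqdeg H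
    ≡⟨ cong (_+ sqdeg H) (cong₂ _+_ (trans (∑-inc e (inc e)) (inc-self e o)) (trans (∑-*ˡ V 2 _) (cong (2 *_) (∑-inc e (deg H))))) ⟩
  (2 + 2 * ends e (deg H)) + sqdeg H ∎
  where
  open ≡-Reasoning
  V = allFin n
  square : ∀ a b → (a + b) * (a + b) ≡ (a * a + 2 * (a * b)) + b * b
  square = solve-∀

sublists : List A → List (List A)
sublists []       = [] ∷ []
sublists (x ∷ xs) = map (x ∷_) (sublists xs) ++ sublists xs

∈-sublists⁺ : {xs ys : List A} → xs ⊆ ys → xs ∈ sublists ys
∈-sublists⁺ []         = here refl
∈-sublists⁺ {ys = _ ∷ ys} (_ ∷ʳ p) = ∈-++⁺ʳ (map _ (sublists ys)) (∈-sublists⁺ p)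
∈-sublists⁺ (refl ∷ p) = ∈-++⁺ˡ (∈-map⁺ _ (∈-sublists⁺ p))

∈-sublists⁻ : {xs : List A} (ys : List A) → xs ∈ sublists ys → xs ⊆ ys
∈-sublists⁻ []       (here refl) = []
∈-sublists⁻ (y ∷ ys) p with ∈-++⁻ (map (y ∷_) (sublists ys)) p
... | inj₂ q = y ∷ʳ ∈-sublists⁻ ys q
... | inj₁ q with ∈-map⁻ (y ∷_) q
... | _ , r , refl = refl ∷ ∈-sublists⁻ ys r

-- Adding an edge with degree sum s to H changes Φ by 2 θ - 2 - 2 s = 2 (62 - s). Both thresholds
-- come from this: the gain is at least 2 when s ≤ 61, and an edge of an optimal H has s ≤ 62 before
-- it is counted itself, hence at most 64 afterwards.
θ : ℕ
θ = 63

Φ : List (Edge n) → ℤ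
Φ H = pos (2 * θ * length H) ℤ.- pos (sqdeg H)

difference-≤⁻ : ∀ a b c d → pos a ℤ.- pos b ℤ.≤ pos c ℤ.- pos d → a + d ≤ c + b
difference-≤⁻ a b c d h = ℤ.drop‿+≤+ (begin
  pos (a + d)                                 ≡⟨ trans (ℤ.pos-+ a d) (lhs (pos a) (pos b) (pos d)) ⟩
  (pos a ℤ.- pos b) ℤ.+ (pos b ℤ.+ pos d)    ≤⟨ ℤ.+-monoˡ-≤ (pos b ℤ.+ pos d) h ⟩
  (pos c ℤ.- pos d) ℤ.+ (pos b ℤ.+ pos d)    ≡⟨ rhs (pos c) (pos d) (pos b) ⟩
  pos c ℤ.+ pos b ∎)
  where
  open ℤ.≤-Reasoning
  lhs : ∀ a b d → a ℤ.+ d ≡ (a ℤ.- b) ℤ.+ (b ℤ.+ d)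
  lhs = solveℤ
  rhs : ∀ c d b → (c ℤ.- d) ℤ.+ (b ℤ.+ d) ≡ c ℤ.+ b
  rhs = solveℤ

opaque
  core : List (Edge n) → List (Edge n)
  core B = argmax Φ [] (sublists B)

  core-⊆ : (B : List (Edge n)) → core B ⊆ B
  core-⊆ B = argmax-all Φ {P = _⊆ B} (minimum B) (All.tabulate (∈-sublists⁻ B))

  core-max : {H B : List (Edge n)} → H ⊆ B → 2 * θ * length H + sqdeg (core B) ≤ 2 * θ * length (core B) + sqdeg H
  core-max {n} {H} {B} H⊆B = difference-≤⁻ (2 * θ * length H) (sqdeg H) _ _
    (All.lookup (f[xs]≤f[argmax] {f = Φ} [] (sublists B)) (∈-sublists⁺ H⊆B))

≤-by : ∀ {a b c d} → c ≤ d → a ≡ c → d ≡ b → a ≤ b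
≤-by c≤d refl refl = c≤d

2xy≤x²+y² : ∀ x y → 2 * (x * y) ≤ x * x + y * y
2xy≤x²+y² x y = [ le x y , (λ p → ≤-by (le y x p) (cong (2 *_) (*-comm x y)) (+-comm (y * y) (x * x))) ]′ (≤-total x y)
  where
  le : ∀ x y → x ≤ y → 2 * (x * y) ≤ x * x + y * y
  le x y p with d , refl ← m≤n⇒∃[o]m+o≡n p = m+n≤o⇒m≤o _ (≤-reflexive (square x d))
    where
    square : ∀ x d → 2 * (x * (x + d)) + d * d ≡ x * x + (x + d) * (x + d)
    square = solve-∀

4xy≤4x²+y² : ∀ x y → 4 * y * x ≤ 4 * (x * x) + y * y
4xy≤4x²+y² x y = ≤-by (2xy≤x²+y² (2 * x) y) (lhs x y) (cong (_+ y * y) (rhs x))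
  where
  lhs : ∀ x y → 4 * y * x ≡ 2 * (2 * x * y)
  lhs = solve-∀
  rhs : ∀ x → 2 * x * (2 * x) ≡ 4 * (x * x)
  rhs = solve-∀

deg-↭ : {H H′ : List (Edge n)} → H ↭ H′ → ∀ v → deg H v ≡ deg H′ v
deg-↭ p v = ∑-↭ _ p

ends-cong : (e : Edge n) {g h : Fin n → ℕ} → (∀ v → g v ≡ h v) → ends e g ≡ ends e h
ends-cong (a , b) p = cong₂ _+_ (p a) (p b)

ends-+ : (e : Edge n) (g h : Fin n → ℕ) → ends e (λ v → g v + h v) ≡ ends e g + ends e h
ends-+ (a , b) g h = interchange (g a) (h a) (g b) (h b)

-- Optimality is used against the sublist without `e`: were the degree sum larger, deleting `e`
-- would raise Φ.
core-bounded : (B : List (Edge n)) {e : Edge n} → e ∈ core B → Ordered e → ends e (deg (core B)) ≤ 64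
core-bounded {n} B {e} e∈C o with ys , zs , eq ← ∈-∃++ e∈C = begin
    ends e (deg C)            ≡⟨ ends-cong e (deg-↭ C↭) ⟩
    ends e (deg (e ∷ C′))     ≡⟨ ends-+ e (inc e) (deg C′) ⟩
    ends e (inc e) + ends e (deg C′) ≡⟨ cong (_+ ends e (deg C′)) (inc-self e o) ⟩
    2 + ends e (deg C′)       ≤⟨ +-monoʳ-≤ 2 (*-cancelˡ-≤ 2 (+-cancelˡ-≤ 2 _ _ s≤)) ⟩
    64 ∎
  where
  open ≤-Reasoning
  C = core B
  C′ = ys ++ zs
  C↭ : C ↭ e ∷ C′
  C↭ = subst (_↭ e ∷ C′) (sym eq) (shift e ys zs)
  C′⊆B : C′ ⊆ B
  C′⊆B = ⊆-trans (subst (C′ ⊆_) (sym eq) (++⁺ {as = ys} ⊆-refl (e ∷ʳ ⊆-refl))) (core-⊆ B)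
  sq : sqdeg C ≡ (2 + 2 * ends e (deg C′)) + sqdeg C′
  sq = trans (∑-cong (allFin n) (λ v → cong₂ _*_ (deg-↭ C↭ v) (deg-↭ C↭ v))) (sqdeg-∷ e o C′)
  cancel : ∀ t h s q → t * h + ((2 + 2 * s) + q) ≤ t * suc h + q → 2 + 2 * s ≤ t
  cancel t h s q p = +-cancelˡ-≤ (t * h + q) _ _ (≤-by p (lhs t h s q) (rhs t h q))
    where
    lhs : ∀ t h s q → (t * h + q) + (2 + 2 * s) ≡ t * h + ((2 + 2 * s) + q)
    lhs = solve-∀
    rhs : ∀ t h q → t * (1 + h) + q ≡ (t * h + q) + t
    rhs = solve-∀
  s≤ : 2 + 2 * ends e (deg C′) ≤ 2 * θ
  s≤ = cancel (2 * θ) (length C′) (ends e (deg C′)) (sqdeg C′)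
    (subst (λ l → 2 * θ * length C′ + ((2 + 2 * ends e (deg C′)) + sqdeg C′) ≤ 2 * θ * l + sqdeg C′) (↭-length C↭)
      (subst (λ q → 2 * θ * length C′ + q ≤ 2 * θ * length C + sqdeg C′) sq (core-max C′⊆B)))

Underfull : List (Edge n) → Edge n → Set
Underfull B e = ends e (deg (core B)) < 62

underfull? : (B : List (Edge n)) (e : Edge n) → Dec (Underfull B e)
underfull? B e = ends e (deg (core B)) <? 62

data Chain {A : Set} (U : List A → A → Set) : List A → Set where
  []  : Chain U []
  _∷_ : ∀ {e B} → U B e → Chain U B → Chain U (e ∷ B)

-- This is Φ (core B) ≥ 2 |B| without subtraction. The step compares the new optimum with the old
-- core plus the mistake `e`, which is a sublist of `e ∷ B`.
chain-potential : {B : List (Edge n)} → All Ordered B → Chain Underfull B →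
                  2 * length B + sqdeg (core B) ≤ 2 * θ * length (core B)
chain-potential {n} {[]} [] [] = ≤-by (core-max {H = []} {B = []} []) refl
  (trans (cong (λ q → 2 * θ * length (core {n} []) + q) sq[]) (+-identityʳ _))
  where
  sq[] : sqdeg {n} [] ≡ 0
  sq[] = ∑-zero (allFin n) (λ _ → refl)
chain-potential {n} {e ∷ B} (o ∷ os) (u ∷ c) =
  gain (2 * θ) 61 (length C) (length C′) (sqdeg C) (sqdeg C′) (length B) (ends e (deg C)) refl (≤-pred u)
    (chain-potential os c)
    (subst (λ q → 2 * θ * suc (length C) + sqdeg C′ ≤ 2 * θ * length C′ + q) (sqdeg-∷ e o C) (core-max {H = e ∷ C} {B = e ∷ B} (refl ∷ core-⊆ B)))
  where
  C = core B
  C′ = core (e ∷ B)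
  gain : ∀ t r h h′ q q′ b s → 2 * r + 4 ≡ t → s ≤ r → 2 * b + q ≤ t * h → t * suc h + q′ ≤ t * h′ + ((2 + 2 * s) + q) →
         2 * suc b + q′ ≤ t * h′
  gain t r h h′ q q′ b s refl s≤r p₁ p₂ = +-cancelˡ-≤ (t * h + q + (2 * r + 2)) _ _
    (+-cancelʳ-≤ (2 * s) _ _ (≤-by (+-mono-≤ (+-mono-≤ p₁ p₂) (*-monoʳ-≤ 2 s≤r)) (lhs r h q q′ b s) (rhs r h h′ q s)))
    where
    lhs : ∀ r h q q′ b s → ((2 * r + 4) * h + q + (2 * r + 2)) + (2 * (1 + b) + q′) + 2 * s
          ≡ ((2 * b + q) + ((2 * r + 4) * (1 + h) + q′)) + 2 * s
    lhs = solve-∀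
    rhs : ∀ r h h′ q s → ((2 * r + 4) * h + ((2 * r + 4) * h′ + ((2 + 2 * s) + q))) + 2 * r
          ≡ ((2 * r + 4) * h + q + (2 * r + 2)) + (2 * r + 4) * h′ + 2 * s
    rhs = solve-∀

-- Φ is the sum over the vertices of 63 deg - deg², and each summand is at most 63² / 4. With
-- `chain-potential` this gives 8 |B| ≤ 3969 n, rounded up to 4096 n.
chain-length : {B : List (Edge n)} → All Ordered B → Chain Underfull B → length B ≤ 512 * n
chain-length {n} {B} os c = *-cancelˡ-≤ 8 (begin
  8 * length B                 ≤⟨ +-cancelʳ-≤ (4 * sqdeg C) _ _ (≤-trans bound (≤-reflexive (+-comm (4 * sqdeg C) (n * 3969)))) ⟩
  n * 3969                     ≤⟨ *-monoʳ-≤ n (m≤m+n 3969 127) ⟩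
  n * 4096                     ≡⟨ *-comm n 4096 ⟩
  8 * 512 * n                  ≡⟨ *-assoc 8 512 n ⟩
  8 * (512 * n) ∎)
  where
  open ≤-Reasoning
  C = core B
  scale : ∀ b q t h → 2 * b + q ≤ 2 * t * h → 8 * b + 4 * q ≤ 4 * t * (2 * h)
  scale b q t h p = ≤-by (*-monoʳ-≤ 4 p) (lhs b q) (rhs t h)
    where
    lhs : ∀ b q → 8 * b + 4 * q ≡ 4 * (2 * b + q)
    lhs = solve-∀
    rhs : ∀ t h → 4 * (2 * t * h) ≡ 4 * t * (2 * h)
    rhs = solve-∀
  bound : 8 * length B + 4 * sqdeg C ≤ 4 * sqdeg C + n * 3969
  bound = begin
    8 * length B + 4 * sqdeg C        ≤⟨ scale (length B) (sqdeg C) θ (length C) (chain-potential os c) ⟩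
    4 * θ * (2 * length C)            ≡⟨ cong (4 * θ *_) (sym (handshake₁ C)) ⟩
    4 * θ * ∑-vertex (deg C)          ≡⟨ sym (∑-*ˡ (allFin n) (4 * θ) (deg C)) ⟩
    ∑-vertex (λ v → 4 * θ * deg C v)  ≤⟨ ∑-mono (allFin n) (λ v → 4xy≤4x²+y² (deg C v) θ) ⟩
    ∑-vertex (λ v → 4 * (deg C v * deg C v) + θ * θ)  ≡⟨ ∑-+ (allFin n) _ _ ⟩
    ∑-vertex (λ v → 4 * (deg C v * deg C v)) + ∑-vertex {n} (λ _ → θ * θ)
      ≡⟨ cong₂ _+_ (∑-*ˡ (allFin n) 4 _) (trans (∑-const (allFin n) (θ * θ)) (cong (_* 3969) (length-tabulate {n = n} id))) ⟩
    4 * sqdeg C + n * 3969 ∎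

-- Matchings

∑-filter : {P : Pred A _} (P? : Decidable P) (xs : List A) (f : A → ℕ) →
           ∑ (filter P? xs) f ≡ ∑ xs (λ x → 𝟙 (P? x) * f x)
∑-filter P? []       f = refl
∑-filter P? (x ∷ xs) f with P? x
... | yes _ = cong₂ _+_ (sym (+-identityʳ (f x))) (∑-filter P? xs f)
... | no  _ = ∑-filter P? xs f

∑-pos : (xs : List A) {f : A → ℕ} → 1 ≤ ∑ xs f → ∃ λ x → x ∈ xs × 1 ≤ f x
∑-pos (x ∷ xs) {f} p with f x in eq
... | suc _ = x , here refl , ≤-trans (s≤s z≤n) (≤-reflexive (sym eq))
... | zero with y , y∈ , q ← ∑-pos xs p = y , there y∈ , q

∑-∈₂ : {xs : List A} {x y : A} (f : A → ℕ) → x ∈ xs → y ∈ xs → x ≢ y → f x + f y ≤ ∑ xs f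
∑-∈₂ f (here refl) (here refl) x≢y = contradiction refl x≢y
∑-∈₂ f (here refl) (there q)   x≢y = +-monoʳ-≤ (f _) (∑-∈ f q)
∑-∈₂ {y = y} f (there p) (here refl) x≢y = ≤-trans (≤-reflexive (+-comm _ (f y))) (+-monoʳ-≤ (f y) (∑-∈ f p))
∑-∈₂ f (there p)   (there q)   x≢y = ≤-trans (∑-∈₂ f p q x≢y) (m≤n+m _ _)

-- These are the search space for matchings and also the state space of the algorithm, so that
-- `length-words` bounds the memory.
words : ℕ → List A → List (List A)
words zero    xs = [] ∷ []
words (suc k) xs = [] ∷ concatMap (λ x → map (x ∷_) (words k xs)) xs

∈-concatMap⁺ : {B : Set} (h : A → List B) {xs : List A} {x : A} {y : B} → x ∈ xs → y ∈ h x → y ∈ concatMap h xs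
∈-concatMap⁺ h x∈ y∈ = ∈-concat⁺′ y∈ (∈-map⁺ h x∈)

∈-concatMap⁻ : {B : Set} (h : A → List B) (xs : List A) {y : B} → y ∈ concatMap h xs → ∃ λ x → x ∈ xs × y ∈ h x
∈-concatMap⁻ h xs y∈ with _ , p , q ← ∈-concat⁻′ (map h xs) y∈ with x , x∈ , refl ← ∈-map⁻ h q = x , x∈ , p

∈-words⁺ : ∀ k {xs w : List A} → All (_∈ xs) w → length w ≤ k → w ∈ words k xs
∈-words⁺ zero    []       _       = here refl
∈-words⁺ (suc k) []       _       = here refl
∈-words⁺ (suc k) (p ∷ ps) (s≤s l) = there (∈-concatMap⁺ _ p (∈-map⁺ _ (∈-words⁺ k ps l)))

∈-words⁻ : ∀ k (xs : List A) {w} → w ∈ words k xs → All (_∈ xs) w × length w ≤ k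
∈-words⁻ zero    xs (here refl) = [] , z≤n
∈-words⁻ (suc k) xs (here refl) = [] , z≤n
∈-words⁻ (suc k) xs (there p) with x , x∈ , q ← ∈-concatMap⁻ _ xs p with w , w∈ , refl ← ∈-map⁻ (x ∷_) q
  with all , l ← ∈-words⁻ k xs w∈ = (x∈ ∷ all) , s≤s l

_≟ₑ_ : (e f : Edge n) → Dec (e ≡ f)
_≟ₑ_ = ≡-dec _≟_ _≟_

_∈?_ : (e : Edge n) (M : List (Edge n)) → Dec (e ∈ M)
e ∈? M = Any.any? (e ≟ₑ_) M

-- Matchings in degree form: degrees are additive when edges are added or deleted, so exchanges
-- become arithmetic. The bound also excludes repeated edges.
AtMostOne : List (Edge n) → Set
AtMostOne N = ∀ v → deg N v ≤ 1

inc≤1 : {e : Edge n} → Ordered e → ∀ v → inc e v ≤ 1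
inc≤1 {e = a , b} o v with a ≟ v | b ≟ v
... | yes refl | yes refl = contradiction o (<-irrefl refl)
... | yes _    | no _     = s≤s z≤n
... | no _     | yes _    = s≤s z≤n
... | no _     | no _     = z≤n

disjoint⇒atMostOne : {N : List (Edge n)} → All Ordered N → AllPairs VertexDisjoint N → AtMostOne N
disjoint⇒atMostOne {N = N} os ps v = ∑≤1 N (λ p → inc≤1 (All.lookup os p) v) (AllPairs.map (λ {e} {f} → zeros {e} {f}) ps)
  where
  zeros : ∀ {e f} → VertexDisjoint e f → inc e v ≡ 0 ⊎ inc f v ≡ 0
  zeros {a , b} {c , d} (a≢c , a≢d , b≢c , b≢d) with a ≟ v | b ≟ v
  ... | no _     | no _ = inj₁ refl
  ... | yes refl | _ = inj₂ (cong₂ _+_ (𝟙-no (c ≟ a) (a≢c ∘ sym)) (𝟙-no (d ≟ a) (a≢d ∘ sym)))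
  ... | no _     | yes refl = inj₂ (cong₂ _+_ (𝟙-no (c ≟ b) (b≢c ∘ sym)) (𝟙-no (d ≟ b) (b≢d ∘ sym)))

inc-l : (a b : Fin n) → 1 ≤ inc (a , b) a
inc-l a b = ≤-trans (≤-reflexive (sym (𝟙-yes (a ≟ a) refl))) (m≤m+n _ _)

inc-r : (a b : Fin n) → 1 ≤ inc (a , b) b
inc-r a b = ≤-trans (≤-reflexive (sym (𝟙-yes (b ≟ b) refl))) (m≤n+m _ _)

atMostOne⇒disjoint : (N : List (Edge n)) → AtMostOne N → AllPairs VertexDisjoint N
atMostOne⇒disjoint []       h = []
atMostOne⇒disjoint ((a , b) ∷ N) h =
  All.tabulate disj ∷ atMostOne⇒disjoint N (λ v → ≤-trans (m≤n+m _ (inc (a , b) v)) (h v))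
  where
  clash : ∀ {f} v → f ∈ N → 1 ≤ inc (a , b) v → 1 ≤ inc f v → ⊥
  clash v f∈ p q = <-irrefl refl (≤-trans (+-mono-≤ p (≤-trans q (∑-∈ (λ e → inc e v) f∈))) (h v))
  disj : ∀ {f} → f ∈ N → VertexDisjoint (a , b) f
  disj {c , d} f∈ = (λ { refl → clash a f∈ (inc-l a b) (inc-l a d) }) , (λ { refl → clash a f∈ (inc-l a b) (inc-r c a) })
                  , (λ { refl → clash b f∈ (inc-r a b) (inc-l b d) }) , (λ { refl → clash b f∈ (inc-r a b) (inc-r c b) })

-- An edge with its ends named in either order, whereas a pair fixes one. Only incidences enter the
-- exchanges, so these are what is recorded.
record Joins (e : Edge n) (y z : Fin n) : Set where
  constructor _,_
  field
    distinct : y ≢ z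
    inc-ends : ∀ v → inc e v ≡ δ y v + δ z v

ordered⇒≢ : {a b : Fin n} → Ordered (a , b) → a ≢ b
ordered⇒≢ o refl = <-irrefl refl o

joins : {a b : Fin n} → Ordered (a , b) → Joins (a , b) a b
joins o = ordered⇒≢ o , λ v → refl

joins-sym : {e : Edge n} {y z : Fin n} → Joins e y z → Joins e z y
joins-sym {y = y} {z} (y≢z , h) = y≢z ∘ sym , λ v → trans (h v) (+-comm (δ y v) (δ z v))

joins-end : {e : Edge n} → Ordered e → ∀ v → 1 ≤ inc e v → ∃ λ y → Joins e y v
joins-end {e = a , b} o v p with a ≟ v | b ≟ v
... | yes refl | _        = b , joins-sym (joins o)
... | no _     | yes refl = a , joins o

joins-l : {e : Edge n} {y z : Fin n} → Joins e y z → inc e y ≡ 1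
joins-l {y = y} {z} (y≢z , h) = trans (h y) (cong₂ _+_ (𝟙-yes (y ≟ y) refl) (𝟙-no (z ≟ y) (y≢z ∘ sym)))

joins-r : {e : Edge n} {y z : Fin n} → Joins e y z → inc e z ≡ 1
joins-r = joins-l ∘ joins-sym

joins-other : {e : Edge n} {y z v : Fin n} → Joins e y z → v ≢ y → v ≢ z → inc e v ≡ 0
joins-other {y = y} {z} {v} (_ , h) v≢y v≢z = trans (h v) (cong₂ _+_ (𝟙-no (y ≟ v) (v≢y ∘ sym)) (𝟙-no (z ≟ v) (v≢z ∘ sym)))

away : Fin n → List (Edge n) → List (Edge n)
away y = filter (λ e → inc e y ≟ℕ 0)

𝟙*≤ : {P : Set} (d : Dec P) (m : ℕ) → 𝟙 d * m ≤ m
𝟙*≤ (yes _) m = ≤-reflexive (+-identityʳ m)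
𝟙*≤ (no _)  m = z≤n

deg-away : (y : Fin n) (N : List (Edge n)) → ∀ v → deg (away y N) v ≤ deg N v
deg-away y N v = ≤-trans (≤-reflexive (∑-filter _ N _)) (∑-mono N (λ e → 𝟙*≤ (inc e y ≟ℕ 0) (inc e v)))

deg-away-self : (y : Fin n) (N : List (Edge n)) → deg (away y N) y ≡ 0
deg-away-self y N = trans (∑-filter _ N _) (∑-zero N zeros)
  where
  zeros : ∀ e → 𝟙 (inc e y ≟ℕ 0) * inc e y ≡ 0
  zeros e with inc e y ≟ℕ 0
  ... | yes p = trans (+-identityʳ (inc e y)) p
  ... | no _  = refl

length-away : (y : Fin n) (N : List (Edge n)) → length N ≤ length (away y N) + deg N y
length-away y N = begin
  length N                                        ≡⟨ sym (trans (∑-const N 1) (*-identityʳ _)) ⟩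
  ∑ N (λ _ → 1)                                   ≤⟨ ∑-mono N one ⟩
  ∑ N (λ e → 𝟙 (inc e y ≟ℕ 0) + inc e y)          ≡⟨ ∑-+ N _ _ ⟩
  ∑ N (λ e → 𝟙 (inc e y ≟ℕ 0)) + deg N y          ≡⟨ cong (_+ deg N y) (sym (length-filter _ N)) ⟩
  length (away y N) + deg N y ∎
  where
  open ≤-Reasoning
  one : ∀ e → 1 ≤ 𝟙 (inc e y ≟ℕ 0) + inc e y
  one e with inc e y ≟ℕ 0
  ... | yes _ = s≤s z≤n
  ... | no ¬p = n≢0⇒n>0 ¬p

shared : List (Edge n) → List (Edge n) → ℕ
shared M N = ∑ N (λ e → 𝟙 (e ∈? M))

shared≤length : (M N : List (Edge n)) → shared M N ≤ length N
shared≤length M N = ≤-trans (∑-mono N (λ e → 𝟙≤1 (e ∈? M))) (≤-reflexive (trans (∑-const N 1) (*-identityʳ _)))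

shared-away : (M N : List (Edge n)) (y : Fin n) → (∀ {g} → g ∈ N → g ∈ M → inc g y ≡ 0) → shared M N ≤ shared M (away y N)
shared-away M N y h = ≤-trans (∑-mono-∈ N keep) (≤-reflexive (sym (∑-filter _ N _)))
  where
  keep : ∀ {g} → g ∈ N → 𝟙 (g ∈? M) ≤ 𝟙 (inc g y ≟ℕ 0) * 𝟙 (g ∈? M)
  keep {g} g∈N with g ∈? M
  ... | no _ = z≤n
  ... | yes g∈M = ≤-reflexive (sym (cong (_* 1) (𝟙-yes (inc g y ≟ℕ 0) (h g∈N g∈M))))

module _ {n : ℕ} (L : List (Edge n)) where

  MatchingOff : List (Fin n) → List (Edge n) → Set
  MatchingOff U N = All (_∈ L) N × AtMostOne N × All (λ u → deg N u ≡ 0) U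

  matchingOff? : ∀ U → Decidable (MatchingOff U)
  matchingOff? U N = All.all? (_∈? L) N ×-dec (all? (λ v → deg N v ≤? 1) ×-dec All.all? (λ u → deg N u ≟ℕ 0) U)

  away-off : ∀ {U N} y → MatchingOff U N → MatchingOff (y ∷ U) (away y N)
  away-off {U} {N} y (N⊆L , one , off) =
      All.tabulate (λ e∈ → All.lookup N⊆L (proj₁ (∈-filter⁻ (λ e → inc e y ≟ℕ 0) e∈)))
    , (λ v → ≤-trans (deg-away y N v) (one v))
    , deg-away-self y N ∷ All.map (λ {u} z → n≤0⇒n≡0 (≤-trans (deg-away y N u) (≤-reflexive z))) off

  add-off : ∀ {U N e y z} → MatchingOff U N → e ∈ L → Joins e y z → y ∉ U → z ∉ U → deg N y ≡ 0 → deg N z ≡ 0 →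
            MatchingOff U (e ∷ N)
  add-off {U} {N} {e} {y} {z} (N⊆L , one , off) e∈L j y∉U z∉U y0 z0 =
      e∈L ∷ N⊆L
    , one′
    , All.tabulate (λ {u} u∈ → cong₂ _+_ (joins-other j (λ { refl → y∉U u∈ }) (λ { refl → z∉U u∈ })) (All.lookup off u∈))
    where
    one′ : AtMostOne (e ∷ N)
    one′ v with v ≟ y | v ≟ z
    ... | yes refl | _ = ≤-reflexive (cong₂ _+_ (joins-l j) y0)
    ... | no _ | yes refl = ≤-reflexive (cong₂ _+_ (joins-r j) z0)
    ... | no v≢y | no v≢z = ≤-trans (≤-reflexive (cong (_+ deg N v) (joins-other j v≢y v≢z))) (one v)

  Maximum : List (Fin n) → ℕ → Set
  Maximum U ν = ∀ N → MatchingOff U N → length N ≤ ν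

  MissedBy : List (Fin n) → ℕ → Fin n → List (Edge n) → Set
  MissedBy U ν v N = MatchingOff U N × length N ≡ ν × deg N v ≡ 0

  missedBy? : ∀ U ν v → Decidable (MissedBy U ν v)
  missedBy? U ν v N = matchingOff? U N ×-dec (length N ≟ℕ ν ×-dec deg N v ≟ℕ 0)

  record Stripped (k : ℕ) : Set where
    field
      U       : List (Fin n)
      ν       : ℕ
      size    : length U + ν ≡ k
      maximum : Maximum U ν
      M₀      : List (Edge n)
      M₀-off  : MatchingOff U M₀
      M₀-size : length M₀ ≡ ν
      missed  : ∀ v → v ∉ U → ∃ (MissedBy U ν v)

  -- A vertex `v` outside `U` that every maximum matching avoiding `U` covers is moved into `U`. The
  -- maximum then drops by exactly one, which keeps |U| + ν fixed: deleting the edge at `v` costs at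
  -- most one, and a matching of the old size avoiding `v` would contradict the choice of `v`.
  strip : ∀ ν U → Maximum U ν → (N : List (Edge n)) → MatchingOff U N → length N ≡ ν → Stripped (length U + ν)
  strip zero U mx [] off refl = record
    { U = U ; ν = 0 ; size = refl ; maximum = mx ; M₀ = [] ; M₀-off = off ; M₀-size = refl
    ; missed = λ v _ → [] , off , refl , refl }
  strip (suc ν) U mx N off eq with all? (λ v → Any.any? (v ≟_) U ⊎-dec Any.any? (missedBy? U (suc ν) v) (words (suc ν) L))
  ... | yes h = record
    { U = U ; ν = suc ν ; size = refl ; maximum = mx ; M₀ = N ; M₀-off = off ; M₀-size = eq
    ; missed = λ v v∉U → [ (λ v∈U → contradiction v∈U v∉U) , Any.satisfied ]′ (h v) }
  ... | no ¬h with v , ¬hv ← ¬∀⟶∃¬ n _ (λ v → Any.any? (v ≟_) U ⊎-dec Any.any? (missedBy? U (suc ν) v) (words (suc ν) L)) ¬h =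
    subst Stripped (sym (+-suc (length U) ν))
      (strip ν (v ∷ U) mx′ (away v N) off′ (≤-antisym (mx′ (away v N) off′) (≤-pred (≤-trans (≤-reflexive (sym eq)) enough))))
    where
    off′ : MatchingOff (v ∷ U) (away v N)
    off′ = away-off v off
    enough : length N ≤ suc (length (away v N))
    enough = ≤-trans (length-away v N) (≤-trans (+-monoʳ-≤ _ (proj₁ (proj₂ off) v)) (≤-reflexive (+-comm _ 1)))
    mx′ : Maximum (v ∷ U) ν
    mx′ N′ (N′⊆L , one , v0 ∷ off″) = ≤-pred (≤∧≢⇒< (mx N′ (N′⊆L , one , off″)) λ l →
      ¬hv (inj₂ (lose (∈-words⁺ (suc ν) N′⊆L (≤-reflexive l)) ((N′⊆L , one , off″) , l , v0))))

-- Exchanges between maximum matchings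

module Exchange {n : ℕ} (L : List (Edge n)) (L-ordered : All Ordered L)
                (U : List (Fin n)) (ν : ℕ) (maximum : Maximum L U ν) where

  Max : List (Edge n) → Set
  Max N = MatchingOff L U N × length N ≡ ν

  no-free-edge : ∀ {N e y z} → Max N → e ∈ L → Joins e y z → y ∉ U → z ∉ U → deg N y ≡ 0 → deg N z ≡ 0 → ⊥
  no-free-edge {N} (off , size) e∈L j y∉U z∉U y0 z0 =
    <-irrefl size (maximum _ (add-off L off e∈L j y∉U z∉U y0 z0))

  covered : ∀ {N v} → Max N → deg N v ≢ 0 → deg N v ≡ 1
  covered {N} {v} ((_ , one , _) , _) d≢0 = ≤-antisym (one v) (n≢0⇒n>0 d≢0)

  swap-Max : ∀ {N e y z} → Max N → e ∈ L → Joins e y z → y ∉ U → z ∉ U → deg N z ≡ 0 → Max (e ∷ away y N)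
  swap-Max {N} {e} {y} {z} (off , size) e∈L j y∉U z∉U z0 = off′ , ≤-antisym (maximum _ off′) enough
    where
    off″ = away-off L y off
    off′ : MatchingOff L U (e ∷ away y N)
    off′ = add-off L (proj₁ off″ , proj₁ (proj₂ off″) , All.tail (proj₂ (proj₂ off″))) e∈L j y∉U z∉U (deg-away-self y N)
             (n≤0⇒n≡0 (≤-trans (deg-away y N z) (≤-reflexive z0)))
    enough : ν ≤ suc (length (away y N))
    enough = ≤-trans (≤-reflexive (sym size)) (≤-trans (length-away y N)
      (≤-trans (+-monoʳ-≤ _ (proj₁ (proj₂ off) y)) (≤-reflexive (+-comm _ 1))))

  -- No shared edge is lost: an edge of `N` at `y` lying in `M` would have to be `e`, the only edge
  -- of `M` at `y`, but `e` is not in `N` because `z` is free there.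
  swap-shared : ∀ N {M : List (Edge n)} {e y z} → AtMostOne M → e ∈ M → Joins e y z → deg N z ≡ 0 → shared M N < shared M (e ∷ away y N)
  swap-shared N {M} {e} {y} {z} one e∈M j z0 =
    +-mono-≤ (≤-reflexive (sym (𝟙-yes (e ∈? M) e∈M))) (shared-away M N y untouched)
    where
    untouched : ∀ {g} → g ∈ N → g ∈ M → inc g y ≡ 0
    untouched {g} g∈N g∈M with g ≟ₑ e
    ... | yes refl = contradiction (≤-trans (≤-reflexive (sym (joins-r j))) (≤-trans (∑-∈ (λ f → inc f z) g∈N) (≤-reflexive z0))) λ ()
    ... | no g≢e = n≤0⇒n≡0 (+-cancelʳ-≤ 1 _ 0
      (≤-trans (≤-reflexive (cong (inc g y +_) (sym (joins-l j)))) (≤-trans (∑-∈₂ (λ f → inc f y) g∈M e∈M g≢e) (one y))))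

  touched : ∀ {M v} → Max M → deg M v ≢ 0 → ∃₂ λ g y → g ∈ M × Joins g y v
  touched {M} {v} ((M⊆L , _) , _) d≢0 with g , g∈M , p ← ∑-pos M (n≢0⇒n>0 d≢0)
    with y , j ← joins-end (All.lookup L-ordered (All.lookup M⊆L g∈M)) v p = g , y , g∈M , j

  avoids : ∀ {M g y v} → Max M → g ∈ M → Joins g y v → y ∉ U
  avoids {M} {g} {y} ((_ , _ , off) , _) g∈M j y∈U =
    contradiction (≤-trans (≤-reflexive (sym (joins-l j))) (≤-trans (∑-∈ (λ f → inc f y) g∈M) (≤-reflexive (All.lookup off y∈U)))) λ ()

  -- Gallai's lemma. Of the maximum matchings missing x, one sharing the most edges with M could be
  -- made to share one more by an exchange at a vertex covered by M but not by it.
  module _ {M : List (Edge n)} (Mmax : Max M) {x f f′ : Fin n} (f≢f′ : f ≢ f′)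
           (f0 : deg M f ≡ 0) (f′0 : deg M f′ ≡ 0) (x∉U : x ∉ U) (f∉U : f ∉ U) (f′∉U : f′ ∉ U)
           {e e′ : Edge n} (e∈L : e ∈ L) (e′∈L : e′ ∈ L) (j : Joins e x f) (j′ : Joins e′ x f′) where

    private
      climb : ∀ k N → Max N → deg N x ≡ 0 → ν < k + shared M N → ⊥
      climb zero    N Nmax x0 p = <-irrefl refl (≤-trans p (≤-trans (shared≤length M N) (≤-reflexive (proj₂ Nmax))))
      -- `M` together with `f` and `f′` has total degree 2 ν + 2, while `N` together with `x` has
      -- only 2 ν + 1, so some vertex `v` has more on the left. It is neither `f` nor `f′`, which
      -- `N` covers; hence `M` covers it, `N` misses it, and it is not `x`.
      climb (suc k) N Nmax x0 p with all? (λ v → deg M v + (δ f v + δ f′ v) ≤? deg N v + δ x v)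
      ... | yes h = <-irrefl refl (+-cancelˡ-≤ (2 * ν) 2 1 (begin
          2 * ν + 2                                          ≡⟨ cong (_+ 2) (cong (2 *_) (sym (proj₂ Mmax))) ⟩
          2 * length M + 2                                   ≡⟨ cong₂ _+_ (sym (handshake₁ M)) (sym (cong₂ _+_ (∑-δ₁ f) (∑-δ₁ f′))) ⟩
          ∑-vertex (deg M) + (∑-vertex (δ f) + ∑-vertex (δ f′)) ≡⟨ cong (∑-vertex (deg M) +_) (sym (∑-+ V (δ f) (δ f′))) ⟩
          ∑-vertex (deg M) + ∑-vertex (λ v → δ f v + δ f′ v)  ≡⟨ sym (∑-+ V _ _) ⟩
          ∑-vertex (λ v → deg M v + (δ f v + δ f′ v))        ≤⟨ ∑-mono V h ⟩
          ∑-vertex (λ v → deg N v + δ x v)                   ≡⟨ ∑-+ V _ _ ⟩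
          ∑-vertex (deg N) + ∑-vertex (δ x)                  ≡⟨ cong₂ _+_ (trans (handshake₁ N) (cong (2 *_) (proj₂ Nmax))) (∑-δ₁ x) ⟩
          2 * ν + 1 ∎))
        where
        open ≤-Reasoning
        V = allFin n
        ∑-δ₁ : ∀ a → ∑-vertex (δ a) ≡ 1
        ∑-δ₁ a = trans (∑-cong V (λ v → sym (*-identityʳ (δ a v)))) (∑-δ a (λ _ → 1))
      ... | no ¬h with v , ¬hv ← ¬∀⟶∃¬ n _ (λ v → deg M v + (δ f v + δ f′ v) ≤? deg N v + δ x v) ¬h = exchange
        where
        Nf : deg N f ≡ 1
        Nf = covered Nmax (no-free-edge Nmax e∈L j x∉U f∉U x0)
        Nf′ : deg N f′ ≡ 1
        Nf′ = covered Nmax (no-free-edge Nmax e′∈L j′ x∉U f′∉U x0)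
        v≢f : v ≢ f
        v≢f refl = ¬hv (≤-trans (≤-reflexive (cong₂ _+_ f0 (cong₂ _+_ (𝟙-yes (f ≟ f) refl) (𝟙-no (f′ ≟ f) (f≢f′ ∘ sym)))))
                     (≤-trans (≤-reflexive (sym Nf)) (m≤m+n _ _)))
        v≢f′ : v ≢ f′
        v≢f′ refl = ¬hv (≤-trans (≤-reflexive (cong₂ _+_ f′0 (cong₂ _+_ (𝟙-no (f ≟ f′) f≢f′) (𝟙-yes (f′ ≟ f′) refl))))
                     (≤-trans (≤-reflexive (sym Nf′)) (m≤m+n _ _)))
        gap : deg N v + δ x v < deg M v
        gap = ≤-trans (≰⇒> ¬hv) (≤-reflexive (trans (cong (deg M v +_)
                (cong₂ _+_ (𝟙-no (f ≟ v) (v≢f ∘ sym)) (𝟙-no (f′ ≟ v) (v≢f′ ∘ sym)))) (+-identityʳ _)))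
        N+x≡0 : deg N v + δ x v ≡ 0
        N+x≡0 = n≤0⇒n≡0 (≤-pred (≤-trans gap (proj₁ (proj₂ (proj₁ Mmax)) v)))
        Nv : deg N v ≡ 0
        Nv = m+n≡0⇒m≡0 _ N+x≡0
        x≢v : x ≢ v
        x≢v x≡v = contradiction (trans (sym (m+n≡0⇒n≡0 (deg N v) N+x≡0)) (𝟙-yes (x ≟ v) x≡v)) λ ()
        exchange : ⊥
        exchange with g , y , g∈M , jg ← touched Mmax (λ z → <⇒≢ (≤-trans (s≤s z≤n) gap) (sym z)) = go
          where
          g∈L = All.lookup (proj₁ (proj₁ Mmax)) g∈M
          y∉U = avoids Mmax g∈M jg
          v∉U = avoids Mmax g∈M (joins-sym jg)
          Ny : deg N y ≢ 0
          Ny y0 = no-free-edge Nmax g∈L jg y∉U v∉U y0 Nv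
          x≢y : x ≢ y
          x≢y refl = Ny x0
          go : ⊥
          go = climb k (g ∷ away y N) (swap-Max Nmax g∈L jg y∉U v∉U Nv)
            (cong₂ _+_ (joins-other jg x≢y x≢v) (n≤0⇒n≡0 (≤-trans (deg-away y N x) (≤-reflexive x0))))
            (≤-trans p (≤-trans (≤-reflexive (sym (+-suc k _))) (+-monoʳ-≤ k (swap-shared N (proj₁ (proj₂ (proj₁ Mmax))) g∈M jg Nv))))

    unique-free-neighbour : ∃ (MissedBy L U ν x) → ⊥
    unique-free-neighbour (N , off , size , x0) = climb (suc ν) N (off , size) x0 (m≤m+n (suc ν) _)

  -- Such an edge of `T` can be swapped into `M` at its free end without loss of size, and `M` then
  -- shares more with `T`. The absence of these edges is all that the counting uses of the extremal
  -- choice of `M`.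
  Improvable : List (Edge n) → Edge n → Set
  Improvable M (a , b) = (a , b) ∈ L × a ∉ U × b ∉ U × (deg M a ≡ 0 ⊎ deg M b ≡ 0)

  improvable? : ∀ M → Decidable (Improvable M)
  improvable? M (a , b) = ((a , b) ∈? L) ×-dec (¬? (Any.any? (a ≟_) U) ×-dec (¬? (Any.any? (b ≟_) U) ×-dec
                          ((deg M a ≟ℕ 0) ⊎-dec (deg M b ≟ℕ 0))))

  closest : (T : List (Edge n)) → AtMostOne T → ∀ k M → Max M → ν < k + shared T M →
            ∃ λ M′ → Max M′ × (∀ {e} → e ∈ T → ¬ Improvable M′ e)
  closest T one zero    M Mmax p =
    contradiction (≤-trans p (≤-trans (shared≤length T M) (≤-reflexive (proj₂ Mmax)))) (<-irrefl refl)
  closest T one (suc k) M Mmax p with Any.any? (improvable? M) T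
  ... | no ¬any = M , Mmax , λ e∈T imp → ¬any (lose e∈T imp)
  ... | yes any with (a , b) , e∈T , e∈L , a∉U , b∉U , free ← find any = [ at-a , at-b ]′ free
    where
    o = All.lookup L-ordered e∈L
    continue : ∀ {y z} → Joins (a , b) y z → y ∉ U → z ∉ U → deg M z ≡ 0 →
               ∃ λ M′ → Max M′ × (∀ {e} → e ∈ T → ¬ Improvable M′ e)
    continue {y} j y∉U z∉U z0 = closest T one k ((a , b) ∷ away y M) (swap-Max Mmax e∈L j y∉U z∉U z0)
      (≤-trans p (≤-trans (≤-reflexive (sym (+-suc k _))) (+-monoʳ-≤ k (swap-shared M one e∈T j z0))))
    at-a = λ a0 → continue (joins-sym (joins o)) b∉U a∉U a0
    at-b = λ b0 → continue (joins o) a∉U b∉U b0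

-- Degree counting

-- For `w = λ _ b → t b` this is the adjacency matrix of `H` applied to `t`, that is, the number of
-- neighbours marked by `t`.
spread : (Fin n → Fin n → ℕ) → List (Edge n) → Fin n → ℕ
spread w H v = ∑ H (λ (a , b) → δ a v * w a b + δ b v * w b a)

∑-spread : (w : Fin n → Fin n → ℕ) (H : List (Edge n)) (g : Fin n → ℕ) →
           ∑-vertex (λ v → spread w H v * g v) ≡ ∑ H (λ (a , b) → w a b * g a + w b a * g b)
∑-spread {n} w H g = begin
  ∑-vertex (λ v → spread w H v * g v)
    ≡⟨ ∑-cong V (λ v → sym (∑-*ʳ H _ (g v))) ⟩
  ∑-vertex (λ v → ∑ H (λ (a , b) → (δ a v * w a b + δ b v * w b a) * g v))
    ≡⟨ ∑-swap V H _ ⟩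
  ∑ H (λ (a , b) → ∑-vertex (λ v → (δ a v * w a b + δ b v * w b a) * g v))
    ≡⟨ ∑-cong H (λ (a , b) → trans (∑-cong V (λ v → distrib (δ a v) (δ b v) (w a b) (w b a) (g v)))
         (trans (∑-+ V _ _) (cong₂ _+_ (∑-δ a (λ v → w a b * g v)) (∑-δ b (λ v → w b a * g v))))) ⟩
  ∑ H (λ (a , b) → w a b * g a + w b a * g b) ∎
  where
  open ≡-Reasoning
  V = allFin n
  distrib : ∀ d d′ w w′ g → (d * w + d′ * w′) * g ≡ d * (w * g) + d′ * (w′ * g)
  distrib = solve-∀

∑-spread₁ : (w : Fin n → Fin n → ℕ) (H : List (Edge n)) → ∑-vertex (spread w H) ≡ ∑ H (λ (a , b) → w a b + w b a)
∑-spread₁ {n} w H = trans (∑-cong (allFin n) (λ v → sym (*-identityʳ _)))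
  (trans (∑-spread w H (λ _ → 1)) (∑-cong H (λ (a , b) → cong₂ _+_ (*-identityʳ (w a b)) (*-identityʳ (w b a)))))

spread-≤ : (w : Fin n → Fin n → ℕ) (c : Fin n → ℕ) → (∀ a b → w a b ≤ c a) → ∀ H v → spread w H v ≤ c v * deg H v
spread-≤ w c w≤c H v = ≤-trans (∑-mono H term) (≤-reflexive (∑-*ˡ H (c v) _))
  where
  δ-≤ : ∀ a b → δ a v * w a b ≤ c v * δ a v
  δ-≤ a b with a ≟ v
  ... | yes refl = ≤-trans (≤-reflexive (+-identityʳ _)) (≤-trans (w≤c a b) (≤-reflexive (sym (*-identityʳ (c a)))))
  ... | no _     = z≤n
  term : ∀ ((a , b) : Edge _) → δ a v * w a b + δ b v * w b a ≤ c v * inc (a , b) v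
  term (a , b) = ≤-trans (+-mono-≤ (δ-≤ a b) (δ-≤ b a)) (≤-reflexive (sym (*-distribˡ-+ (c v) (δ a v) (δ b v))))

module DegreeBound {n : ℕ} (H : List (Edge n)) (β : ℕ) .{{_ : NonZero β}}
                   (bounded : ∀ {e} → e ∈ H → ends e (deg H) ≤ β) where

  -- Both sides of Σ t(x) d(x,y) (D x + D y) ≤ β Σ t D are compared with the tangent 4 d² ≥ 4 β d − β² of d² at β / 2.
  degree-bound : (t Y : Fin n → ℕ) (ex : ℕ) → (∀ v → t v ≤ 1) → (∀ v → Y v ≤ 1) →
                 ∑-vertex (spread (λ _ b → t b) H) ≤ ∑-vertex (λ v → spread (λ _ b → t b) H v * Y v) + ex →
                 4 * ∑-vertex (λ v → t v * deg H v) ≤ β * (∑-vertex t + ∑-vertex Y) + 4 * ex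
  degree-bound t Y ex t≤1 Y≤1 leave = begin
      4 * Σt                      ≤⟨ *-monoʳ-≤ 4 (≤-trans (≤-reflexive Σt≡) leave) ⟩
      4 * (Yd + ex)              ≡⟨ *-distribˡ-+ 4 Yd ex ⟩
      4 * Yd + 4 * ex            ≤⟨ +-monoˡ-≤ (4 * ex) (*-cancelˡ-≤ β main) ⟩
      β * (∑-vertex t + ∑-vertex Y) + 4 * ex ∎
    where
    open ≤-Reasoning
    V = allFin n
    D = deg H
    d = spread (λ _ b → t b) H
    Σt = ∑-vertex (λ v → t v * D v)
    Yd = ∑-vertex (λ v → d v * Y v)
    Σt≡ : Σt ≡ ∑-vertex d
    Σt≡ = trans (∑-cong V (λ v → *-comm (t v) (D v))) (trans (handshake H t)
           (trans (∑-cong H (λ (a , b) → +-comm (t a) (t b))) (sym (∑-spread₁ (λ _ b → t b) H))))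
    d≤D : ∀ v → d v ≤ D v
    d≤D v = ≤-trans (spread-≤ (λ _ b → t b) (λ _ → 1) (λ _ b → t≤1 b) H v) (≤-reflexive (+-identityʳ _))
    edges-bound : ∑-vertex (λ v → D v * (t v * D v)) + ∑-vertex (λ v → d v * D v) ≤ β * Σt
    edges-bound = begin
      ∑-vertex (λ v → D v * (t v * D v)) + ∑-vertex (λ v → d v * D v)
        ≡⟨ cong₂ _+_ (handshake H (λ v → t v * D v)) (∑-spread (λ _ b → t b) H D) ⟩
      ∑ H (λ e → ends e (λ v → t v * D v)) + ∑ H (λ (a , b) → t b * D a + t a * D b)
        ≡⟨ sym (∑-+ H _ _) ⟩
      ∑ H (λ (a , b) → (t a * D a + t b * D b) + (t b * D a + t a * D b))
        ≡⟨ ∑-cong H (λ (a , b) → factor (t a) (t b) (D a) (D b)) ⟩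
      ∑ H (λ (a , b) → (t a + t b) * (D a + D b))
        ≤⟨ ∑-mono-∈ H (λ { {a , b} e∈ → ≤-trans (*-monoʳ-≤ (t a + t b) (bounded e∈)) (≤-reflexive (*-comm (t a + t b) β)) }) ⟩
      ∑ H (λ (a , b) → β * (t a + t b))
        ≡⟨ trans (∑-*ˡ H β _) (cong (β *_) (trans (sym (handshake H t)) (∑-cong V (λ v → *-comm (D v) (t v))))) ⟩
      β * Σt ∎
      where
      factor : ∀ t t′ d d′ → (t * d + t′ * d′) + (t′ * d + t * d′) ≡ (t + t′) * (d + d′)
      factor = solve-∀
    tangent : ∀ i x y → i ≤ 1 → x ≤ y → 4 * β * (x * i) ≤ 4 * (x * y) + β * β * i
    tangent zero x y _ _ = ≤-trans (≤-reflexive (trans (cong (4 * β *_) (*-zeroʳ x)) (*-zeroʳ (4 * β)))) z≤n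
    tangent (suc zero) x y (s≤s z≤n) x≤y = begin
      4 * β * (x * 1)              ≡⟨ cong (4 * β *_) (*-identityʳ x) ⟩
      4 * β * x                    ≤⟨ 4xy≤4x²+y² x β ⟩
      4 * (x * x) + β * β          ≤⟨ +-mono-≤ (*-monoʳ-≤ 4 (*-monoʳ-≤ x x≤y)) (≤-reflexive (sym (*-identityʳ (β * β)))) ⟩
      4 * (x * y) + β * β * 1 ∎
    tangent-D : ∀ i x → i ≤ 1 → 4 * β * (i * x) ≤ 4 * (x * (i * x)) + β * β * i
    tangent-D zero x _ = ≤-trans (≤-reflexive (*-zeroʳ (4 * β))) z≤n
    tangent-D (suc zero) x (s≤s z≤n) = ≤-by (tangent 1 x x (s≤s z≤n) ≤-refl)
      (cong (4 * β *_) (trans (+-identityʳ x) (sym (*-identityʳ x)))) (cong (λ z → 4 * (x * z) + β * β * 1) (sym (+-identityʳ x)))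
    sumD : 4 * β * Σt ≤ 4 * ∑-vertex (λ v → D v * (t v * D v)) + β * β * ∑-vertex t
    sumD = ≤-by (∑-mono V (λ v → tangent-D (t v) (D v) (t≤1 v))) (sym (∑-*ˡ V (4 * β) _))
             (trans (∑-+ V _ _) (cong₂ _+_ (∑-*ˡ V 4 _) (∑-*ˡ V (β * β) _)))
    sumd : 4 * β * Yd ≤ 4 * ∑-vertex (λ v → d v * D v) + β * β * ∑-vertex Y
    sumd = ≤-by (∑-mono V (λ v → tangent (Y v) (d v) (D v) (Y≤1 v) (d≤D v))) (sym (∑-*ˡ V (4 * β) _))
             (trans (∑-+ V _ _) (cong₂ _+_ (∑-*ˡ V 4 _) (∑-*ˡ V (β * β) _)))
    -- When the two tangent bounds are added and `edges-bound` is inserted, the terms 4 β `Σt`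
    -- cancel and a bound on `Yd` alone remains.
    main : β * (4 * Yd) ≤ β * (β * (∑-vertex t + ∑-vertex Y))
    main = combine β Σt Yd (∑-vertex (λ v → D v * (t v * D v))) (∑-vertex (λ v → d v * D v)) (∑-vertex t) (∑-vertex Y) sumD sumd edges-bound
      where
      combine : ∀ β Σt Yd P Q t Y → 4 * β * Σt ≤ 4 * P + β * β * t → 4 * β * Yd ≤ 4 * Q + β * β * Y → P + Q ≤ β * Σt →
                β * (4 * Yd) ≤ β * (β * (t + Y))
      combine β Σt Yd P Q t Y p q r = +-cancelˡ-≤ (4 * β * Σt + 4 * (P + Q)) _ _
        (≤-by (+-mono-≤ (+-mono-≤ p q) (*-monoʳ-≤ 4 r)) (lhs β Σt Yd P Q) (rhs β Σt P Q t Y))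
        where
        lhs : ∀ β Σt Yd P Q → 4 * β * Σt + 4 * (P + Q) + β * (4 * Yd) ≡ (4 * β * Σt + 4 * β * Yd) + 4 * (P + Q)
        lhs = solve-∀
        rhs : ∀ β Σt P Q t Y → ((4 * P + β * β * t) + (4 * Q + β * β * Y)) + 4 * (β * Σt) ≡ 4 * β * Σt + 4 * (P + Q) + β * (β * (t + Y))
        rhs = solve-∀

-- The core and the surviving edges contain a large matching

Unique-AllPairs : {A : Set} {R : A → A → Set} (xs : List A) → Unique xs → (∀ {x y} → x ∈ xs → y ∈ xs → x ≢ y → R x y) → AllPairs R xs
Unique-AllPairs []       []       h = []
Unique-AllPairs (x ∷ xs) (u ∷ us) h =
  All.tabulate (λ y∈ → h (here refl) (there y∈) (All.lookup u y∈)) ∷ Unique-AllPairs xs us (λ p q → h (there p) (there q))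

module Counting {n : ℕ} {L : List (Edge n)} (L-ordered : All Ordered L)
                {H : List (Edge n)} (H-unique : Unique H) (H⊆L : ∀ {e} → e ∈ H → e ∈ L)
                (bounded : ∀ {e} → e ∈ H → ends e (deg H) ≤ 64)
                {T : List (Edge n)} (T-one : AtMostOne T) (T-full : ∀ {e} → e ∈ T → e ∈ L ⊎ 62 ≤ ends e (deg H))
                {U : List (Fin n)} {ν : ℕ} (maximum : Maximum L U ν) (missed : ∀ v → v ∉ U → ∃ (MissedBy L U ν v))
                {M : List (Edge n)} (Mmax : Exchange.Max L L-ordered U ν maximum M) (blocked : ∀ {e} → e ∈ T → ¬ Exchange.Improvable L L-ordered U ν maximum M e) where

  open Exchange L L-ordered U ν maximum

  private
    V = allFin n

    IsFree : Fin n → Set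
    IsFree v = v ∉ U × deg M v ≡ 0

    isFree? : Decidable IsFree
    isFree? v = ¬? (Any.any? (v ≟_) U) ×-dec (deg M v ≟ℕ 0)

    u p f D : Fin n → ℕ
    u v = 𝟙 (Any.any? (v ≟_) U)
    p = deg M
    f v = 𝟙 (isFree? v)
    D = deg H

    -- The indices are the values of `u`, `p` and `f` at `v`. Matching on `classify` reduces
    -- inequalities between these indicators to a few numerical cases.
    data Class (v : Fin n) : ℕ → ℕ → ℕ → Set where
      inU  : Class v 1 0 0
      inP  : v ∉ U → Class v 0 1 0
      free : v ∉ U → deg M v ≡ 0 → Class v 0 0 1

    classify : ∀ v → Class v (u v) (p v) (f v)
    classify v with Any.any? (v ≟_) U | deg M v ≟ℕ 0
    ... | yes v∈U | yes d rewrite d = inU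
    ... | yes v∈U | no ¬d = contradiction (All.lookup (proj₂ (proj₂ (proj₁ Mmax))) v∈U) ¬d
    ... | no v∉U  | yes d rewrite d = free v∉U d
    ... | no v∉U  | no ¬d rewrite covered Mmax ¬d = inP v∉U

    -- Marks the pairs with `b` free and `a` outside `U`. In `w a b + w b a` an edge between a
    -- covered and a free vertex counts once, an edge between two free vertices twice.
    w : Fin n → Fin n → ℕ
    w a b = (p a + f a) * f b

    w≤₁ : ∀ a b → w a b ≤ p a + f a
    w≤₁ a b = ≤-trans (*-monoʳ-≤ (p a + f a) (𝟙≤1 (isFree? b))) (≤-reflexive (*-identityʳ _))

    p+f≤1 : ∀ v → p v + f v ≤ 1
    p+f≤1 v with u v | p v | f v | classify v
    ... | _ | _ | _ | inU      = z≤n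
    ... | _ | _ | _ | inP _    = s≤s z≤n
    ... | _ | _ | _ | free _ _ = s≤s z≤n

    w≤₂ : ∀ a b → w b a ≤ f a
    w≤₂ a b = ≤-trans (*-monoˡ-≤ (f a) (p+f≤1 b)) (≤-reflexive (+-identityʳ _))

    -- For the edges of `T` that `w` counts, `t₁` marks the end opposite a free vertex and `t₂` the
    -- free end. They are kept apart because their neighbourhoods differ: up to few exceptions, the
    -- neighbours of `t₁` are covered or in `U`, those of `t₂` are in `U`.
    t₁ t₂ : Fin n → ℕ
    t₁ = spread w T
    t₂ = spread (λ a b → w b a) T

    k : ℕ
    k = ∑ T (λ (a , b) → w a b + w b a)

    *deg≤ : ∀ c v → c * deg T v ≤ c
    *deg≤ c v = ≤-trans (*-monoʳ-≤ c (T-one v)) (≤-reflexive (*-identityʳ c))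

    t₁≤ : ∀ v → t₁ v ≤ p v + f v
    t₁≤ v = ≤-trans (spread-≤ w _ w≤₁ T v) (*deg≤ (p v + f v) v)

    t₂≤ : ∀ v → t₂ v ≤ f v
    t₂≤ v = ≤-trans (spread-≤ (λ a b → w b a) _ w≤₂ T v) (*deg≤ (f v) v)

    no-FF : ∀ {a b} → (a , b) ∈ L → IsFree a → ¬ IsFree b
    no-FF e∈L (a∉U , a0) (b∉U , b0) = no-free-edge Mmax e∈L (joins (All.lookup L-ordered e∈L)) a∉U b∉U a0 b0

    ff≡0 : ∀ {a b} → (a , b) ∈ L → f a * f b ≡ 0
    ff≡0 {a} {b} e∈L with isFree? a | isFree? b
    ... | yes fa | yes fb = contradiction fb (no-FF e∈L fa)
    ... | yes _  | no _   = refl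
    ... | no _   | _      = refl

    X : ℕ
    X = ∑ H (λ (a , b) → f b * p a + f a * p b)

    -- At a covered vertex, edges of `H` to two different free vertices contradict Gallai's lemma,
    -- and two entries of `H` with the same ends contradict `H-unique`.
    free-degree≤1 : ∀ v → spread (λ _ b → f b) H v * p v ≤ p v
    free-degree≤1 v with u v | p v in pv | f v | classify v
    ... | _ | _ | _ | inU      = ≤-reflexive (*-zeroʳ (spread (λ _ b → f b) H v))
    ... | _ | _ | _ | free _ _ = ≤-reflexive (*-zeroʳ (spread (λ _ b → f b) H v))
    ... | _ | _ | _ | inP v∉U  = ≤-trans (≤-reflexive (*-identityʳ _)) (∑≤1 H ≤1 (Unique-AllPairs H H-unique exclusive))
      where
      o : ∀ {e} → e ∈ H → Ordered e
      o e∈ = All.lookup L-ordered (H⊆L e∈)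
      term : Edge n → ℕ
      term (a , b) = δ a v * f b + δ b v * f a
      ≤1 : ∀ {e} → e ∈ H → term e ≤ 1
      ≤1 {a , b} e∈ = ≤-trans (+-mono-≤ (*-monoʳ-≤ (δ a v) (𝟙≤1 (isFree? b))) (*-monoʳ-≤ (δ b v) (𝟙≤1 (isFree? a))))
                      (≤-trans (≤-reflexive (cong₂ _+_ (*-identityʳ (δ a v)) (*-identityʳ (δ b v)))) (inc≤1 {e = a , b} (o e∈) v))
      free-end : ∀ {e} → e ∈ H → term e ≡ 0 ⊎ ∃ λ x → Joins e v x × IsFree x
      free-end {a , b} e∈ with a ≟ v | b ≟ v | isFree? a | isFree? b
      ... | yes refl | _        | _      | yes fb = inj₂ (b , joins (o e∈) , fb)
      ... | no _     | yes refl | yes fa | _      = inj₂ (a , joins-sym (joins (o e∈)) , fa)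
      ... | yes refl | yes refl | _      | _      = contradiction refl (ordered⇒≢ (o e∈))
      ... | yes refl | no _     | _      | no _   = inj₁ refl
      ... | no _     | no _     | _      | _      = inj₁ refl
      ... | no _     | yes refl | no _   | _      = inj₁ refl
      same-edge : ∀ {e e′ x} → e ∈ H → e′ ∈ H → Joins e v x → Joins e′ v x → e ≡ e′
      same-edge {a , b} {a′ , b′} {x} e∈ e′∈ j j′ = same (o e∈) (o e′∈) (ends-of j) (ends-of j′)
        where
        ends-of : ∀ {a b} → Joins (a , b) v x → (a ≡ v × b ≡ x) ⊎ (a ≡ x × b ≡ v)
        ends-of {a} {b} j with a ≟ v | b ≟ v | a ≟ x | b ≟ x | joins-l j | joins-r j
        ... | yes p | _     | _     | yes q | _  | _  = inj₁ (p , q)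
        ... | _     | yes p | yes q | _     | _  | _  = inj₂ (q , p)
        ... | no _  | no _  | _     | _     | () | _
        ... | _     | _     | no _  | no _  | _  | ()
        ... | yes p | no _  | yes q | no _  | _  | _  = contradiction (trans (sym p) q) (Joins.distinct j)
        ... | no _  | yes p | no _  | yes q | _  | _  = contradiction (trans (sym p) q) (Joins.distinct j)
        same : ∀ {a b a′ b′} → Ordered (a , b) → Ordered (a′ , b′) → (a ≡ v × b ≡ x) ⊎ (a ≡ x × b ≡ v) →
               (a′ ≡ v × b′ ≡ x) ⊎ (a′ ≡ x × b′ ≡ v) → (a , b) ≡ (a′ , b′)
        same _ _  (inj₁ (refl , refl)) (inj₁ (refl , refl)) = refl
        same _ _  (inj₂ (refl , refl)) (inj₂ (refl , refl)) = refl
        same o o′ (inj₁ (refl , refl)) (inj₂ (refl , refl)) = contradiction o′ (<-asym o)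
        same o o′ (inj₂ (refl , refl)) (inj₁ (refl , refl)) = contradiction o′ (<-asym o)
      exclusive : ∀ {e e′} → e ∈ H → e′ ∈ H → e ≢ e′ → term e ≡ 0 ⊎ term e′ ≡ 0
      exclusive e∈ e′∈ e≢e′ with free-end e∈ | free-end e′∈
      ... | inj₁ z | _ = inj₁ z
      ... | inj₂ _ | inj₁ z = inj₂ z
      ... | inj₂ (x , j , x∉U , x0) | inj₂ (x′ , j′ , x′∉U , x′0) with x ≟ x′
      ...   | yes refl = contradiction (same-edge e∈ e′∈ j j′) e≢e′
      ...   | no x≢x′ = ⊥-elim (unique-free-neighbour Mmax x≢x′ x0 x′0 v∉U x∉U x′∉U (H⊆L e∈) (H⊆L e′∈) j j′ (missed v v∉U))

    X≤2ν : X ≤ 2 * ν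
    X≤2ν = begin
      X                                                  ≡⟨ sym (∑-spread (λ _ b → f b) H p) ⟩
      ∑-vertex (λ v → spread (λ _ b → f b) H v * p v)    ≤⟨ ∑-mono V free-degree≤1 ⟩
      ∑-vertex p                                         ≡⟨ trans (handshake₁ M) (cong (2 *_) (proj₂ Mmax)) ⟩
      2 * ν ∎
      where open ≤-Reasoning

    -- The last hypothesis says that edges from `t` to the complement `Z` of `Y` run between covered
    -- and free vertices. There are at most 2 ν of these in `H`, one for each covered vertex.
    leave-bound : (t Y Z : Fin n → ℕ) → (∀ v → Y v + Z v ≡ 1) → (∀ {a b} → (a , b) ∈ L → t b * Z a + t a * Z b ≤ f b * p a + f a * p b) →
                  ∑-vertex (spread (λ _ b → t b) H) ≤ ∑-vertex (λ v → spread (λ _ b → t b) H v * Y v) + 2 * ν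
    leave-bound t Y Z Y+Z≡1 h = begin
      ∑-vertex d                                                       ≡⟨ ∑-cong V (λ v → sym (trans (cong (d v *_) (Y+Z≡1 v)) (*-identityʳ (d v)))) ⟩
      ∑-vertex (λ v → d v * (Y v + Z v))                               ≡⟨ trans (∑-cong V (λ v → *-distribˡ-+ (d v) (Y v) (Z v))) (∑-+ V _ _) ⟩
      ∑-vertex (λ v → d v * Y v) + ∑-vertex (λ v → d v * Z v)          ≤⟨ +-monoʳ-≤ _ (≤-trans (≤-reflexive (∑-spread (λ _ b → t b) H Z)) (≤-trans (∑-mono-∈ H (λ e∈ → h (H⊆L e∈))) X≤2ν)) ⟩
      ∑-vertex (λ v → d v * Y v) + 2 * ν ∎
      where
      open ≤-Reasoning
      d = spread (λ _ b → t b) H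

    partition : ∀ v → (u v + p v) + f v ≡ 1
    partition v with u v | p v | f v | classify v
    ... | _ | _ | _ | inU      = refl
    ... | _ | _ | _ | inP _    = refl
    ... | _ | _ | _ | free _ _ = refl

    leave₁ : ∑-vertex (spread (λ _ b → t₁ b) H) ≤ ∑-vertex (λ v → spread (λ _ b → t₁ b) H v * (u v + p v)) + 2 * ν
    leave₁ = leave-bound t₁ (λ v → u v + p v) f partition λ {a} {b} e∈ → ≤-trans
      (+-mono-≤ (*-monoˡ-≤ (f a) (t₁≤ b)) (*-monoˡ-≤ (f b) (t₁≤ a)))
      (≤-reflexive (trans (expand (p a) (f a) (p b) (f b)) (trans (cong (λ z → f b * p a + f a * p b + 2 * z) (ff≡0 e∈)) (+-identityʳ _))))
      where
      expand : ∀ p f p′ f′ → (p′ + f′) * f + (p + f) * f′ ≡ f′ * p + f * p′ + 2 * (f * f′)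
      expand = solve-∀

    leave₂ : ∑-vertex (spread (λ _ b → t₂ b) H) ≤ ∑-vertex (λ v → spread (λ _ b → t₂ b) H v * u v) + 2 * ν
    leave₂ = leave-bound t₂ u (λ v → p v + f v) (λ v → trans (sym (+-assoc (u v) (p v) (f v))) (partition v)) λ {a} {b} e∈ → ≤-trans
      (+-mono-≤ (*-monoˡ-≤ (p a + f a) (t₂≤ b)) (*-monoˡ-≤ (p b + f b) (t₂≤ a)))
      (≤-reflexive (trans (expand (p a) (f a) (p b) (f b)) (trans (cong (λ z → f b * p a + f a * p b + 2 * z) (ff≡0 e∈)) (+-identityʳ _))))
      where
      expand : ∀ p f p′ f′ → f′ * (p + f) + f * (p′ + f′) ≡ f′ * p + f * p′ + 2 * (f * f′)
      expand = solve-∀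

    u+p≤1 : ∀ v → u v + p v ≤ 1
    u+p≤1 v = ≤-trans (m≤m+n _ (f v)) (≤-reflexive (partition v))

    S₁ S₂ : ℕ
    S₁ = ∑-vertex (λ v → t₁ v * D v)
    S₂ = ∑-vertex (λ v → t₂ v * D v)

    bound₁ : 4 * S₁ ≤ 64 * (∑-vertex t₁ + ∑-vertex (λ v → u v + p v)) + 4 * (2 * ν)
    bound₁ = DegreeBound.degree-bound H 64 bounded t₁ (λ v → u v + p v) (2 * ν) (λ v → ≤-trans (t₁≤ v) (p+f≤1 v)) u+p≤1 leave₁

    bound₂ : 4 * S₂ ≤ 64 * (∑-vertex t₂ + ∑-vertex u) + 4 * (2 * ν)
    bound₂ = DegreeBound.degree-bound H 64 bounded t₂ u (2 * ν) (λ v → ≤-trans (t₂≤ v) (𝟙≤1 (isFree? v))) (λ v → 𝟙≤1 (Any.any? (v ≟_) U)) leave₂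

    ∑t₁ : ∑-vertex t₁ ≡ k
    ∑t₁ = ∑-spread₁ w T

    ∑t₂ : ∑-vertex t₂ ≡ k
    ∑t₂ = trans (∑-spread₁ (λ a b → w b a) T) (∑-cong T (λ (a , b) → +-comm (w b a) (w a b)))

    ∑u≤ : ∑-vertex u ≤ length U
    ∑u≤ = begin
      ∑-vertex u                             ≤⟨ ∑-mono V count ⟩
      ∑-vertex (λ v → ∑ U (λ x → δ x v))     ≡⟨ ∑-swap V U (λ v x → δ x v) ⟩
      ∑ U (λ x → ∑-vertex (δ x))             ≡⟨ ∑-cong U (λ x → trans (∑-cong V (λ v → sym (*-identityʳ (δ x v)))) (∑-δ x (λ _ → 1))) ⟩
      ∑ U (λ _ → 1)                          ≡⟨ trans (∑-const U 1) (*-identityʳ _) ⟩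
      length U ∎
      where
      open ≤-Reasoning
      count : ∀ v → u v ≤ ∑ U (λ x → δ x v)
      count v with Any.any? (v ≟_) U
      ... | no _    = z≤n
      ... | yes v∈U = ≤-trans (≤-reflexive (sym (𝟙-yes (v ≟ v) refl))) (∑-∈ (λ x → δ x v) v∈U)

    ∑p : ∑-vertex p ≡ 2 * ν
    ∑p = trans (handshake₁ M) (cong (2 *_) (proj₂ Mmax))

    -- An edge of `T` with nonzero weight avoids `U` and has a free end. If it were in `L` it would
    -- be `Improvable`; so it is not, and its degree sum is at least 62.
    full : ∀ {a b} → (a , b) ∈ T → (w a b + w b a) * 62 ≤ (w a b + w b a) * (D a + D b)
    full {a} {b} e∈T with T-full e∈T
    ... | inj₂ 62≤ = *-monoʳ-≤ (w a b + w b a) 62≤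
    ... | inj₁ e∈L = ≤-trans (≤-reflexive (cong (_* 62) (cong₂ _+_ wab≡0 wba≡0))) z≤n
      where
      wab≡0 : w a b ≡ 0
      wab≡0 with u a | p a | f a | classify a | isFree? b
      ... | _ | _ | _ | inU | _ = refl
      ... | _ | _ | _ | inP a∉U | yes (b∉U , b0) = contradiction (e∈L , a∉U , b∉U , inj₂ b0) (blocked e∈T)
      ... | _ | _ | _ | free a∉U _ | yes (b∉U , b0) = contradiction (e∈L , a∉U , b∉U , inj₂ b0) (blocked e∈T)
      ... | _ | _ | _ | inP _ | no _ = refl
      ... | _ | _ | _ | free _ _ | no _ = refl
      wba≡0 : w b a ≡ 0
      wba≡0 with u b | p b | f b | classify b | isFree? a
      ... | _ | _ | _ | inU | _ = refl
      ... | _ | _ | _ | inP b∉U | yes (a∉U , a0) = contradiction (e∈L , a∉U , b∉U , inj₁ a0) (blocked e∈T)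
      ... | _ | _ | _ | free b∉U _ | yes (a∉U , a0) = contradiction (e∈L , a∉U , b∉U , inj₁ a0) (blocked e∈T)
      ... | _ | _ | _ | inP _ | no _ = refl
      ... | _ | _ | _ | free _ _ | no _ = refl

    k*62≤ : k * 62 ≤ S₁ + S₂
    k*62≤ = begin
      k * 62                                                                ≡⟨ sym (∑-*ʳ T _ 62) ⟩
      ∑ T (λ (a , b) → (w a b + w b a) * 62)                                ≤⟨ ∑-mono-∈ T full ⟩
      ∑ T (λ (a , b) → (w a b + w b a) * (D a + D b))                       ≡⟨ ∑-cong T (λ (a , b) → expand (w a b) (w b a) (D a) (D b)) ⟩
      ∑ T (λ (a , b) → (w a b * D a + w b a * D b) + (w b a * D a + w a b * D b)) ≡⟨ ∑-+ T _ _ ⟩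
      ∑ T (λ (a , b) → w a b * D a + w b a * D b) + ∑ T (λ (a , b) → w b a * D a + w a b * D b)
        ≡⟨ cong₂ _+_ (sym (∑-spread w T D)) (sym (∑-spread (λ a b → w b a) T D)) ⟩
      S₁ + S₂ ∎
      where
      open ≤-Reasoning
      expand : ∀ w w′ d d′ → (w + w′) * (d + d′) ≡ (w * d + w′ * d′) + (w′ * d + w * d′)
      expand = solve-∀

    -- A charging scheme: an end in `U` pays 2, a covered end pays 1, and `w` supplies what is
    -- missing, 1 for a covered and a free end, 2 for two free ends.
    cover : ∀ a b → 2 ≤ (2 * (u a + u b) + (p a + p b)) + (w a b + w b a)
    cover a b with u a | p a | f a | classify a | u b | p b | f b | classify b
    ... | _ | _ | _ | inU      | _ | _ | _ | inU      = s≤s (s≤s z≤n)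
    ... | _ | _ | _ | inU      | _ | _ | _ | inP _    = s≤s (s≤s z≤n)
    ... | _ | _ | _ | inU      | _ | _ | _ | free _ _ = s≤s (s≤s z≤n)
    ... | _ | _ | _ | inP _    | _ | _ | _ | inU      = s≤s (s≤s z≤n)
    ... | _ | _ | _ | inP _    | _ | _ | _ | inP _    = s≤s (s≤s z≤n)
    ... | _ | _ | _ | inP _    | _ | _ | _ | free _ _ = s≤s (s≤s z≤n)
    ... | _ | _ | _ | free _ _ | _ | _ | _ | inU      = s≤s (s≤s z≤n)
    ... | _ | _ | _ | free _ _ | _ | _ | _ | inP _    = s≤s (s≤s z≤n)
    ... | _ | _ | _ | free _ _ | _ | _ | _ | free _ _ = s≤s (s≤s z≤n)

    once : (g : Fin n → ℕ) → ∑ T (λ (a , b) → g a + g b) ≤ ∑-vertex g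
    once g = ≤-trans (≤-reflexive (sym (handshake T g)))
      (∑-mono V (λ v → ≤-trans (*-monoˡ-≤ (g v) (T-one v)) (≤-reflexive (+-identityʳ (g v)))))

    2T≤ : 2 * length T ≤ (2 * length U + 2 * ν) + k
    2T≤ = begin
      2 * length T                                    ≡⟨ trans (*-comm 2 (length T)) (sym (∑-const T 2)) ⟩
      ∑ T (λ _ → 2)                                   ≤⟨ ∑-mono T (λ (a , b) → cover a b) ⟩
      ∑ T (λ (a , b) → (2 * (u a + u b) + (p a + p b)) + (w a b + w b a)) ≡⟨ trans (∑-+ T _ _) (cong (_+ k) (∑-+ T _ _)) ⟩
      (∑ T (λ (a , b) → 2 * (u a + u b)) + ∑ T (λ (a , b) → p a + p b)) + k
        ≤⟨ +-monoˡ-≤ k (+-mono-≤ (≤-trans (≤-reflexive (∑-*ˡ T 2 _)) (*-monoʳ-≤ 2 (≤-trans (once u) ∑u≤))) (≤-trans (once p) (≤-reflexive ∑p))) ⟩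
      (2 * length U + 2 * ν) + k ∎
      where open ≤-Reasoning

    -- The two degree bounds against 4 · 62 k leave 120 k ≤ 128 u + 144 ν. Hence 240 t ≤ 368 u + 384
    -- ν, rounded up to 384 (u + ν), and everything is divided by 48.
    arith : ∀ k s₁ s₂ u ν t → k * 62 ≤ s₁ + s₂ → 4 * s₁ ≤ 64 * (k + (u + 2 * ν)) + 4 * (2 * ν) → 4 * s₂ ≤ 64 * (k + u) + 4 * (2 * ν) →
            2 * t ≤ (2 * u + 2 * ν) + k → 5 * t ≤ 8 * (u + ν)
    arith k s₁ s₂ u ν t h h₁ h₂ ht = *-cancelˡ-≤ 48 (+-cancelˡ-≤ (120 * k) _ _ (begin
        120 * k + 48 * (5 * t)                                ≡⟨ e₁ k t ⟩
        120 * (2 * t) + 120 * k                               ≤⟨ +-monoˡ-≤ (120 * k) (*-monoʳ-≤ 120 ht) ⟩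
        120 * ((2 * u + 2 * ν) + k) + 120 * k                 ≤⟨ +-monoʳ-≤ (120 * ((2 * u + 2 * ν) + k)) k≤ ⟩
        120 * ((2 * u + 2 * ν) + k) + (128 * u + 144 * ν)     ≤⟨ m≤m+n _ (16 * u) ⟩
        120 * ((2 * u + 2 * ν) + k) + (128 * u + 144 * ν) + 16 * u ≡⟨ e₂ k u ν ⟩
        120 * k + 48 * (8 * (u + ν)) ∎))
      where
      open ≤-Reasoning
      e₁ : ∀ k t → 120 * k + 48 * (5 * t) ≡ 120 * (2 * t) + 120 * k
      e₁ = solve-∀
      e₂ : ∀ k u ν → 120 * ((2 * u + 2 * ν) + k) + (128 * u + 144 * ν) + 16 * u ≡ 120 * k + 48 * (8 * (u + ν))
      e₂ = solve-∀
      e₃ : ∀ k → 128 * k + 120 * k ≡ 4 * (k * 62)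
      e₃ = solve-∀
      e₄ : ∀ k u ν → (64 * (k + (u + 2 * ν)) + 4 * (2 * ν)) + (64 * (k + u) + 4 * (2 * ν)) ≡ 128 * k + (128 * u + 144 * ν)
      e₄ = solve-∀
      k≤ : 120 * k ≤ 128 * u + 144 * ν
      k≤ = +-cancelˡ-≤ (128 * k) _ _ (begin
        128 * k + 120 * k       ≡⟨ e₃ k ⟩
        4 * (k * 62)            ≤⟨ *-monoʳ-≤ 4 h ⟩
        4 * (s₁ + s₂)           ≡⟨ *-distribˡ-+ 4 s₁ s₂ ⟩
        4 * s₁ + 4 * s₂         ≤⟨ +-mono-≤ h₁ h₂ ⟩
        (64 * (k + (u + 2 * ν)) + 4 * (2 * ν)) + (64 * (k + u) + 4 * (2 * ν)) ≡⟨ e₄ k u ν ⟩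
        128 * k + (128 * u + 144 * ν) ∎)

  counting : 5 * length T ≤ 8 * (length U + ν)
  counting = arith k S₁ S₂ (length U) ν (length T) k*62≤
    (≤-trans bound₁ (+-monoˡ-≤ _ (*-monoʳ-≤ 64 (+-mono-≤ (≤-reflexive ∑t₁) (≤-trans (≤-reflexive (∑-+ V u p)) (+-mono-≤ ∑u≤ (≤-reflexive ∑p)))))))
    (≤-trans bound₂ (+-monoˡ-≤ _ (*-monoʳ-≤ 64 (+-mono-≤ (≤-reflexive ∑t₂) ∑u≤))))
    2T≤

-- Stripping keeps |U| + ν equal to the size of the maximum matching `N`, so the charge against |U|
-- + ν bounds |N|. Edges of `T` outside `L` take part through their degree sum in `H` only.
sparsifier : {L : List (Edge n)} → All Ordered L →
             {H : List (Edge n)} → Unique H → (∀ {e} → e ∈ H → e ∈ L) → (∀ {e} → e ∈ H → ends e (deg H) ≤ 64) →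
             {T : List (Edge n)} → AtMostOne T → (∀ {e} → e ∈ T → e ∈ L ⊎ 62 ≤ ends e (deg H)) →
             {N : List (Edge n)} → MatchingOff L [] N → Maximum L [] (length N) → 5 * length T ≤ 8 * length N
sparsifier {L = L} L-ordered H-unique H⊆L bounded {T} T-one T-full {N} N-off N-max
  with record { U = U ; ν = ν ; size = size ; maximum = maximum ; M₀ = M₀ ; M₀-off = M₀-off ; M₀-size = M₀-size ; missed = missed }
       ← strip L (length N) [] N-max N N-off refl
  with M , Mmax , blocked ← Exchange.closest L L-ordered U ν maximum T T-one (suc ν) M₀ (M₀-off , M₀-size) (m≤m+n (suc ν) _) =
  subst (λ m → 5 * length T ≤ 8 * m) size
    (Counting.counting L-ordered H-unique H⊆L bounded T-one T-full maximum missed Mmax blocked)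

-- Uniformly random orderings

insertions-↭ : ∀ (x : A) ys {σ} → σ ∈ insertions x ys → σ ↭ x ∷ ys
insertions-↭ x []       (here refl) = ↭-refl
insertions-↭ x (y ∷ ys) (here refl) = ↭-refl
insertions-↭ x (y ∷ ys) (there p) with τ , τ∈ , refl ← ∈-map⁻ (y ∷_) p =
  ↭-trans (prep y (insertions-↭ x ys τ∈)) (swap y x ↭-refl)

permutations-↭ : ∀ (xs : List A) {σ} → σ ∈ permutations xs → σ ↭ xs
permutations-↭ []       (here refl) = ↭-refl
permutations-↭ (x ∷ xs) p with τ , τ∈ , σ∈ ← ∈-concatMap⁻ (insertions x) (permutations xs) p =
  ↭-trans (insertions-↭ x τ σ∈) (prep x (permutations-↭ xs τ∈))

∑-1 : (xs : List A) → ∑ xs (λ _ → 1) ≡ length xs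
∑-1 xs = trans (∑-const xs 1) (*-identityʳ _)

length-insertions : ∀ (x : A) ys → length (insertions x ys) ≡ suc (length ys)
length-insertions x []       = refl
length-insertions x (y ∷ ys) = cong suc (trans (length-map (y ∷_) (insertions x ys)) (length-insertions x ys))

∑-cong-∈ : (xs : List A) {f g : A → ℕ} → (∀ {x} → x ∈ xs → f x ≡ g x) → ∑ xs f ≡ ∑ xs g
∑-cong-∈ xs h = ≤-antisym (∑-mono-∈ xs (≤-reflexive ∘ h)) (∑-mono-∈ xs (≤-reflexive ∘ sym ∘ h))

length-permutations : (xs : List A) → length (permutations xs) ≡ length xs !
length-permutations []       = refl
length-permutations (x ∷ xs) = begin
  length (concatMap (insertions x) P)             ≡⟨ sym (∑-1 (concatMap (insertions x) P)) ⟩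
  ∑ (concatMap (insertions x) P) (λ _ → 1)        ≡⟨ ∑-concatMap (insertions x) P _ ⟩
  ∑ P (λ σ → ∑ (insertions x σ) (λ _ → 1))        ≡⟨ ∑-cong-∈ P (λ {σ} σ∈ → trans (∑-1 (insertions x σ))
                                                       (trans (length-insertions x σ) (cong suc (↭-length (permutations-↭ xs σ∈))))) ⟩
  ∑ P (λ _ → suc (length xs))                     ≡⟨ ∑-const P _ ⟩
  length P * suc (length xs)                      ≡⟨ cong (_* suc (length xs)) (length-permutations xs) ⟩
  length xs ! * suc (length xs)                   ≡⟨ *-comm (length xs !) _ ⟩
  suc (length xs) * length xs ! ∎
  where
  open ≡-Reasoning
  P = permutations xs

select : List A → List (A × List A)
select []       = []
select (x ∷ xs) = (x , xs) ∷ map (λ (y , ys) → y , x ∷ ys) (select xs)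

select-↭ : (xs : List A) → ∀ {y ys} → (y , ys) ∈ select xs → xs ↭ y ∷ ys
select-↭ (x ∷ xs) (here refl) = ↭-refl
select-↭ (x ∷ xs) (there p) with (y , ys) , q , refl ← ∈-map⁻ _ p = ↭-trans (prep x (select-↭ xs q)) (swap x y ↭-refl)

∑-select₁ : (xs : List A) (g : A → ℕ) → ∑ (select xs) (λ (y , _) → g y) ≡ ∑ xs g
∑-select₁ []       g = refl
∑-select₁ (x ∷ xs) g = cong (g x +_) (trans (∑-map _ (select xs) _) (∑-select₁ xs g))

∑-insertions : (x y : A) (ys : List A) (f : List A → ℕ) →
               ∑ (insertions x (y ∷ ys)) f ≡ f (x ∷ y ∷ ys) + ∑ (insertions x ys) (λ σ → f (y ∷ σ))
∑-insertions x y ys f = cong (f (x ∷ y ∷ ys) +_) (∑-map (y ∷_) (insertions x ys) f)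

-- `permutations` builds orderings by insertion, but a stream is read from the front. Inserting `x`
-- either puts it first or keeps the old head `y`; in the latter case the tails are the orderings of
-- the remaining entries with `x` put back.
∑-permutations : (x : A) (xs : List A) (f : List A → ℕ) →
                 ∑ (permutations (x ∷ xs)) f ≡ ∑ (select (x ∷ xs)) (λ (y , ys) → ∑ (permutations ys) (λ σ → f (y ∷ σ)))
∑-permutations x [] f = sym (+-identityʳ _)
∑-permutations {A} x (x′ ∷ xs) f = begin
  ∑ (permutations (x ∷ x′ ∷ xs)) f                   ≡⟨ ∑-concatMap (insertions x) (permutations (x′ ∷ xs)) f ⟩
  ∑ (permutations (x′ ∷ xs)) (λ σ → ∑ (insertions x σ) f)
    ≡⟨ ∑-cong (permutations (x′ ∷ xs)) split ⟩
  ∑ (permutations (x′ ∷ xs)) (λ σ → f (x ∷ σ) + rest σ)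
    ≡⟨ ∑-+ (permutations (x′ ∷ xs)) _ rest ⟩
  first + ∑ (permutations (x′ ∷ xs)) rest
    ≡⟨ cong (first +_) (∑-permutations x′ xs rest) ⟩
  first + ∑ (select (x′ ∷ xs)) (λ (y , ys) → ∑ (permutations ys) (λ σ → ∑ (insertions x σ) (λ τ → f (y ∷ τ))))
    ≡⟨ cong (first +_) (∑-cong (select (x′ ∷ xs)) (λ (y , ys) → sym (∑-concatMap (insertions x) (permutations ys) _))) ⟩
  first + ∑ (select (x′ ∷ xs)) (λ (y , ys) → ∑ (permutations (x ∷ ys)) (λ σ → f (y ∷ σ)))
    ≡⟨ cong (first +_) (sym (∑-map (λ (y , ys) → y , x ∷ ys) (select (x′ ∷ xs)) _)) ⟩
  first + ∑ (map (λ (y , ys) → y , x ∷ ys) (select (x′ ∷ xs))) (λ (y , ys) → ∑ (permutations ys) (λ σ → f (y ∷ σ))) ∎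
  where
  open ≡-Reasoning
  first = ∑ (permutations (x′ ∷ xs)) (λ σ → f (x ∷ σ))
  rest : List A → ℕ
  rest []       = 0
  rest (y ∷ ys) = ∑ (insertions x ys) (λ σ → f (y ∷ σ))
  split : ∀ σ → ∑ (insertions x σ) f ≡ f (x ∷ σ) + rest σ
  split []       = refl
  split (y ∷ ys) = ∑-insertions x y ys f

-- One supermartingale step: `W y` bounds the scaled conditional expectation once `y` has been read,
-- and its average over the next entry is at most `V`.
average-step : {R : List A} {r : ℕ} (f : List A → ℕ) (c V : ℕ) (W : A → ℕ) → length R ≡ suc r →
               (∀ {y ys} → (y , ys) ∈ select R → ∑ (permutations ys) (λ σ → f (y ∷ σ)) * c ≤ r ! * W y) →
               ∑ R W ≤ suc r * V → ∑ (permutations R) f * c ≤ suc r ! * V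
average-step {R = x ∷ xs} {r} f c V W _ h avg = begin
  ∑ (permutations R) f * c                                    ≡⟨ cong (_* c) (∑-permutations x xs f) ⟩
  ∑ (select R) (λ (y , ys) → ∑ (permutations ys) (λ σ → f (y ∷ σ))) * c ≡⟨ sym (∑-*ʳ (select R) (λ (y , ys) → ∑ (permutations ys) (λ σ → f (y ∷ σ))) c) ⟩
  ∑ (select R) (λ (y , ys) → ∑ (permutations ys) (λ σ → f (y ∷ σ)) * c) ≤⟨ ∑-mono-∈ (select R) h ⟩
  ∑ (select R) (λ (y , ys) → r ! * W y)                       ≡⟨ trans (∑-*ˡ (select R) (r !) _) (cong (r ! *_) (∑-select₁ R W)) ⟩
  r ! * ∑ R W                                                 ≤⟨ *-monoʳ-≤ (r !) avg ⟩
  r ! * (suc r * V)                                           ≡⟨ rearrange (r !) (suc r) V ⟩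
  suc r * r ! * V ∎
  where
  open ≤-Reasoning
  R = x ∷ xs
  rearrange : ∀ a b v → a * (b * v) ≡ b * a * v
  rearrange = solve-∀

∑-permutations-const : (R : List A) (f : List A → ℕ) (c V : ℕ) → (∀ {σ} → σ ↭ R → f σ * c ≤ V) → ∑ (permutations R) f * c ≤ length R ! * V
∑-permutations-const R f c V h = begin
  ∑ (permutations R) f * c               ≡⟨ sym (∑-*ʳ (permutations R) f c) ⟩
  ∑ (permutations R) (λ σ → f σ * c)     ≤⟨ ∑-mono-∈ (permutations R) (λ σ∈ → h (permutations-↭ R σ∈)) ⟩
  ∑ (permutations R) (λ _ → V)           ≡⟨ ∑-const (permutations R) V ⟩
  length (permutations R) * V            ≡⟨ cong (_* V) (length-permutations R) ⟩
  length R ! * V ∎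
  where open ≤-Reasoning

-- Few matching edges in a short prefix

module Early (w : A → ℕ) (w≤1 : ∀ e → w e ≤ 1) (z m μ : ℕ) where

  early : ℕ → ℕ → List A → ℕ
  early s Z σ = 𝟙 (z ≤? Z + ∑ (take s σ) w)

  -- With Z matching edges read and s steps to go, 2 ^ Z * ((m + 2 * μ) / m) ^ s is a supermartingale:
  -- the next edge is a matching edge with probability at most 2 μ / m.
  early-bound : ∀ s Z R → ∑ R w ≤ μ → m + 2 * s ≤ 2 * length R →
                ∑ (permutations R) (early s Z) * (2 ^ z * m ^ s) ≤ length R ! * (2 ^ Z * (m + 2 * μ) ^ s)
  early-bound zero Z R _ _ = ∑-permutations-const R (early zero Z) (2 ^ z * 1) (2 ^ Z * 1) λ _ → markov
    where
    markov : 𝟙 (z ≤? Z + 0) * (2 ^ z * 1) ≤ 2 ^ Z * 1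
    markov with z ≤? Z + 0
    ... | yes p = ≤-trans (≤-reflexive (+-identityʳ _)) (*-monoˡ-≤ 1 (^-monoʳ-≤ 2 (≤-trans p (≤-reflexive (+-identityʳ Z)))))
    ... | no _  = z≤n
  early-bound (suc s) Z [] _ long = contradiction (≤-trans (≤-trans (s≤s z≤n) (m≤n+m _ m)) long) λ ()
  early-bound (suc s) Z R@(x ∷ xs) few long =
    average-step (early (suc s) Z) _ (2 ^ Z * (m + 2 * μ) ^ suc s) W refl ih avg
    where
    open ≤-Reasoning
    r = length xs
    Q = (m + 2 * μ) ^ s
    W : A → ℕ
    W y = m * (2 ^ Z * Q) * (1 + w y)
    2^w : ∀ i → i ≤ 1 → 2 ^ i ≡ 1 + i
    2^w zero          _ = refl
    2^w (suc zero)    _ = refl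
    2^w (suc (suc _)) (s≤s ())
    ih : ∀ {y ys} → (y , ys) ∈ select R → ∑ (permutations ys) (λ σ → early (suc s) Z (y ∷ σ)) * (2 ^ z * m ^ suc s) ≤ r ! * W y
    ih {y} {ys} p = begin
      ∑ (permutations ys) (λ σ → early (suc s) Z (y ∷ σ)) * (2 ^ z * (m * m ^ s))
        ≡⟨ cong₂ _*_ (∑-cong (permutations ys) (λ σ → cong (λ t → 𝟙 (z ≤? t)) (sym (+-assoc Z (w y) _)))) (e₁ (2 ^ z) m (m ^ s)) ⟩
      ∑ (permutations ys) (early s (Z + w y)) * (m * (2 ^ z * m ^ s))
        ≡⟨ e₂ (∑ (permutations ys) (early s (Z + w y))) m (2 ^ z * m ^ s) ⟩
      m * (∑ (permutations ys) (early s (Z + w y)) * (2 ^ z * m ^ s))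
        ≤⟨ *-monoʳ-≤ m (early-bound s (Z + w y) ys few′ long′) ⟩
      m * (length ys ! * (2 ^ (Z + w y) * Q))
        ≡⟨ cong (m *_) (cong₂ _*_ (cong _! len) (cong (_* Q) (trans (^-distribˡ-+-* 2 Z (w y)) (cong (2 ^ Z *_) (2^w (w y) (w≤1 y)))))) ⟩
      m * (r ! * (2 ^ Z * (1 + w y) * Q))
        ≡⟨ e₃ m (r !) (2 ^ Z) (1 + w y) Q ⟩
      r ! * W y ∎
      where
      R↭ = select-↭ R p
      len : length ys ≡ r
      len = sym (cong pred (↭-length R↭))
      few′ : ∑ ys w ≤ μ
      few′ = ≤-trans (m≤n+m _ (w y)) (≤-trans (≤-reflexive (sym (∑-↭ w R↭))) few)
      long′ : m + 2 * s ≤ 2 * length ys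
      long′ = +-cancelʳ-≤ 2 _ _ (≤-by long (e₄ m s) (trans (cong (λ l → 2 * suc l) (sym len)) (e₅ (length ys))))
        where
        e₄ : ∀ m s → m + 2 * s + 2 ≡ m + 2 * (1 + s)
        e₄ = solve-∀
        e₅ : ∀ l → 2 * (1 + l) ≡ 2 * l + 2
        e₅ = solve-∀
      e₁ : ∀ a m b → a * (m * b) ≡ m * (a * b)
      e₁ = solve-∀
      e₂ : ∀ a m b → a * (m * b) ≡ m * (a * b)
      e₂ = solve-∀
      e₃ : ∀ m f z w q → m * (f * (z * w * q)) ≡ f * (m * (z * q) * w)
      e₃ = solve-∀
    -- `long` ensures that at least m / 2 edges are still unread, whence the factor 2 in 2 μ / m.
    m≤2r : m ≤ 2 * suc r
    m≤2r = ≤-trans (m≤m+n m _) long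
    avg : ∑ R W ≤ suc r * (2 ^ Z * ((m + 2 * μ) * Q))
    avg = begin
      ∑ R W                                   ≡⟨ ∑-*ˡ R (m * (2 ^ Z * Q)) (λ y → 1 + w y) ⟩
      m * (2 ^ Z * Q) * ∑ R (λ y → 1 + w y)   ≡⟨ cong (m * (2 ^ Z * Q) *_) (trans (∑-+ R (λ _ → 1) w) (cong (_+ ∑ R w) (∑-1 R))) ⟩
      m * (2 ^ Z * Q) * (suc r + ∑ R w)       ≡⟨ e₁ m (2 ^ Z * Q) (suc r) (∑ R w) ⟩
      (2 ^ Z * Q) * (suc r * m + m * ∑ R w)   ≤⟨ *-monoʳ-≤ (2 ^ Z * Q) (+-monoʳ-≤ (suc r * m) (*-mono-≤ m≤2r few)) ⟩
      (2 ^ Z * Q) * (suc r * m + 2 * suc r * μ) ≡⟨ e₂ (2 ^ Z) Q (suc r) m μ ⟩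
      suc r * (2 ^ Z * ((m + 2 * μ) * Q)) ∎
      where
      e₁ : ∀ m q r u → m * q * (r + u) ≡ q * (r * m + m * u)
      e₁ = solve-∀
      e₂ : ∀ z q r m μ → (z * q) * (r * m + 2 * r * μ) ≡ r * (z * ((m + 2 * μ) * q))
      e₂ = solve-∀

-- Few mistakes remain after a streak without one

module Learner {A : Set} (Ok : A → Set) (U : List A → A → Set) (U? : ∀ B e → Dec (U B e)) (K : ℕ)
               (chain-≤ : ∀ {B} → All Ok B → Chain U B → length B ≤ K) (α : ℕ) where

  left : List A → List A → ℕ
  left B σ = ∑ σ (λ e → 𝟙 (U? B e))

  -- d is the number of consecutive edges still to be seen before B is declared final.
  stuck : ℕ → ℕ → List A → List A → ℕ
  stuck γ zero    B σ       = 𝟙 (γ <? left B σ)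
  stuck γ (suc d) B []      = 0
  stuck γ (suc d) B (e ∷ σ) with U? B e
  ... | yes _ = stuck γ α (e ∷ B) σ
  ... | no _  = stuck γ d B σ

  stuck-yes : ∀ {γ d B e} σ → U B e → stuck γ (suc d) B (e ∷ σ) ≡ stuck γ α (e ∷ B) σ
  stuck-yes {B = B} {e} σ u with U? B e
  ... | yes _ = refl
  ... | no ¬u = contradiction u ¬u

  stuck-no : ∀ {γ d B e} σ → ¬ U B e → stuck γ (suc d) B (e ∷ σ) ≡ stuck γ d B σ
  stuck-no {B = B} {e} σ ¬u with U? B e
  ... | yes u = contradiction u ¬u
  ... | no _  = refl

  -- The bracket is a supermartingale: while more than γ mistakes are left, a streak survives the next edge with
  -- probability at most q / (q + γ), and each of the at most K − |B| further mistakes starts one new streak.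
  stuck-bound : ∀ γ q r d c B R → length R ≡ r → d + c ≡ α → All Ok B → All Ok R → Chain U B → length R ≤ q + γ →
                ∑ (permutations R) (stuck γ d B) * (q + γ) ^ α ≤
                length R ! * (𝟙 (γ <? left B R) * (q ^ d * (q + γ) ^ c) + (K ∸ length B) * q ^ α)
  stuck-bound γ q _ zero c B R _ refl okB okR ch r≤m = ∑-permutations-const R (stuck γ zero B) _ _ λ {σ} σ↭R →
    ≤-trans (≤-reflexive (cong₂ (λ u x → 𝟙 (γ <? u) * x) (∑-↭ _ σ↭R) (sym (+-identityʳ _)))) (m≤m+n _ _)
  stuck-bound γ q _ (suc d) c B []         _ eq okB okR ch r≤m = z≤n
  stuck-bound γ q (suc r) (suc d) c B R@(x ∷ xs) |R| eq okB okR ch r≤m =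
    subst (λ l → ∑ (permutations R) (stuck γ (suc d) B) * m ^ α ≤ l ! * (bad * (q ^ suc d * m ^ c) + rest)) (sym |R|)
      (average-step (stuck γ (suc d) B) (m ^ α) _ W |R| ih avg)
    where
    open ≤-Reasoning
    m = q + γ
    rest = (K ∸ length B) * q ^ α
    bad = 𝟙 (γ <? left B R)
    stays : A → ℕ
    stays y = 𝟙 (¬? (U? B y))
    W : A → ℕ
    W y = stays y * (bad * (q ^ d * m ^ suc c)) + rest
    ih : ∀ {y ys} → (y , ys) ∈ select R → ∑ (permutations ys) (λ σ → stuck γ (suc d) B (y ∷ σ)) * m ^ α ≤ r ! * W y
    ih {y} {ys} p = by (U? B y)
      where
      R↭ = select-↭ R p
      len : length ys ≡ r
      len = cong pred (trans (sym (↭-length R↭)) |R|)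
      ok = All-resp-↭ R↭ okR
      ys≤m : length ys ≤ m
      ys≤m = ≤-trans (n≤1+n _) (≤-trans (≤-reflexive (trans (cong suc len) (sym |R|))) r≤m)
      by : Dec (U B y) → _
      by (yes u) = begin
        ∑ (permutations ys) (λ σ → stuck γ (suc d) B (y ∷ σ)) * m ^ α
          ≡⟨ cong (_* m ^ α) (∑-cong (permutations ys) (λ σ → stuck-yes σ u)) ⟩
        ∑ (permutations ys) (stuck γ α (y ∷ B)) * m ^ α
          ≤⟨ stuck-bound γ q r α 0 (y ∷ B) ys len (+-identityʳ α) ok′ (All.tail ok) (u ∷ ch) ys≤m ⟩
        length ys ! * (𝟙 (γ <? left (y ∷ B) ys) * (q ^ α * 1) + (K ∸ suc (length B)) * q ^ α)
          ≤⟨ *-mono-≤ (≤-reflexive (cong _! len)) collapse ⟩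
        r ! * rest
          ≤⟨ *-monoʳ-≤ (r !) (m≤n+m rest _) ⟩
        r ! * W y ∎
        where
        ok′ = All.head ok ∷ okB
        -- The new streak weighs at most q ^ α and is paid for by one unit of `K ∸ length B`. By the
        -- chain bound |B| + 1 ≤ K, so the truncated subtraction really drops by one.
        collapse : 𝟙 (γ <? left (y ∷ B) ys) * (q ^ α * 1) + (K ∸ suc (length B)) * q ^ α ≤ rest
        collapse = begin
          𝟙 (γ <? left (y ∷ B) ys) * (q ^ α * 1) + (K ∸ suc (length B)) * q ^ α
            ≤⟨ +-monoˡ-≤ _ (≤-trans (*-monoˡ-≤ (q ^ α * 1) (𝟙≤1 (γ <? left (y ∷ B) ys))) (≤-reflexive (trans (+-identityʳ _) (*-identityʳ _)))) ⟩
          suc (K ∸ suc (length B)) * q ^ α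
            ≡⟨ cong (_* q ^ α) (sym (+-∸-assoc 1 (chain-≤ ok′ (u ∷ ch)))) ⟩
          rest ∎
      by (no ¬u) = begin
        ∑ (permutations ys) (λ σ → stuck γ (suc d) B (y ∷ σ)) * m ^ α
          ≡⟨ cong (_* m ^ α) (∑-cong (permutations ys) (λ σ → stuck-no σ ¬u)) ⟩
        ∑ (permutations ys) (stuck γ d B) * m ^ α
          ≤⟨ stuck-bound γ q r d (suc c) B ys len (trans (+-suc d c) eq) okB (All.tail ok) ch ys≤m ⟩
        length ys ! * (𝟙 (γ <? left B ys) * (q ^ d * m ^ suc c) + rest)
          ≡⟨ cong₂ (λ l u → l ! * (𝟙 (γ <? u) * (q ^ d * m ^ suc c) + rest)) len same ⟩
        r ! * (bad * (q ^ d * m ^ suc c) + rest)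
          ≡⟨ cong (λ i → r ! * (i + rest)) (trans (sym (+-identityʳ _)) (cong (_* (bad * (q ^ d * m ^ suc c))) (sym (𝟙-yes (¬? (U? B y)) ¬u)))) ⟩
        r ! * W y ∎
        where
        same : left B ys ≡ left B R
        same = sym (trans (∑-↭ _ R↭) (cong (_+ left B ys) (𝟙-no (U? B y) ¬u)))
    others : ∑ R stays + left B R ≡ suc r
    others = trans (sym (∑-+ R stays _)) (trans (∑-cong R one) (trans (∑-1 R) |R|))
      where
      one : ∀ y → stays y + 𝟙 (U? B y) ≡ 1
      one y with U? B y
      ... | yes _ = refl
      ... | no _  = refl
    -- With u > γ mistakes left among r + 1 ≤ q + γ edges, (r + 1 - u) / (r + 1) ≤ q / (q + γ).
    -- Otherwise `bad` is zero.
    decay : bad * (∑ R stays * m) ≤ bad * (suc r * q)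
    decay with γ <? left B R
    ... | no _ = z≤n
    ... | yes γ<u = +-monoˡ-≤ 0 (begin
      x′ * (q + γ)       ≡⟨ *-distribˡ-+ x′ q γ ⟩
      x′ * q + x′ * γ    ≤⟨ +-monoʳ-≤ (x′ * q) (*-mono-≤ x≤q (<⇒≤ γ<u)) ⟩
      x′ * q + q * u     ≡⟨ e x′ q u ⟩
      (x′ + u) * q       ≡⟨ cong (_* q) others ⟩
      suc r * q ∎)
      where
      x′ = ∑ R stays
      u = left B R
      x≤q : x′ ≤ q
      x≤q = +-cancelʳ-≤ γ _ _ (≤-trans (+-monoʳ-≤ x′ (<⇒≤ γ<u)) (≤-trans (≤-reflexive (trans others (sym |R|))) r≤m))
      e : ∀ x q u → x * q + q * u ≡ (x + u) * q
      e = solve-∀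
    avg : ∑ R W ≤ suc r * (bad * (q ^ suc d * m ^ c) + rest)
    avg = begin
      ∑ R W                                                     ≡⟨ trans (∑-+ R (λ y → stays y * (bad * (q ^ d * m ^ suc c))) (λ _ → rest)) (cong₂ _+_ (∑-*ʳ R stays (bad * (q ^ d * m ^ suc c))) (trans (∑-const R rest) (cong (_* rest) |R|))) ⟩
      ∑ R stays * (bad * (q ^ d * (m * m ^ c))) + suc r * rest      ≡⟨ cong (_+ suc r * rest) (e₁ (∑ R stays) bad (q ^ d) m (m ^ c)) ⟩
      bad * (∑ R stays * m) * (q ^ d * m ^ c) + suc r * rest        ≤⟨ +-monoˡ-≤ (suc r * rest) (*-monoˡ-≤ (q ^ d * m ^ c) decay) ⟩
      bad * (suc r * q) * (q ^ d * m ^ c) + suc r * rest        ≡⟨ e₂ bad (suc r) q (q ^ d) (m ^ c) rest ⟩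
      suc r * (bad * (q * q ^ d * m ^ c) + rest) ∎
      where
      e₁ : ∀ x b qd m mc → x * (b * (qd * (m * mc))) ≡ b * (x * m) * (qd * mc)
      e₁ = solve-∀
      e₂ : ∀ b r q qd mc rest → b * (r * q) * (qd * mc) + r * rest ≡ r * (b * (q * qd * mc) + rest)
      e₂ = solve-∀

-- From counts of bad orderings to high probability

∑-lookup : (xs : List A) (f : A → ℕ) → ∑-vertex (λ i → f (lookup xs i)) ≡ ∑ xs f
∑-lookup xs f = cong sum (trans (map-tabulate {n = length xs} id (f ∘ lookup xs))
  (trans (sym (map-tabulate (lookup xs) f)) (cong (map f) (tabulate-lookup xs))))

-- Markov's inequality by counting, so `bad` may be a sum of several indicators. `I` collects the
-- positions where `bad` vanishes; their distinctness is inherited from `allFin`.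
high-prob : ∀ {n} (G : Graph n) {P : List (Edge n) → Set} (bad : List (Edge n) → ℕ) → 1 ≤ n →
            (∀ {σ} → σ ↭ edges G → bad σ ≡ 0 → P σ) →
            n * ∑ (permutations (edges G)) bad ≤ length (permutations (edges G)) → HighProb G 1 P
high-prob {suc n} G {P} bad _ good rare = I , Unique.filter⁺ _ (Unique.allFin⁺ _) , All.tabulate goodI , count
  where
  open ≤-Reasoning
  perms = permutations (edges G)
  l = length perms
  ok? : Decidable (λ i → bad (lookup perms i) ≡ 0)
  ok? i = bad (lookup perms i) ≟ℕ 0
  I = filter ok? (allFin l)
  goodI : ∀ {i} → i ∈ I → P (lookup perms i)
  goodI {i} i∈ = good (permutations-↭ (edges G) (∈-lookup i)) (proj₂ (∈-filter⁻ ok? {xs = allFin l} i∈))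
  most : l ≤ length I + ∑ perms bad
  most = begin
    l                                                  ≡⟨ sym (trans (∑-1 (allFin l)) (length-tabulate {n = l} id)) ⟩
    ∑-vertex {l} (λ _ → 1)                             ≤⟨ ∑-mono (allFin l) one ⟩
    ∑-vertex (λ i → 𝟙 (ok? i) + bad (lookup perms i))  ≡⟨ ∑-+ (allFin l) _ _ ⟩
    ∑-vertex (𝟙 ∘ ok?) + ∑-vertex (λ i → bad (lookup perms i)) ≡⟨ cong₂ _+_ (sym (length-filter ok? (allFin l))) (∑-lookup perms bad) ⟩
    length I + ∑ perms bad ∎
    where
    one : ∀ i → 1 ≤ 𝟙 (ok? i) + bad (lookup perms i)
    one i with bad (lookup perms i) ≟ℕ 0
    ... | yes _ = s≤s z≤n
    ... | no ¬p = n≢0⇒n>0 ¬p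
  count : (suc n ^ 1 ∸ 1) * l ≤ length I * suc n ^ 1
  count = +-cancelʳ-≤ l _ _ (begin
    (suc n ^ 1 ∸ 1) * l + l               ≡⟨ cong (λ k → (k ∸ 1) * l + l) (*-identityʳ (suc n)) ⟩
    n * l + l                             ≡⟨ +-comm (n * l) l ⟩
    suc n * l                             ≤⟨ *-monoʳ-≤ (suc n) most ⟩
    suc n * (length I + ∑ perms bad)      ≡⟨ *-distribˡ-+ (suc n) (length I) _ ⟩
    suc n * length I + suc n * ∑ perms bad ≤⟨ +-monoʳ-≤ (suc n * length I) rare ⟩
    suc n * length I + l                  ≡⟨ cong (_+ l) (trans (*-comm (suc n) (length I)) (cong (length I *_) (sym (*-identityʳ (suc n))))) ⟩
    length I * suc n ^ 1 + l ∎)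

-- The algorithm

-- An automaton with structured states. Its memory holds a position in `states n`; repetitions in
-- that list do no harm, because `index` of the membership proof picks a position and `lookup`
-- recovers the state.
record Machine : Set₁ where
  field
    State   : ℕ → Set
    states  : ∀ n → List (State n)
    start   : ∀ n → State n
    next    : ∀ n → State n → Edge n → State n
    output  : ∀ n → State n → List (Edge n)
    start∈  : ∀ n → start n ∈ states n
    next∈   : ∀ n {s} e → s ∈ states n → next n s e ∈ states n

  algorithm : StreamAlg
  algorithm = record
    { S    = λ n → length (states n)
    ; init = λ n → index (start∈ n)
    ; step = λ n i e → index (next∈ n e (∈-lookup i))
    ; out  = λ n i → output n (lookup (states n) i)
    }

  simulate : ∀ n i σ → lookup (states n) (foldl (step algorithm n) i σ) ≡ foldl (next n) (lookup (states n) i) σ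
  simulate n i []      = refl
  simulate n i (e ∷ σ) = trans (simulate n _ σ) (cong (λ s → foldl (next n) s σ) (sym (lookup-index (next∈ n e (∈-lookup i)))))

  run-output : ∀ n σ → run algorithm n σ ≡ output n (foldl (next n) (start n) σ)
  run-output n σ = cong (output n) (trans (simulate n _ σ) (cong (λ s → foldl (next n) s σ) (sym (lookup-index (start∈ n)))))

atMostOne-length : (N : List (Edge n)) → AtMostOne N → length N ≤ n
atMostOne-length {n} N one = ≤-trans (m≤m+n (length N) _) (≤-trans (≤-reflexive (sym (handshake₁ N)))
  (≤-trans (∑-mono (allFin n) one) (≤-reflexive (trans (∑-1 (allFin n)) (length-tabulate {n = n} id)))))

opaque
  best-matching : List (Edge n) → List (Edge n)
  best-matching {n} L = Nat.argmax length [] (filter (matchingOff? L []) (words n L))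

  []-off : (L : List (Edge n)) → MatchingOff L [] []
  []-off L = [] , (λ v → z≤n) , []

  best-off : (L : List (Edge n)) → MatchingOff L [] (best-matching L)
  best-off {n} L = Nat.argmax-all length {P = MatchingOff L []} ([]-off L)
    (All.tabulate (λ {N} p → proj₂ (∈-filter⁻ (matchingOff? L []) {xs = words n L} p)))

  best-maximum : (L : List (Edge n)) → Maximum L [] (length (best-matching L))
  best-maximum {n} L N off@(N⊆L , one , _) = All.lookup (Nat.f[xs]≤f[argmax] {f = length} [] (filter (matchingOff? L []) (words n L)))
    (∈-filter⁺ (matchingOff? L []) (∈-words⁺ n N⊆L (atMostOne-length N one)) off)

-- (streak length α required, number of edges still missing from the current streak, mistakes B, late edges X)
Instance : ℕ → Set
Instance n = ℕ × ℕ × List (Edge n) × List (Edge n)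

module Instances (n K cap : ℕ) where

  collect : List (Edge n) → List (Edge n) → Edge n → List (Edge n)
  collect B X e with underfull? B e | length X <? cap
  ... | yes _ | yes _ = e ∷ X
  ... | _     | _     = X

  -- The caps keep the state space finite on arbitrary input. On a stream of ordered edges the chain
  -- bound prevents the cap on `B` from ever blocking a mistake; on good orderings the cap on `X`
  -- loses nothing for the relevant streak length.
  advance : Instance n → Edge n → Instance n
  advance (α , zero , B , X) e = α , zero , B , collect B X e
  advance (α , suc d , B , X) e with underfull? B e | length B <? K
  ... | yes _ | yes _ = α , α , e ∷ B , X
  ... | yes _ | no _  = α , suc d , B , X
  ... | no _  | _     = α , d , B , X

  advance-yes : ∀ {α d B X e} → Underfull B e → length B < K → advance (α , suc d , B , X) e ≡ (α , α , e ∷ B , X)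
  advance-yes {B = B} {e = e} u l with underfull? B e | length B <? K
  ... | yes _ | yes _ = refl
  ... | yes _ | no ¬l = contradiction l ¬l
  ... | no ¬u | _     = contradiction u ¬u

  advance-no : ∀ {α d B X e} → ¬ Underfull B e → advance (α , suc d , B , X) e ≡ (α , d , B , X)
  advance-no {B = B} {e = e} ¬u with underfull? B e | length B <? K
  ... | yes u | _ = contradiction u ¬u
  ... | no _  | _ = refl

  stored : Instance n → List (Edge n)
  stored (_ , _ , B , X) = B ++ X

  collect-⊇ : ∀ B X e {x} → x ∈ X → x ∈ collect B X e
  collect-⊇ B X e x∈ with underfull? B e | length X <? cap
  ... | yes _ | yes _ = there x∈
  ... | yes _ | no _  = x∈
  ... | no _  | _     = x∈

  collect-⊆ : ∀ B X e {x} → x ∈ collect B X e → x ∈ X ⊎ x ≡ e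
  collect-⊆ B X e x∈ with underfull? B e | length X <? cap
  collect-⊆ B X e (here p)   | yes _ | yes _ = inj₂ p
  collect-⊆ B X e (there x∈) | yes _ | yes _ = inj₁ x∈
  collect-⊆ B X e x∈ | yes _ | no _  = inj₁ x∈
  collect-⊆ B X e x∈ | no _  | _     = inj₁ x∈

  collect-∋ : ∀ B X e → Underfull B e → length X < cap → e ∈ collect B X e
  collect-∋ B X e u l with underfull? B e | length X <? cap
  ... | yes _ | yes _ = here refl
  ... | yes _ | no ¬l = contradiction l ¬l
  ... | no ¬u | _     = contradiction u ¬u

  collect-length : ∀ B X e → length (collect B X e) ≤ length X + 𝟙 (underfull? B e)
  collect-length B X e with underfull? B e | length X <? cap
  ... | yes _ | yes _ = ≤-reflexive (+-comm 1 (length X))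
  ... | yes _ | no _  = m≤m+n _ _
  ... | no _  | _     = m≤m+n _ _

  collect-cap : ∀ B X e → length X ≤ cap → length (collect B X e) ≤ cap
  collect-cap B X e l with underfull? B e | length X <? cap
  ... | yes _ | yes l< = l<
  ... | yes _ | no _   = l
  ... | no _  | _      = l

  stored-⊆ : ∀ i σ {x} → x ∈ stored (foldl advance i σ) → x ∈ stored i ⊎ x ∈ σ
  stored-⊆ i []      x∈ = inj₁ x∈
  stored-⊆ i (e ∷ σ) x∈ with stored-⊆ (advance i e) σ x∈
  ... | inj₂ x∈σ = inj₂ (there x∈σ)
  ... | inj₁ x∈′ = [ inj₁ , (λ { refl → inj₂ (here refl) }) ]′ (one i x∈′)
    where
    one : ∀ i {x} → x ∈ stored (advance i e) → x ∈ stored i ⊎ x ≡ e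
    one (α , zero , B , X) x∈ = [ inj₁ ∘ ∈-++⁺ˡ , (λ p → [ inj₁ ∘ ∈-++⁺ʳ B , inj₂ ]′ (collect-⊆ B X e p)) ]′ (∈-++⁻ B x∈)
    one (α , suc d , B , X) x∈ with underfull? B e | length B <? K
    one (α , suc d , B , X) (here p)  | yes _ | yes _ = inj₂ p
    one (α , suc d , B , X) (there p) | yes _ | yes _ = inj₁ p
    one (α , suc d , B , X) x∈ | yes _ | no _ = inj₁ x∈
    one (α , suc d , B , X) x∈ | no _  | _    = inj₁ x∈

  record Final (α : ℕ) (B : List (Edge n)) (X σ : List (Edge n)) : Set where
    field
      X′        : List (Edge n)
      final     : foldl advance (α , zero , B , X) σ ≡ (α , zero , B , X′)
      keeps     : ∀ {x} → x ∈ X → x ∈ X′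
      collects  : ∀ {e} → e ∈ σ → Underfull B e → e ∈ X′

  finish : ∀ α B X σ → length X + ∑ σ (λ e → 𝟙 (underfull? B e)) ≤ cap → Final α B X σ
  finish α B X []      fits = record { X′ = X ; final = refl ; keeps = id ; collects = λ () }
  finish α B X (e ∷ σ) fits = record
    { X′ = F.X′ ; final = F.final ; keeps = F.keeps ∘ collect-⊇ B X e
    ; collects = λ { (here refl) u → F.keeps (collect-∋ B X e u (room u)) ; (there e∈) u → F.collects e∈ u } }
    where
    fits′ : length (collect B X e) + ∑ σ (λ e → 𝟙 (underfull? B e)) ≤ cap
    fits′ = ≤-trans (+-monoˡ-≤ _ (collect-length B X e)) (≤-trans (≤-reflexive (+-assoc (length X) _ _)) fits)
    module F = Final (finish α B (collect B X e) σ fits′)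
    room : Underfull B e → length X < cap
    room u = ≤-trans (≤-trans (≤-reflexive (trans (+-comm 1 (length X)) (cong (length X +_) (sym (𝟙-yes (underfull? B e) u)))))
                              (+-monoʳ-≤ (length X) (m≤m+n _ _))) fits

  module _ (chain-≤ : ∀ {B : List (Edge n)} → All Ordered B → Chain Underfull B → length B ≤ K) (α : ℕ) where

    open Learner Ordered Underfull underfull? K chain-≤ α

    record Learnt (d : ℕ) (B σ : List (Edge n)) (s : ℕ) : Set where
      field
        d′ : ℕ
        B′ X′    : List (Edge n)
        final    : foldl advance (α , d , B , []) σ ≡ (α , d′ , B′ , X′)
        B′-unique : Unique B′
        decided  : ∀ {e} → e ∈ drop s σ → Underfull B′ e → e ∈ X′

    drop-⊆ : ∀ s (σ : List A) {x} → x ∈ drop s σ → x ∈ σ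
    drop-⊆ zero    σ       p = p
    drop-⊆ (suc s) (_ ∷ σ) p = there (drop-⊆ s σ p)

    -- `d + (K ∸ length B) * α` bounds the number of edges read before the freeze: an edge that is
    -- no mistake lowers `d`, and a mistake uses up one of the remaining restarts. Everything beyond
    -- the first `s` edges therefore arrives after the freeze; a stream that ends earlier has
    -- nothing beyond them.
    learn : ∀ d B σ s → All Ordered B → All Ordered σ → Chain Underfull B → Unique B → Unique σ → (∀ {e} → e ∈ B → e ∉ σ) →
            stuck cap d B σ ≡ 0 → d + (K ∸ length B) * α ≤ s → Learnt d B σ s
    learn zero B σ s okB okσ ch uB uσ B∩σ ok _ = record
      { d′ = 0 ; B′ = B ; X′ = F.X′ ; final = F.final ; B′-unique = uB
      ; decided = λ e∈ → F.collects (drop-⊆ s σ e∈) }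
      where
      fits : left B σ ≤ cap
      fits = ≮⇒≥ λ p → contradiction (trans (sym ok) (𝟙-yes (cap <? left B σ) p)) λ ()
      module F = Final (finish α B [] σ fits)
    learn (suc d) B [] (suc s) okB okσ ch uB uσ B∩σ ok _ = record
      { d′ = suc d ; B′ = B ; X′ = [] ; final = refl ; B′-unique = uB ; decided = λ () }
    learn (suc d) B (e ∷ σ) (suc s) okB (o ∷ okσ) ch uB (u ∷ uσ) B∩σ ok (s≤s time) = by (underfull? B e)
      where
      by : Dec (Underfull B e) → Learnt (suc d) B (e ∷ σ) (suc s)
      by (no ¬und) = record
        { d′ = N.d′ ; B′ = N.B′ ; X′ = N.X′ ; B′-unique = N.B′-unique ; decided = N.decided
        ; final = trans (cong (λ i → foldl advance i σ) (advance-no ¬und)) N.final }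
        where
        rest : Learnt d B σ s
        rest = learn d B σ s okB okσ ch uB uσ (λ e∈B e∈σ → B∩σ e∈B (there e∈σ)) (trans (sym (stuck-no σ ¬und)) ok) time
        module N = Learnt rest
      by (yes und) = record
        { d′ = N.d′ ; B′ = N.B′ ; X′ = N.X′ ; B′-unique = N.B′-unique ; decided = N.decided
        ; final = trans (cong (λ i → foldl advance i σ) (advance-yes und room)) N.final }
        where
        room : length B < K
        room = chain-≤ (o ∷ okB) (und ∷ ch)
        time′ : α + (K ∸ suc (length B)) * α ≤ s
        time′ = ≤-trans (≤-reflexive (cong (_* α) (sym (+-∸-assoc 1 room)))) (≤-trans (m≤n+m _ d) time)
        rest : Learnt α (e ∷ B) σ s
        rest = learn α (e ∷ B) σ s (o ∷ okB) okσ (und ∷ ch)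
          (All.tabulate (λ { x∈B refl → B∩σ x∈B (here refl) }) ∷ uB) uσ
          (λ { (here refl) e∈σ → All.lookup u e∈σ refl ; (there x∈) e∈σ → B∩σ x∈ (there e∈σ) })
          (trans (sym (stuck-yes σ und)) ok) time′
        module N = Learnt rest

-- Arithmetic of the parameters

-- Since b j ≤ a, the factor 1 + b / a is at most (j + 1) / j, and these quotients telescope to (j +
-- i) / j. The case j = i gives the factor 2 in `growth`.
pow-double : ∀ a b i j → b * (j + i) ≤ a → (a + b) ^ i * j ≤ a ^ i * (j + i)
pow-double a b zero    j h = ≤-reflexive (cong (1 *_) (sym (+-identityʳ j)))
pow-double a b (suc i) j h = begin
  (a + b) * (a + b) ^ i * j       ≡⟨ e₁ (a + b) ((a + b) ^ i) j ⟩
  (a + b) ^ i * ((a + b) * j)     ≤⟨ *-monoʳ-≤ ((a + b) ^ i) step′ ⟩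
  (a + b) ^ i * (a * suc j)       ≡⟨ e₂ ((a + b) ^ i) a (suc j) ⟩
  a * ((a + b) ^ i * suc j)       ≤⟨ *-monoʳ-≤ a (pow-double a b i (suc j) (≤-by h (cong (b *_) (sym (+-suc j i))) refl)) ⟩
  a * (a ^ i * (suc j + i))       ≡⟨ trans (sym (*-assoc a (a ^ i) (suc j + i))) (cong (a * a ^ i *_) (sym (+-suc j i))) ⟩
  a * a ^ i * (j + suc i) ∎
  where
  open ≤-Reasoning
  e₁ : ∀ x y z → x * y * z ≡ y * (x * z)
  e₁ = solve-∀
  e₂ : ∀ x y z → x * (y * z) ≡ y * (x * z)
  e₂ = solve-∀
  e₃ : ∀ a b j → (a + b) * j ≡ a * j + b * j
  e₃ = solve-∀
  step′ : (a + b) * j ≤ a * suc j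
  step′ = begin
    (a + b) * j     ≡⟨ e₃ a b j ⟩
    a * j + b * j   ≤⟨ +-monoʳ-≤ (a * j) (≤-trans (*-monoʳ-≤ b (m≤m+n j (suc i))) h) ⟩
    a * j + a       ≡⟨ +-comm (a * j) a ⟩
    a + a * j       ≡⟨ sym (*-suc a j) ⟩
    a * suc j ∎

^-distrib-* : ∀ a b y → (a * b) ^ y ≡ a ^ y * b ^ y
^-distrib-* a b zero    = refl
^-distrib-* a b (suc y) = trans (cong (a * b *_) (^-distrib-* a b y)) (e a b (a ^ y) (b ^ y))
  where
  e : ∀ a b x y → a * b * (x * y) ≡ a * x * (b * y)
  e = solve-∀

growth : ∀ a b i y → .{{NonZero i}} → 2 * i * b ≤ a → (a + b) ^ (i * y) ≤ 2 ^ y * a ^ (i * y)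
growth a b i y h = begin
  (a + b) ^ (i * y)      ≡⟨ sym (^-*-assoc (a + b) i y) ⟩
  ((a + b) ^ i) ^ y      ≤⟨ ^-monoˡ-≤ y (*-cancelʳ-≤ _ _ i (≤-by (pow-double a b i i (≤-by h (e₁ b i) refl)) refl (e₂ (a ^ i) i))) ⟩
  (2 * a ^ i) ^ y        ≡⟨ ^-distrib-* 2 (a ^ i) y ⟩
  2 ^ y * (a ^ i) ^ y    ≡⟨ cong (2 ^ y *_) (^-*-assoc a i y) ⟩
  2 ^ y * a ^ (i * y) ∎
  where
  open ≤-Reasoning
  e₁ : ∀ b i → b * (i + i) ≡ 2 * i * b
  e₁ = solve-∀
  e₂ : ∀ x i → x * (i + i) ≡ 2 * x * i
  e₂ = solve-∀

-- Bernoulli's inequality for (1 + γ / q) ^ i, multiplied by q ^ (i + 1).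
bernoulli : ∀ q γ i → q ^ i * (q + i * γ) ≤ (q + γ) ^ i * q
bernoulli q γ zero    = ≤-reflexive (cong (1 *_) (+-identityʳ q))
bernoulli q γ (suc i) = begin
  q * q ^ i * (q + (γ + i * γ))           ≤⟨ m≤m+n _ (q ^ i * (γ * (i * γ))) ⟩
  q * q ^ i * (q + (γ + i * γ)) + q ^ i * (γ * (i * γ)) ≡⟨ e₁ q (q ^ i) γ (i * γ) ⟩
  (q + γ) * (q ^ i * (q + i * γ))         ≤⟨ *-monoʳ-≤ (q + γ) (bernoulli q γ i) ⟩
  (q + γ) * ((q + γ) ^ i * q)             ≡⟨ sym (*-assoc (q + γ) ((q + γ) ^ i) q) ⟩
  (q + γ) * (q + γ) ^ i * q ∎
  where
  open ≤-Reasoning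
  e₁ : ∀ q x γ z → q * x * (q + (γ + z)) + x * (γ * z) ≡ (q + γ) * (x * (q + z))
  e₁ = solve-∀

halving : ∀ q γ i → q ≤ suc i * γ → 2 * q ^ suc i ≤ (q + γ) ^ suc i
halving zero      γ i h = z≤n
halving q@(suc _) γ i h = *-cancelʳ-≤ _ _ q (begin
  2 * q ^ suc i * q              ≡⟨ e (q ^ suc i) q ⟩
  q ^ suc i * (q + q)            ≤⟨ *-monoʳ-≤ (q ^ suc i) (+-monoʳ-≤ q h) ⟩
  q ^ suc i * (q + suc i * γ)    ≤⟨ bernoulli q γ (suc i) ⟩
  (q + γ) ^ suc i * q ∎)
  where
  open ≤-Reasoning
  e : ∀ x q → 2 * x * q ≡ x * (q + q)
  e = solve-∀

-- By `halving`, each block of i + 1 factors q / (q + γ) contributes at most 1/2, and the exponent α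
-- contains Y such blocks.
decay : ∀ q γ i Y α → q ≤ suc i * γ → suc i * Y ≤ α → 2 ^ Y * q ^ α ≤ (q + γ) ^ α
decay q γ i Y α h iY≤α with r , refl ← m≤n⇒∃[o]m+o≡n iY≤α = begin
  2 ^ Y * q ^ (suc i * Y + r)                     ≡⟨ cong (2 ^ Y *_) (^-distribˡ-+-* q (suc i * Y) r) ⟩
  2 ^ Y * (q ^ (suc i * Y) * q ^ r)               ≡⟨ sym (*-assoc (2 ^ Y) (q ^ (suc i * Y)) (q ^ r)) ⟩
  2 ^ Y * q ^ (suc i * Y) * q ^ r                 ≡⟨ cong (_* q ^ r) (trans (cong (2 ^ Y *_) (sym (^-*-assoc q (suc i) Y))) (sym (^-distrib-* 2 (q ^ suc i) Y))) ⟩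
  (2 * q ^ suc i) ^ Y * q ^ r                     ≤⟨ *-mono-≤ (^-monoˡ-≤ Y (halving q γ i h)) (^-monoˡ-≤ r (m≤m+n q γ)) ⟩
  ((q + γ) ^ suc i) ^ Y * (q + γ) ^ r             ≡⟨ cong (_* (q + γ) ^ r) (^-*-assoc (q + γ) (suc i) Y) ⟩
  (q + γ) ^ (suc i * Y) * (q + γ) ^ r             ≡⟨ sym (^-distribˡ-+-* (q + γ) (suc i * Y) r) ⟩
  (q + γ) ^ (suc i * Y + r) ∎
  where open ≤-Reasoning

dyadic : ∀ c m k → c ≤ m → m < c * 2 ^ k → ∃ λ e → e < k × c * 2 ^ e ≤ m × m < 2 * (c * 2 ^ e)
dyadic c m zero    c≤m m< = contradiction (≤-trans m< (≤-reflexive (*-identityʳ c))) (≤⇒≯ c≤m)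
dyadic c m (suc k) c≤m m< with c * 2 ^ k ≤? m
... | yes p = k , ≤-refl , p , ≤-trans m< (≤-reflexive (e c (2 ^ k)))
  where
  e : ∀ c x → c * (2 * x) ≡ 2 * (c * x)
  e = solve-∀
... | no ¬p with e , e< , lo , hi ← dyadic c m k c≤m (≰⇒> ¬p) = e , m≤n⇒m≤1+n e< , lo , hi

opaque
  ℓ : ℕ → ℕ
  ℓ n = suc ⌊log₂ n ⌋

  ℓ-def : ∀ n → ℓ n ≡ suc ⌊log₂ n ⌋
  ℓ-def n = refl

  n<2^ℓ : ∀ n → n < 2 ^ ℓ n
  n<2^ℓ n = ≰⇒> λ p → <-irrefl refl (≤-trans (≤-reflexive (sym (⌊log₂[2^n]⌋≡n (ℓ n)))) (⌊log₂⌋-mono-≤ p))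

m≤suc[m/n]*n : ∀ m n → .{{_ : NonZero n}} → m ≤ suc (m / n) * n
m≤suc[m/n]*n m n = ≤-trans (≤-reflexive (m≡m%n+[m/n]*n m n)) (+-monoˡ-≤ (m / n * n) (<⇒≤ (m%n<n m n)))

-- With y = μ / 16 and i = t / y the prefix is lengthened to (i + 1) y ≥ t, where `growth` bounds (1
-- + 2 μ / m) ^ ((i + 1) y) by 2 ^ y. The threshold μ / 8 is at least 2 y, and the surplus y ≥ l
-- pays for 2 ^ l. The constant 256 is 2 for rounding t up, times 4 from the hypothesis of `growth`,
-- times 32 from μ ≤ 32 y.
early-parameters : ∀ l μ t m → 1 ≤ l → 16 * l ≤ μ → 256 * t ≤ m → 256 * μ ≤ m →
  ∃₂ λ i y → t ≤ suc i * y × 2 * (suc i * y) ≤ m × 2 * suc i * (2 * μ) ≤ m × 2 ^ l * 2 ^ y ≤ 2 ^ suc (μ / 8)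
early-parameters l μ t m 1≤l 16l≤μ 256t≤m 256μ≤m =
    i , y , m≤suc[m/n]*n t y , ≤-trans (*-monoˡ-≤ (suc i * y) (m≤m+n 2 126)) 128iy≤m
  , *-cancelʳ-≤ _ _ y (begin
      2 * suc i * (2 * μ) * y          ≡⟨ e₁ (suc i) μ y ⟩
      4 * (suc i * y) * μ              ≤⟨ *-monoʳ-≤ (4 * (suc i * y)) μ≤32y ⟩
      4 * (suc i * y) * (32 * y)       ≡⟨ e₂ (suc i * y) y ⟩
      128 * (suc i * y) * y            ≤⟨ *-monoˡ-≤ y 128iy≤m ⟩
      m * y ∎)
  , (begin
      2 ^ l * 2 ^ y          ≡⟨ sym (^-distribˡ-+-* 2 l y) ⟩
      2 ^ (l + y)            ≤⟨ ^-monoʳ-≤ 2 (≤-trans (+-monoˡ-≤ y l≤y) (≤-trans 2y≤ (n≤1+n _))) ⟩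
      2 ^ suc (μ / 8) ∎)
  where
  open ≤-Reasoning
  y = μ / 16
  l≤y : l ≤ y
  l≤y = ≤-trans (≤-reflexive (sym (m*n/n≡m l 16))) (/-monoˡ-≤ 16 (≤-trans (≤-reflexive (*-comm l 16)) 16l≤μ))
  1≤y : 1 ≤ y
  1≤y = ≤-trans 1≤l l≤y
  instance
    y≢0 : NonZero y
    y≢0 = >-nonZero 1≤y
  i = t / y
  16y≤μ : y * 16 ≤ μ
  16y≤μ = m/n*n≤m μ 16
  2y≤ : y + y ≤ μ / 8
  2y≤ = ≤-trans (≤-reflexive (sym (m*n/n≡m (y + y) 8))) (/-monoˡ-≤ 8 (≤-trans (≤-reflexive (e y)) 16y≤μ))
    where
    e : ∀ y → (y + y) * 8 ≡ y * 16
    e = solve-∀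
  μ≤32y : μ ≤ 32 * y
  μ≤32y = begin
    μ                ≤⟨ m≤suc[m/n]*n μ 16 ⟩
    16 + y * 16      ≤⟨ +-monoˡ-≤ (y * 16) (*-monoʳ-≤ 16 1≤y) ⟩
    16 * y + y * 16  ≡⟨ e y ⟩
    32 * y ∎
    where
    e : ∀ y → 16 * y + y * 16 ≡ 32 * y
    e = solve-∀
  128iy≤m : 128 * (suc i * y) ≤ m
  128iy≤m = *-cancelˡ-≤ 2 (begin
    2 * (128 * (y + i * y))   ≡⟨ e₃ y (i * y) ⟩
    256 * y + 256 * (i * y)   ≤⟨ +-mono-≤ (≤-trans (*-monoʳ-≤ 256 (≤-trans (m≤m*n y 16) 16y≤μ)) 256μ≤m) (≤-trans (*-monoʳ-≤ 256 (m/n*n≤m t y)) 256t≤m) ⟩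
    m + m                     ≡⟨ cong (m +_) (sym (+-identityʳ m)) ⟩
    2 * m ∎)
    where
    e₃ : ∀ y z → 2 * (128 * (y + z)) ≡ 256 * y + 256 * z
    e₃ = solve-∀
  e₁ : ∀ i μ y → 2 * i * (2 * μ) * y ≡ 4 * (i * y) * μ
  e₁ = solve-∀
  e₂ : ∀ z y → 4 * z * (32 * y) ≡ 128 * z * y
  e₂ = solve-∀

-- About (q + γ) / γ edges halve the survival probability of a streak, and α ≥ 2 Y (q + γ) / γ. The
-- factor 2 absorbs the rounding of the quotient, as γ ≤ q + γ.
late-parameters : ∀ C k Y α q {γ} → 1 ≤ C → 1 ≤ k → 1 ≤ Y → γ ≡ C * k * Y → 2 * (q + γ) ≤ C * k * α → 2 ^ Y * q ^ α ≤ (q + γ) ^ α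
late-parameters C k Y α q 1≤C 1≤k 1≤Y refl h = decay q γ i Y α q≤ (*-cancelʳ-≤ _ _ (C * k) (begin
    suc i * Y * (C * k)    ≡⟨ e₁ (suc i) Y (C * k) ⟩
    γ + i * γ              ≤⟨ +-monoʳ-≤ γ (m/n*n≤m (q + γ) γ) ⟩
    γ + (q + γ)            ≤⟨ +-monoˡ-≤ (q + γ) (m≤n+m γ q) ⟩
    (q + γ) + (q + γ)      ≡⟨ cong (q + γ +_) (sym (+-identityʳ (q + γ))) ⟩
    2 * (q + γ)            ≤⟨ h ⟩
    C * k * α              ≡⟨ *-comm (C * k) α ⟩
    α * (C * k) ∎))
  where
  open ≤-Reasoning
  instance
    Ck≢0 : NonZero (C * k)
    Ck≢0 = >-nonZero (*-mono-≤ 1≤C 1≤k)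
    γ≢0 : NonZero (C * k * Y)
    γ≢0 = >-nonZero (*-mono-≤ (*-mono-≤ 1≤C 1≤k) 1≤Y)
  γ = C * k * Y
  i = (q + γ) / γ
  q≤ : q ≤ suc i * γ
  q≤ = ≤-trans (m≤m+n q γ) (m≤suc[m/n]*n (q + γ) γ)
  e₁ : ∀ i Y c → i * Y * c ≡ i * (c * Y)
  e₁ = solve-∀

-- Matching edges in part of the stream, and the number of edges

restrict : List (Edge n) → List (Edge n) → List (Edge n)
restrict M = filter (_∈? M)

length-restrict : (M xs : List (Edge n)) → length (restrict M xs) ≡ shared M xs
length-restrict M xs = length-filter (_∈? M) xs

restrict-atMostOne : (M : List (Edge n)) {xs : List (Edge n)} → Unique xs → All Ordered xs → AtMostOne M → AtMostOne (restrict M xs)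
restrict-atMostOne M {xs} uniq ord one v = ≤-trans (≤-reflexive (∑-filter (_∈? M) xs (λ e → inc e v)))
  (∑≤1 xs (λ {e} e∈ → ≤-trans (𝟙*≤ (e ∈? M) (inc e v)) (inc≤1 (All.lookup ord e∈) v)) (Unique-AllPairs xs uniq (λ _ _ → exclusive)))
  where
  exclusive : ∀ {e f} → e ≢ f → 𝟙 (e ∈? M) * inc e v ≡ 0 ⊎ 𝟙 (f ∈? M) * inc f v ≡ 0
  exclusive {e} {f} e≢f with e ∈? M | f ∈? M
  ... | no _  | _    = inj₁ refl
  ... | yes _ | no _ = inj₂ refl
  ... | yes e∈ | yes f∈ with inc e v in eq
  ...   | zero = inj₁ refl
  ...   | suc i = inj₂ (trans (+-identityʳ (inc f v)) (n≤0⇒n≡0 (+-cancelˡ-≤ 1 _ 0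
          (≤-trans (+-monoˡ-≤ (inc f v) (≤-trans (s≤s z≤n) (≤-reflexive (sym eq)))) (≤-trans (∑-∈₂ (λ g → inc g v) e∈ f∈ e≢f) (one v))))))

length≤shared : (M xs : List (Edge n)) → Unique M → All (_∈ xs) M → length M ≤ shared M xs
length≤shared M xs uniq M⊆xs = begin
  length M                                    ≡⟨ sym (∑-1 M) ⟩
  ∑ M (λ _ → 1)                               ≤⟨ ∑-mono-∈ M (λ {m} m∈ → ≤-trans (≤-reflexive (sym (𝟙-yes (m ≟ₑ m) refl))) (∑-∈ (λ x → 𝟙 (x ≟ₑ m)) (All.lookup M⊆xs m∈))) ⟩
  ∑ M (λ m → ∑ xs (λ x → 𝟙 (x ≟ₑ m)))         ≡⟨ ∑-swap M xs (λ m x → 𝟙 (x ≟ₑ m)) ⟩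
  ∑ xs (λ x → ∑ M (λ m → 𝟙 (x ≟ₑ m)))         ≤⟨ ∑-mono xs count ⟩
  shared M xs ∎
  where
  open ≤-Reasoning
  count : ∀ x → ∑ M (λ m → 𝟙 (x ≟ₑ m)) ≤ 𝟙 (x ∈? M)
  count x with x ∈? M
  ... | yes _ = ∑≤1 M (λ {m} _ → 𝟙≤1 (x ≟ₑ m)) (Unique-AllPairs M uniq (λ _ _ → exclusive))
    where
    exclusive : ∀ {e f} → e ≢ f → 𝟙 (x ≟ₑ e) ≡ 0 ⊎ 𝟙 (x ≟ₑ f) ≡ 0
    exclusive {e} {f} e≢f with x ≟ₑ e
    ... | no _     = inj₁ refl
    ... | yes refl = inj₂ (𝟙-no (x ≟ₑ f) e≢f)
  ... | no x∉ = ≤-reflexive (n≤0⇒n≡0 (≤-trans (∑-mono-∈ M (λ {m} m∈ → ≤-reflexive (𝟙-no (x ≟ₑ m) λ { refl → x∉ m∈ }))) (≤-reflexive (∑-zero M (λ _ → refl)))))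

-- `v` is the first end of at most `n` edges and the second end of at most `n`; constant factors are
-- harmless here.
degree≤2n : {E : List (Edge n)} → Unique E → ∀ v → deg E v ≤ 2 * n
degree≤2n {n} {E} uniq v = begin
  deg E v                                                 ≡⟨ ∑-+ E (λ e → δ (proj₁ e) v) (λ e → δ (proj₂ e) v) ⟩
  ∑ E (λ e → δ (proj₁ e) v) + ∑ E (λ e → δ (proj₂ e) v)   ≤⟨ +-mono-≤ (side proj₁ proj₂ (λ p q → cong₂ _,_ p q)) (side proj₂ proj₁ (λ p q → cong₂ _,_ q p)) ⟩
  n + n                                                   ≡⟨ cong (n +_) (sym (+-identityʳ n)) ⟩
  2 * n ∎
  where
  open ≤-Reasoning
  V = allFin n
  side : (p q : Edge n → Fin n) → (∀ {e f} → p e ≡ p f → q e ≡ q f → e ≡ f) → ∑ E (λ e → δ (p e) v) ≤ n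
  side p q pq-injective = begin
    ∑ E (λ e → δ (p e) v)                          ≡⟨ ∑-cong E (λ e → sym (trans (∑-cong V (λ x → *-comm (δ (p e) v) (δ (q e) x))) (∑-δ (q e) (λ _ → δ (p e) v)))) ⟩
    ∑ E (λ e → ∑-vertex (λ x → δ (p e) v * δ (q e) x)) ≡⟨ ∑-swap E V _ ⟩
    ∑-vertex (λ x → ∑ E (λ e → δ (p e) v * δ (q e) x)) ≤⟨ ∑-mono V (λ x → ∑≤1 E (λ {e} _ → ≤-trans (𝟙*≤ (p e ≟ v) _) (𝟙≤1 (q e ≟ x))) (Unique-AllPairs E uniq (λ _ _ → exclusive x))) ⟩
    ∑-vertex {n} (λ _ → 1)                         ≡⟨ trans (∑-1 V) (length-tabulate {n = n} id) ⟩
    n ∎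
    where
    exclusive : ∀ x {e f} → e ≢ f → δ (p e) v * δ (q e) x ≡ 0 ⊎ δ (p f) v * δ (q f) x ≡ 0
    exclusive x {e} {f} e≢f with p e ≟ v | q e ≟ x | p f ≟ v | q f ≟ x
    ... | no _ | _ | _ | _ = inj₁ refl
    ... | yes _ | no _ | _ | _ = inj₁ refl
    ... | yes _ | yes _ | no _ | _ = inj₂ refl
    ... | yes _ | yes _ | yes _ | no _ = inj₂ refl
    ... | yes pe | yes qe | yes pf | yes qf = contradiction (pq-injective (trans pe (sym pf)) (trans qe (sym qf))) e≢f

disjoint⇒unique : {M : List (Edge n)} → AllPairs VertexDisjoint M → Unique M
disjoint⇒unique = AllPairs.map (λ { (a≢c , _) refl → a≢c refl })

-- The endpoints of a maximum matching cover all edges.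
edges≤4nμ : (G : Graph n) {M : List (Edge n)} → IsMatching G M → (∀ N → IsMatching G N → length N ≤ length M) →
            length (edges G) ≤ 4 * n * length M
edges≤4nμ {n} G {M} (M⊆E , disj) maximal = begin
  length E                              ≡⟨ sym (∑-1 E) ⟩
  ∑ E (λ _ → 1)                         ≤⟨ ∑-mono-∈ E touches ⟩
  ∑ E (λ e → ends e (deg M))            ≡⟨ sym (handshake E (deg M)) ⟩
  ∑-vertex (λ v → deg E v * deg M v)    ≤⟨ ∑-mono (allFin n) (λ v → *-monoˡ-≤ (deg M v) (degree≤2n (simple G) v)) ⟩
  ∑-vertex (λ v → 2 * n * deg M v)      ≡⟨ trans (∑-*ˡ (allFin n) (2 * n) (deg M)) (cong (2 * n *_) (handshake₁ M)) ⟩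
  2 * n * (2 * length M)                ≡⟨ e₁ n (length M) ⟩
  4 * n * length M ∎
  where
  open ≤-Reasoning
  E = edges G
  e₁ : ∀ n k → 2 * n * (2 * k) ≡ 4 * n * k
  e₁ = solve-∀
  one : AtMostOne M
  one = disjoint⇒atMostOne (All.map (All.lookup (ordered G)) M⊆E) disj
  touches : ∀ {e} → e ∈ E → 1 ≤ ends e (deg M)
  touches {a , b} e∈ = n≢0⇒n>0 λ z → <-irrefl refl (maximal ((a , b) ∷ M) (extend (m+n≡0⇒m≡0 _ z) (m+n≡0⇒n≡0 (deg M a) z)))
    where
    extend : deg M a ≡ 0 → deg M b ≡ 0 → IsMatching G ((a , b) ∷ M)
    extend a0 b0 with E′ , one′ , _ ← add-off E {U = []} (M⊆E , one , []) e∈ (joins (All.lookup (ordered G) e∈)) (λ ()) (λ ()) a0 b0 =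
      E′ , atMostOne⇒disjoint ((a , b) ∷ M) one′

-- Sizes and the state space

opaque
  mistakes : ℕ → ℕ
  mistakes n = 512 * n

  mistakes-def : ∀ n → mistakes n ≡ 512 * n
  mistakes-def n = refl

  -- With k = `suc (mistakes n)` and Y = `2 * ℓ n + 11`, learning fails with probability at most k /
  -- 2 ^ Y, and 2 n k ≤ 2 ^ (2 ℓ + 10) makes this at most 1 / (2 n). The factor 1024 = 4 · 256 fits
  -- the dyadic choice of α: m < 512 k α gives the 2 m ≤ 1024 k α that `late-parameters` asks for.
  capacity : ℕ → ℕ
  capacity n = 1024 * suc (mistakes n) * (2 * ℓ n + 11)

  capacity-def : ∀ n → capacity n ≡ 1024 * suc (mistakes n) * (2 * ℓ n + 11)
  capacity-def n = refl

few-mistakes : {B : List (Edge n)} → All Ordered B → Chain Underfull B → length B ≤ mistakes n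
few-mistakes {n} os c = ≤-trans (chain-length os c) (≤-reflexive (sym (mistakes-def n)))

-- The powers of two suffice because m ≤ 4 n² < 2 ^ (2 ℓ + 3).
streaks : ℕ → List ℕ
streaks n = 0 ∷ map (2 ^_) (upTo (2 * ℓ n + 3))

longest : ℕ → ℕ
longest n = 2 ^ (2 * ℓ n + 3)

pairs : (n : ℕ) → List (Edge n)
pairs n = cartesianProduct (allFin n) (allFin n)

instances : (n : ℕ) → List (Instance n)
instances n = cartesianProduct I (cartesianProduct I (cartesianProduct (words (mistakes n) (pairs n)) (words (capacity n) (pairs n))))
  where I = upTo (suc (longest n))

module Inst (n : ℕ) = Instances n (mistakes n) (capacity n)

∈-pairs : (e : Edge n) → e ∈ pairs n
∈-pairs (a , b) = ∈-cartesianProduct⁺ (∈-allFin a) (∈-allFin b)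

∈-instances⁺ : ∀ {α d} {B X : List (Edge n)} → α ≤ longest n → d ≤ longest n → length B ≤ mistakes n → length X ≤ capacity n →
               (α , d , B , X) ∈ instances n
∈-instances⁺ {n} {α} {d} {B} {X} p q r s = ∈-cartesianProduct⁺ (∈-upTo⁺ (s≤s p)) (∈-cartesianProduct⁺ (∈-upTo⁺ (s≤s q))
  (∈-cartesianProduct⁺ (∈-words⁺ (mistakes n) (All.tabulate (λ {e} _ → ∈-pairs e)) r) (∈-words⁺ (capacity n) (All.tabulate (λ {e} _ → ∈-pairs e)) s)))

∈-instances⁻ : ∀ {α d} {B X : List (Edge n)} → (α , d , B , X) ∈ instances n →
               α ≤ longest n × d ≤ longest n × length B ≤ mistakes n × length X ≤ capacity n
∈-instances⁻ {n} p
  with α∈ , p₁ ← ∈-cartesianProduct⁻ (upTo (suc (longest n))) _ p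
  with d∈ , p₂ ← ∈-cartesianProduct⁻ (upTo (suc (longest n))) _ p₁
  with B∈ , X∈ ← ∈-cartesianProduct⁻ (words (mistakes n) (pairs n)) _ p₂ =
  ≤-pred (∈-upTo⁻ α∈) , ≤-pred (∈-upTo⁻ d∈) , proj₂ (∈-words⁻ (mistakes n) (pairs n) B∈) , proj₂ (∈-words⁻ (capacity n) (pairs n) X∈)

advance∈ : ∀ i e → i ∈ instances n → Inst.advance n i e ∈ instances n
advance∈ {n} (α , zero , B , X) e i∈ with p , q , r , s ← ∈-instances⁻ i∈ =
  ∈-instances⁺ p q r (Inst.collect-cap n B X e s)
advance∈ {n} (α , suc d , B , X) e i∈ with p , q , r , s ← ∈-instances⁻ i∈ with underfull? B e | length B <? mistakes n
... | yes _ | yes l = ∈-instances⁺ p p l s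
... | yes _ | no _  = i∈
... | no _  | _     = ∈-instances⁺ p (<⇒≤ q) r s

initial : ℕ → Instance n
initial α = α , α , [] , []

streaks≤longest : ∀ n {α} → α ∈ streaks n → α ≤ longest n
streaks≤longest n (here refl) = z≤n
streaks≤longest n (there p) with e , e∈ , refl ← ∈-map⁻ (2 ^_) p = ^-monoʳ-≤ 2 (<⇒≤ (∈-upTo⁻ e∈))

machine : Machine
machine = record
  { State  = λ n → List (Instance n)
  ; states = λ n → words (length (streaks n)) (instances n)
  ; start  = λ n → map initial (streaks n)
  ; next   = λ n s e → map (λ i → Inst.advance n i e) s
  ; output = λ n s → best-matching (concatMap (Inst.stored n) s)
  ; start∈ = λ n → ∈-words⁺ (length (streaks n))
      (All.map⁺ (All.tabulate (λ α∈ → ∈-instances⁺ (streaks≤longest n α∈) (streaks≤longest n α∈) z≤n z≤n)))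
      (≤-reflexive (length-map initial (streaks n)))
  ; next∈  = λ n {s} e s∈ → let all∈ , short = ∈-words⁻ (length (streaks n)) (instances n) s∈ in
      ∈-words⁺ (length (streaks n)) (All.map⁺ (All.map (λ {i} → advance∈ i e) all∈))
        (≤-trans (≤-reflexive (length-map _ s)) short)
  }

foldl-map-pointwise : (f : A → B → A) (s : List A) (σ : List B) → foldl (λ s e → map (λ i → f i e) s) s σ ≡ map (λ i → foldl f i σ) s
foldl-map-pointwise f s []      = sym (map-id s)
foldl-map-pointwise f s (e ∷ σ) = trans (foldl-map-pointwise f (map (λ i → f i e) s) σ) (sym (map-∘ s))

-- Correctness on good orderings

unique-⊆ : {A : Set} {xs ys : List A} → xs ⊆ ys → Unique ys → Unique xs
unique-⊆ []         []       = []
unique-⊆ (_ ∷ʳ p)   (_ ∷ us) = unique-⊆ p us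
unique-⊆ (refl ∷ p) (u ∷ us) = All-resp-⊆ p u ∷ unique-⊆ p us

underfull-[] : (e : Edge n) → Underfull [] e
underfull-[] {n} e = subst (λ H → ends e (deg H) < 62) (sym (empty (core-⊆ {n} []))) (s≤s z≤n)
  where
  empty : {H : List (Edge n)} → H ⊆ [] → H ≡ []
  empty [] = refl

module Correctness {n : ℕ} (G : Graph n) {M : List (Edge n)} (M-matching : IsMatching G M)
                   {σ : List (Edge n)} (σ↭ : σ ↭ edges G) where

  open Inst n

  memory : List (Edge n)
  memory = concatMap stored (map (λ i → foldl advance i σ) (map initial (streaks n)))

  result : List (Edge n)
  result = best-matching memory

  run≡ : run (Machine.algorithm machine) n σ ≡ result
  run≡ = trans (Machine.run-output machine n σ)
    (cong (best-matching ∘ concatMap stored) (foldl-map-pointwise advance (map initial (streaks n)) σ))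

  σ-ordered : All Ordered σ
  σ-ordered = All-resp-↭ (↭-sym σ↭) (ordered G)

  σ-unique : Unique σ
  σ-unique = Permutation.Unique-resp-↭ (setoid (Edge n)) (↭⇒↭ₛ (↭-sym σ↭)) (simple G)

  memory-⊆ : ∀ {e} → e ∈ memory → e ∈ σ
  memory-⊆ e∈ with i , i∈ , e∈i ← ∈-concatMap⁻ stored (map (λ i → foldl advance i σ) (map initial (streaks n))) e∈
    with j , j∈ , refl ← ∈-map⁻ (λ i → foldl advance i σ) i∈ with α , _ , refl ← ∈-map⁻ initial j∈
    with stored-⊆ (initial α) σ e∈i
  ... | inj₂ e∈σ = e∈σ

  memory-∋ : ∀ {α e} → α ∈ streaks n → e ∈ stored (foldl advance (initial α) σ) → e ∈ memory
  memory-∋ α∈ e∈ = ∈-concatMap⁺ stored (∈-map⁺ (λ i → foldl advance i σ) (∈-map⁺ initial α∈)) e∈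

  memory-ordered : All Ordered memory
  memory-ordered = All.tabulate (All.lookup σ-ordered ∘ memory-⊆)

  result-matching : IsMatching G result
  result-matching = All.map (∈-resp-↭ σ↭ ∘ memory-⊆) (proj₁ (best-off memory))
                  , atMostOne⇒disjoint result (proj₁ (proj₂ (best-off memory)))

  M⊆σ : All (_∈ σ) M
  M⊆σ = All.map (∈-resp-↭ (↭-sym σ↭)) (proj₁ M-matching)

  M-one : AtMostOne M
  M-one = disjoint⇒atMostOne (All.map (All.lookup σ-ordered) M⊆σ) (proj₂ M-matching)

  -- The instance with α = 0 is frozen from the outset with `B = []`. All degrees in its core are
  -- zero, so every edge is underfull and goes into `X`.
  few-edges : length (edges G) ≤ capacity n → length M ≤ length result
  few-edges m≤cap = best-maximum memory M (All.map M⊆memory M⊆σ , M-one , [])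
    where
    fits : ∑ σ (λ e → 𝟙 (underfull? [] e)) ≤ capacity n
    fits = ≤-trans (≤-trans (∑-mono σ (λ e → 𝟙≤1 (underfull? [] e))) (≤-reflexive (trans (∑-1 σ) (↭-length σ↭)))) m≤cap
    module Kept = Final (finish 0 [] [] σ fits)
    M⊆memory : ∀ {e} → e ∈ σ → e ∈ memory
    M⊆memory {e} e∈σ = memory-∋ {α = 0} (here refl) (subst (λ i → e ∈ stored i) (sym Kept.final) (Kept.collects e∈σ (underfull-[] e)))

  -- `suc (mistakes n) * α` is the latest possible freezing time, one streak plus one restart for
  -- each possible mistake. `T` is the part of `M` beyond it.
  many-edges : ∀ {α s} → α ∈ streaks n → suc (mistakes n) * α ≤ s → 8 * shared M (take s σ) ≤ length M →
               Learner.stuck Ordered Underfull underfull? (mistakes n) few-mistakes α (capacity n) α [] σ ≡ 0 →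
               6 * length M ≤ 11 * length result
  many-edges {α} {s} α∈ time early ok = finally (length M) (shared M (take s σ)) (length T) (length result) early split sparse
    where
    module N = Learnt (learn few-mistakes α α [] σ s [] σ-ordered [] [] σ-unique (λ ()) ok time)
    T = restrict M (drop s σ)
    B′⊆memory : ∀ {e} → e ∈ N.B′ → e ∈ memory
    B′⊆memory {e} e∈ = memory-∋ α∈ (subst (λ i → e ∈ stored i) (sym N.final) (∈-++⁺ˡ e∈))
    X′⊆memory : ∀ {e} → e ∈ N.X′ → e ∈ memory
    X′⊆memory {e} e∈ = memory-∋ α∈ (subst (λ i → e ∈ stored i) (sym N.final) (∈-++⁺ʳ N.B′ e∈))
    core⊆memory : ∀ {e} → e ∈ core N.B′ → e ∈ memory
    core⊆memory e∈ = B′⊆memory (Sublist.lookup (core-⊆ N.B′) e∈)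
    sparse : 5 * length T ≤ 8 * length result
    sparse = sparsifier memory-ordered (unique-⊆ (core-⊆ N.B′) N.B′-unique) core⊆memory
      (λ e∈ → core-bounded N.B′ e∈ (All.lookup memory-ordered (core⊆memory e∈)))
      (restrict-atMostOne M (Unique.drop⁺ s σ-unique) (All.drop⁺ s σ-ordered) M-one) full
      (best-off memory) (best-maximum memory)
      where
      full : ∀ {e} → e ∈ T → e ∈ memory ⊎ 62 ≤ ends e (deg (core N.B′))
      full {e} e∈ = by (underfull? N.B′ e)
        where
        by : Dec (Underfull N.B′ e) → e ∈ memory ⊎ 62 ≤ ends e (deg (core N.B′))
        by (yes u) = inj₁ (X′⊆memory (N.decided (proj₁ (∈-filter⁻ (_∈? M) {xs = drop s σ} e∈)) u))
        by (no ¬u) = inj₂ (≮⇒≥ ¬u)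
    split : length M ≤ shared M (take s σ) + length T
    split = begin
      length M                                       ≤⟨ length≤shared M σ (disjoint⇒unique (proj₂ M-matching)) M⊆σ ⟩
      shared M σ                                     ≡⟨ cong (shared M) (sym (take++drop≡id s σ)) ⟩
      shared M (take s σ ++ drop s σ)                ≡⟨ ∑-++ (take s σ) (drop s σ) _ ⟩
      shared M (take s σ) + shared M (drop s σ)      ≡⟨ cong (shared M (take s σ) +_) (sym (length-restrict M (drop s σ))) ⟩
      shared M (take s σ) + length T ∎
      where open ≤-Reasoning
    -- From t ≥ 7 μ / 8 and k ≥ 5 t / 8 one gets 210 μ ≤ 384 k, and 384 k ≤ 385 k = 35 · 11 k.
    finally : ∀ μ z t k → 8 * z ≤ μ → μ ≤ z + t → 5 * t ≤ 8 * k → 6 * μ ≤ 11 * k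
    finally μ z t k p q r = *-cancelˡ-≤ 35 (+-cancelʳ-≤ (30 * μ) _ _ (begin
      35 * (6 * μ) + 30 * μ           ≡⟨ e₁ μ ⟩
      240 * μ                         ≤⟨ *-monoʳ-≤ 240 q ⟩
      240 * (z + t)                   ≡⟨ e₂ z t ⟩
      30 * (8 * z) + 48 * (5 * t)     ≤⟨ +-mono-≤ (*-monoʳ-≤ 30 p) (*-monoʳ-≤ 48 r) ⟩
      30 * μ + 48 * (8 * k)           ≤⟨ m≤m+n _ k ⟩
      30 * μ + 48 * (8 * k) + k       ≡⟨ e₃ μ k ⟩
      35 * (11 * k) + 30 * μ ∎))
      where
      open ≤-Reasoning
      e₁ : ∀ μ → 35 * (6 * μ) + 30 * μ ≡ 240 * μ
      e₁ = solve-∀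
      e₂ : ∀ z t → 240 * (z + t) ≡ 30 * (8 * z) + 48 * (5 * t)
      e₂ = solve-∀
      e₃ : ∀ μ k → 30 * μ + 48 * (8 * k) + k ≡ 35 * (11 * k) + 30 * μ
      e₃ = solve-∀

-- Memory

length-cartesianProduct : (xs : List A) (ys : List B) → length (cartesianProduct xs ys) ≡ length xs * length ys
length-cartesianProduct []       ys = refl
length-cartesianProduct (x ∷ xs) ys = trans (length-++ (map (x ,_) ys)) (cong₂ _+_ (length-map (x ,_) ys) (length-cartesianProduct xs ys))

length-words : ∀ k (xs : List A) → length (words k xs) ≤ suc (length xs) ^ k
length-words zero    xs = ≤-refl
length-words (suc k) xs = begin
  suc (length (concatMap (λ x → map (x ∷_) W) xs))      ≡⟨ cong suc (sym (∑-1 (concatMap (λ x → map (x ∷_) W) xs))) ⟩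
  suc (∑ (concatMap (λ x → map (x ∷_) W) xs) (λ _ → 1)) ≡⟨ cong suc (∑-concatMap (λ x → map (x ∷_) W) xs (λ _ → 1)) ⟩
  suc (∑ xs (λ x → ∑ (map (x ∷_) W) (λ _ → 1)))         ≡⟨ cong suc (∑-cong xs (λ x → trans (∑-1 (map (x ∷_) W)) (length-map (x ∷_) W))) ⟩
  suc (∑ xs (λ _ → length W))                           ≡⟨ cong suc (∑-const xs (length W)) ⟩
  suc (length xs * length W)                            ≤⟨ +-mono-≤ (m^n>0 (suc (length xs)) k) (*-monoʳ-≤ (length xs) (length-words k xs)) ⟩
  suc (length xs) ^ k + length xs * suc (length xs) ^ k ∎
  where
  open ≤-Reasoning
  W = words k xs

space-exponent : ∀ a b K C N l → 1 ≤ l → 1 ≤ N → K ≤ a * N → C ≤ b * (N * l) →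
                 (4 * l + 9 + 2 * l * K + 2 * l * C) * (2 * l + 4) ≤ 6 * (13 + 2 * a + 2 * b) * N * l ^ 3
space-exponent a b K C N l 1≤l 1≤N K≤ C≤ = begin
  (4 * l + 9 + 2 * l * K + 2 * l * C) * (2 * l + 4)
    ≤⟨ *-mono-≤ (+-mono-≤ (+-mono-≤ linear (*-monoʳ-≤ (2 * l) (≤-trans K≤ (*-monoʳ-≤ a (m≤m*l N))))) (*-monoʳ-≤ (2 * l) C≤)) (+-monoʳ-≤ (2 * l) (*-monoʳ-≤ 4 1≤l)) ⟩
  (13 * (N * (l * l)) + 2 * l * (a * (N * l)) + 2 * l * (b * (N * l))) * (2 * l + 4 * l)
    ≡⟨ e a b N l ⟩
  6 * (13 + 2 * a + 2 * b) * N * l ^ 3 ∎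
  where
  open ≤-Reasoning
  m≤m*l : ∀ m → m ≤ m * l
  m≤m*l m = ≤-trans (≤-reflexive (sym (*-identityʳ m))) (*-monoʳ-≤ m 1≤l)
  linear : 4 * l + 9 ≤ 13 * (N * (l * l))
  linear = begin
    4 * l + 9          ≤⟨ +-monoʳ-≤ (4 * l) (*-monoʳ-≤ 9 1≤l) ⟩
    4 * l + 9 * l      ≡⟨ sym (*-distribʳ-+ l 4 9) ⟩
    13 * l             ≤⟨ *-monoʳ-≤ 13 (≤-trans (m≤m*l l) (≤-trans (≤-reflexive (sym (+-identityʳ (l * l)))) (*-monoˡ-≤ (l * l) 1≤N))) ⟩
    13 * (N * (l * l)) ∎
  e : ∀ a b N l → (13 * (N * (l * l)) + 2 * l * (a * (N * l)) + 2 * l * (b * (N * l))) * (2 * l + 4 * l)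
                  ≡ 6 * (13 + 2 * a + 2 * b) * N * (l * (l * (l * 1)))
  e = solve-∀

suc≤ : ∀ {a} c n → 1 ≤ c → a ≤ c * n → suc a ≤ c * suc n
suc≤ c n 1≤c h = ≤-trans (+-mono-≤ 1≤c h) (≤-reflexive (sym (*-suc c n)))

-- There are O(log n) instances, each with O(n log n) edges of O(log n) bits, hence the exponent 3
-- of the logarithm.
semiStreaming : SemiStreaming (Machine.algorithm machine)
semiStreaming = 6 * (13 + 2 * 512 + 2 * (1024 * 512 * 13)) , 3 , λ n → ≤-trans (bound n) (≤-reflexive (cong (λ l → 2 ^ (6 * (13 + 2 * 512 + 2 * (1024 * 512 * 13)) * suc n * l ^ 3)) (ℓ-def n)))
  where
  open ≤-Reasoning
  bound : ∀ n → length (words (length (streaks n)) (instances n)) ≤ 2 ^ (6 * (13 + 2 * 512 + 2 * (1024 * 512 * 13)) * suc n * ℓ n ^ 3)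
  bound n = begin
    length (words (length (streaks n)) (instances n))   ≤⟨ length-words (length (streaks n)) (instances n) ⟩
    suc (length (instances n)) ^ length (streaks n)     ≡⟨ cong (suc (length (instances n)) ^_) |streaks| ⟩
    suc (length (instances n)) ^ (2 * l + 4)            ≤⟨ ^-monoˡ-≤ (2 * l + 4) |instances| ⟩
    (2 ^ (4 * l + 9 + 2 * l * K + 2 * l * C)) ^ (2 * l + 4) ≡⟨ ^-*-assoc 2 (4 * l + 9 + 2 * l * K + 2 * l * C) (2 * l + 4) ⟩
    2 ^ ((4 * l + 9 + 2 * l * K + 2 * l * C) * (2 * l + 4)) ≤⟨ ^-monoʳ-≤ 2 (space-exponent 512 (1024 * 512 * 13) K C (suc n) l 1≤l (s≤s z≤n) (≤-trans (≤-reflexive (mistakes-def n)) (*-monoʳ-≤ 512 (n≤1+n n))) C≤) ⟩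
    2 ^ (6 * (13 + 2 * 512 + 2 * (1024 * 512 * 13)) * suc n * l ^ 3) ∎
    where
    l = ℓ n
    1≤l : 1 ≤ l
    1≤l = ≤-trans (s≤s z≤n) (≤-reflexive (sym (ℓ-def n)))
    K = mistakes n
    C = capacity n
    C≤ : C ≤ 1024 * 512 * 13 * (suc n * l)
    C≤ = begin
      C                                        ≡⟨ capacity-def n ⟩
      1024 * suc K * (2 * l + 11)              ≤⟨ *-mono-≤ (*-monoʳ-≤ 1024 (suc≤ 512 n (s≤s z≤n) (≤-reflexive (mistakes-def n)))) (+-monoʳ-≤ (2 * l) (*-monoʳ-≤ 11 1≤l)) ⟩
      1024 * (512 * suc n) * (2 * l + 11 * l)  ≡⟨ cong (1024 * (512 * suc n) *_) (sym (*-distribʳ-+ l 2 11)) ⟩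
      1024 * (512 * suc n) * (13 * l)          ≡⟨ e 1024 512 13 (suc n) l ⟩
      1024 * 512 * 13 * (suc n * l) ∎
      where
      e : ∀ a b c N l → a * (b * N) * (c * l) ≡ a * b * c * (N * l)
      e = solve-∀
    |streaks| : length (streaks n) ≡ 2 * l + 4
    |streaks| = trans (cong suc (trans (length-map (2 ^_) (upTo (2 * l + 3))) (length-upTo (2 * l + 3)))) (sym (+-suc (2 * l) 3))
    double : ∀ x → 2 ^ x + 2 ^ x ≡ 2 ^ suc x
    double x = cong ((2 ^ x) +_) (sym (+-identityʳ (2 ^ x)))
    suc-2^ : ∀ {y} x → y ≤ 2 ^ x → suc y ≤ 2 ^ suc x
    suc-2^ x y≤ = ≤-trans (+-mono-≤ (m^n>0 2 x) y≤) (≤-reflexive (double x))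
    |range| : length (upTo (suc (longest n))) ≤ 2 ^ (2 * l + 4)
    |range| = ≤-trans (≤-reflexive (length-upTo (suc (longest n)))) (≤-trans (suc-2^ (2 * l + 3) ≤-refl) (≤-reflexive (cong (2 ^_) (sym (+-suc (2 * l) 3)))))
    |words| : ∀ k → length (words k (pairs n)) ≤ 2 ^ (2 * l * k)
    |words| k = begin
      length (words k (pairs n))     ≤⟨ length-words k (pairs n) ⟩
      suc (length (pairs n)) ^ k     ≤⟨ ^-monoˡ-≤ k letters ⟩
      (2 ^ (2 * l)) ^ k              ≡⟨ ^-*-assoc 2 (2 * l) k ⟩
      2 ^ (2 * l * k) ∎
      where
      letters : suc (length (pairs n)) ≤ 2 ^ (2 * l)
      letters = begin
        suc (length (pairs n))     ≡⟨ cong suc (trans (length-cartesianProduct (allFin n) (allFin n)) (cong₂ _*_ (length-tabulate {n = n} id) (length-tabulate {n = n} id))) ⟩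
        suc (n * n)                ≤⟨ s≤s (≤-trans (*-monoʳ-≤ n (n≤1+n n)) (m≤n+m _ n)) ⟩
        suc n * suc n              ≤⟨ *-mono-≤ (n<2^ℓ n) (n<2^ℓ n) ⟩
        2 ^ l * 2 ^ l              ≡⟨ trans (sym (^-distribˡ-+-* 2 l l)) (cong (λ k → 2 ^ (l + k)) (sym (+-identityʳ l))) ⟩
        2 ^ (2 * l) ∎
    |instances| : suc (length (instances n)) ≤ 2 ^ (4 * l + 9 + 2 * l * K + 2 * l * C)
    |instances| = ≤-trans (suc-2^ (4 * l + 8 + 2 * l * K + 2 * l * C) (begin
      length (instances n)
        ≡⟨ trans (length-cartesianProduct I (cartesianProduct I lists)) (cong (length I *_)
             (trans (length-cartesianProduct I lists) (cong (length I *_) (length-cartesianProduct (words K (pairs n)) (words C (pairs n)))))) ⟩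
      length I * (length I * (length (words K (pairs n)) * length (words C (pairs n))))
        ≤⟨ *-mono-≤ |range| (*-mono-≤ |range| (*-mono-≤ (|words| K) (|words| C))) ⟩
      2 ^ (2 * l + 4) * (2 ^ (2 * l + 4) * (2 ^ (2 * l * K) * 2 ^ (2 * l * C)))
        ≡⟨ sym (trans (^-distribˡ-+-* 2 (2 * l + 4) _) (cong (2 ^ (2 * l + 4) *_) (trans (^-distribˡ-+-* 2 (2 * l + 4) _) (cong (2 ^ (2 * l + 4) *_) (^-distribˡ-+-* 2 (2 * l * K) _))))) ⟩
      2 ^ ((2 * l + 4) + ((2 * l + 4) + (2 * l * K + 2 * l * C)))
        ≡⟨ cong (2 ^_) (e l (2 * l * K) (2 * l * C)) ⟩
      2 ^ (4 * l + 8 + 2 * l * K + 2 * l * C) ∎)) (≤-reflexive (cong (2 ^_) (e′ l (2 * l * K) (2 * l * C))))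
      where
      I = upTo (suc (longest n))
      lists = cartesianProduct (words K (pairs n)) (words C (pairs n))
      e : ∀ l x y → (2 * l + 4) + ((2 * l + 4) + (x + y)) ≡ 4 * l + 8 + x + y
      e = solve-∀
      e′ : ∀ l x y → 1 + (4 * l + 8 + x + y) ≡ 4 * l + 9 + x + y
      e′ = solve-∀

ratio : ∀ μ k → 6 * μ ≤ 11 * k → (pos 6 ℚ./ 11 ℚ.- 0ℚ) ℚ.* toℚ μ ℚ.≤ toℚ k
ratio μ k h = ℚ.toℚᵘ-cancel-≤ (begin
  ℚ.toℚᵘ ((pos 6 ℚ./ 11) ℚ.* toℚ μ)          ≃⟨ ℚ.toℚᵘ-homo-* (pos 6 ℚ./ 11) (toℚ μ) ⟩
  mkℚᵘ (pos 6) 10 ℚᵘ.* ℚ.toℚᵘ (toℚ μ)        ≃⟨ ℚᵘ.*-congˡ {mkℚᵘ (pos 6) 10} (ℚ.toℚᵘ-fromℚᵘ (mkℚᵘ (pos μ) 0)) ⟩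
  mkℚᵘ (pos 6) 10 ℚᵘ.* mkℚᵘ (pos μ) 0          ≤⟨ ℚᵘ.*≤* integers ⟩
  mkℚᵘ (pos k) 0                             ≃⟨ ℚᵘ.≃-sym (ℚ.toℚᵘ-fromℚᵘ (mkℚᵘ (pos k) 0)) ⟩
  ℚ.toℚᵘ (toℚ k) ∎)
  where
  open ℚᵘ.≤-Reasoning
  integers : (pos 6 ℤ.* pos μ) ℤ.* pos 1 ℤ.≤ pos k ℤ.* pos 11
  integers = ℤ.≤-trans
      (ℤ.≤-reflexive (trans (ℤ.*-identityʳ (pos 6 ℤ.* pos μ)) (sym (ℤ.pos-* 6 μ))))
      (ℤ.≤-trans (ℤ.+≤+ (≤-trans h (≤-reflexive (*-comm 11 k)))) (ℤ.≤-reflexive (ℤ.pos-* k 11)))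

-- Probability of a good ordering

scale : ∀ N a F X Y → 1 ≤ X → a * X ≤ F * Y → N * Y ≤ X → N * a ≤ F
scale N a F X@(suc _) Y _ p q = *-cancelʳ-≤ _ _ X (begin
  N * a * X     ≡⟨ *-assoc N a X ⟩
  N * (a * X)   ≤⟨ *-monoʳ-≤ N p ⟩
  N * (F * Y)   ≡⟨ e N F Y ⟩
  F * (N * Y)   ≤⟨ *-monoʳ-≤ F q ⟩
  F * X ∎)
  where
  open ≤-Reasoning
  e : ∀ N F Y → N * (F * Y) ≡ F * (N * Y)
  e = solve-∀

module Dense {n : ℕ} (1≤n : 1 ≤ n) (G : Graph n) {M : List (Edge n)} (M-matching : IsMatching G M)
             (M-max : ∀ N → IsMatching G N → length N ≤ length M) (dense : capacity n < length (edges G)) where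

  open ≤-Reasoning
  E : List (Edge n)
  E = edges G

  m μ l k Y γ : ℕ
  m = length E
  μ = length M
  l = ℓ n
  k = suc (mistakes n)
  Y = 2 * l + 11
  γ = capacity n

  M-one : AtMostOne M
  M-one = disjoint⇒atMostOne (All.map (All.lookup (ordered G)) (proj₁ M-matching)) (proj₂ M-matching)

  μ≤n : μ ≤ n
  μ≤n = atMostOne-length M M-one

  n≤k : n ≤ k
  n≤k = ≤-trans (≤-trans (m≤n*m n 512) (≤-reflexive (sym (mistakes-def n)))) (n≤1+n _)

  k≤2^ : k ≤ 512 * 2 ^ l
  k≤2^ = ≤-trans (suc≤ 512 n (s≤s z≤n) (≤-reflexive (mistakes-def n))) (*-monoʳ-≤ 512 (n<2^ℓ n))

  2nk≤ : 2 * n * k ≤ 2 ^ Y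
  2nk≤ = begin
    2 * n * k                        ≤⟨ *-mono-≤ (*-monoʳ-≤ 2 (<⇒≤ (n<2^ℓ n))) k≤2^ ⟩
    2 * 2 ^ l * (512 * 2 ^ l)        ≡⟨ e 512 (2 ^ l) ⟩
    2 ^ l * 2 ^ l * 1024             ≤⟨ *-monoʳ-≤ (2 ^ l * 2 ^ l) (m≤m+n 1024 1024) ⟩
    2 ^ l * 2 ^ l * 2 ^ 11           ≡⟨ cong (_* 2 ^ 11) (trans (sym (^-distribˡ-+-* 2 l l)) (cong (λ x → 2 ^ (l + x)) (sym (+-identityʳ l)))) ⟩
    2 ^ (2 * l) * 2 ^ 11             ≡⟨ sym (^-distribˡ-+-* 2 (2 * l) 11) ⟩
    2 ^ Y ∎
    where
    e : ∀ c x → 2 * x * (c * x) ≡ x * x * (2 * c)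
    e = solve-∀

  k≤m : 1024 * k ≤ m
  k≤m = begin
    1024 * k                ≤⟨ m≤m*n (1024 * k) Y {{>-nonZero (≤-trans (s≤s z≤n) (m≤n+m 11 (2 * l)))}} ⟩
    1024 * k * Y            ≡⟨ sym (capacity-def n) ⟩
    γ                       ≤⟨ <⇒≤ dense ⟩
    m ∎

  256k≤m : 256 * k ≤ m
  256k≤m = ≤-trans (*-monoˡ-≤ k (m≤m+n 256 768)) k≤m

  256μ≤m : 256 * μ ≤ m
  256μ≤m = ≤-trans (*-monoʳ-≤ 256 (≤-trans μ≤n n≤k)) 256k≤m

  -- For a smaller μ the bound m ≤ 4 n μ would put m within the capacity, against `dense`. This
  -- supplies the concentration needed for the prefix.
  16l≤μ : 16 * suc l ≤ μ
  16l≤μ = ≮⇒≥ λ μ< → <-irrefl refl (≤-trans dense (begin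
    m                           ≤⟨ edges≤4nμ G M-matching M-max ⟩
    4 * n * μ                   ≤⟨ *-mono-≤ (*-monoʳ-≤ 4 n≤k) (<⇒≤ μ<) ⟩
    4 * k * (16 * suc l)        ≡⟨ e k (suc l) ⟩
    64 * k * suc l              ≤⟨ *-mono-≤ (*-monoˡ-≤ k (m≤m+n 64 960)) (≤-trans (≤-reflexive (+-comm 1 l)) (+-mono-≤ (m≤m+n l _) (s≤s z≤n))) ⟩
    1024 * k * Y                ≡⟨ sym (capacity-def n) ⟩
    γ ∎))
    where
    e : ∀ k l → 4 * k * (16 * l) ≡ 64 * k * l
    e = solve-∀

  m<dyadic : m < 256 * k * 2 ^ (2 * l + 3)
  m<dyadic = begin-strict
    m                            ≤⟨ edges≤4nμ G M-matching M-max ⟩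
    4 * n * μ                    ≤⟨ *-monoʳ-≤ (4 * n) μ≤n ⟩
    4 * n * n                    ≤⟨ *-monoʳ-≤ (4 * n) (<⇒≤ (n<2^ℓ n)) ⟩
    4 * n * 2 ^ l                <⟨ *-monoˡ-< (2 ^ l) {{>-nonZero (m^n>0 2 l)}} (*-monoʳ-< 4 (n<2^ℓ n)) ⟩
    4 * 2 ^ l * 2 ^ l            ≤⟨ ≤-trans (≤-reflexive (e (2 ^ l))) (*-monoʳ-≤ (2 ^ l * 2 ^ l) (m≤m+n 4 4)) ⟩
    2 ^ l * 2 ^ l * 2 ^ 3        ≡⟨ cong (_* 2 ^ 3) (trans (sym (^-distribˡ-+-* 2 l l)) (cong (λ x → 2 ^ (l + x)) (sym (+-identityʳ l)))) ⟩
    2 ^ (2 * l) * 2 ^ 3          ≡⟨ sym (^-distribˡ-+-* 2 (2 * l) 3) ⟩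
    2 ^ (2 * l + 3)              ≤⟨ m≤n*m (2 ^ (2 * l + 3)) (256 * k) ⟩
    256 * k * 2 ^ (2 * l + 3) ∎
    where
    e : ∀ x → 4 * x * x ≡ x * x * 4
    e = solve-∀

  module Choice {e : ℕ} (e< : e < 2 * l + 3) (lower : 256 * k * 2 ^ e ≤ m) (upper : m < 2 * (256 * k * 2 ^ e))
                {i y : ℕ} (time : k * 2 ^ e ≤ suc i * y) (2s≤m : 2 * (suc i * y) ≤ m) (slow : 2 * suc i * (2 * μ) ≤ m)
                (small : 2 ^ suc l * 2 ^ y ≤ 2 ^ suc (μ / 8)) where

    α s z q : ℕ
    α = 2 ^ e
    s = suc i * y
    z = suc (μ / 8)
    q = m ∸ γ

    open Early {A = Edge n} (λ f → 𝟙 (f ∈? M)) (λ f → 𝟙≤1 (f ∈? M)) z m μ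
    open Learner Ordered (Underfull {n}) underfull? (mistakes n) few-mistakes α

    bad : List (Edge n) → ℕ
    bad σ = early s 0 σ + stuck γ α [] σ

    perms = permutations E

    1≤m : 1 ≤ m
    1≤m = ≤-trans (s≤s z≤n) 256k≤m

    instance
      m≢0 : NonZero m
      m≢0 = >-nonZero 1≤m

    -- The tail bound is 2 ^ y / 2 ^ z by `growth`, and `small` makes it at most 1 / 2 ^ (l + 1),
    -- where 2 n ≤ 2 ^ (l + 1).
    early-rare : 2 * n * ∑ perms (early s 0) ≤ m !
    early-rare = scale (2 * n) _ (m !) (2 ^ z * m ^ s) (2 ^ 0 * (m + 2 * μ) ^ s) (*-mono-≤ (m^n>0 2 z) (m^n>0 m s))
      (early-bound s 0 E present (≤-trans (+-monoʳ-≤ m 2s≤m) (≤-reflexive (cong (m +_) (sym (+-identityʳ m))))))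
      (begin
        2 * n * (1 * (m + 2 * μ) ^ s)        ≤⟨ *-mono-≤ (*-monoʳ-≤ 2 (<⇒≤ (n<2^ℓ n))) (≤-trans (≤-reflexive (+-identityʳ _)) (growth m (2 * μ) (suc i) y slow)) ⟩
        2 ^ suc l * (2 ^ y * m ^ s)          ≡⟨ sym (*-assoc (2 ^ suc l) (2 ^ y) (m ^ s)) ⟩
        2 ^ suc l * 2 ^ y * m ^ s            ≤⟨ *-monoˡ-≤ (m ^ s) small ⟩
        2 ^ z * m ^ s ∎)
      where
      present : shared M E ≤ μ
      present = ≤-trans (≤-reflexive (sym (length-restrict M E))) (M-max (restrict M E)
        (All.tabulate (λ p → proj₁ (∈-filter⁻ (_∈? M) {xs = E} p))
        , atMostOne⇒disjoint (restrict M E) (restrict-atMostOne M (simple G) (ordered G) M-one)))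

    q+γ≡m : q + γ ≡ m
    q+γ≡m = m∸n+n≡m (<⇒≤ dense)

    stuck-rare : 2 * n * ∑ perms (stuck γ α []) ≤ m !
    stuck-rare = scale (2 * n) _ (m !) ((q + γ) ^ α) _ (≤-trans (m^n>0 m α) (≤-reflexive (cong (_^ α) (sym q+γ≡m))))
      (stuck-bound γ q m α 0 [] E refl (+-identityʳ α) [] (ordered G) [] (≤-reflexive (sym q+γ≡m)))
      (begin
        -- The initial bracket is at most k q ^ α: one streak at the outset and one for each
        -- possible mistake.
        2 * n * (𝟙 (γ <? left [] E) * (q ^ α * 1) + mistakes n * q ^ α)
          ≤⟨ *-monoʳ-≤ (2 * n) (+-monoˡ-≤ (mistakes n * q ^ α) (≤-trans (*-monoˡ-≤ (q ^ α * 1) (𝟙≤1 (γ <? left [] E))) (≤-reflexive (trans (+-identityʳ _) (*-identityʳ _))))) ⟩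
        2 * n * (k * q ^ α)       ≡⟨ sym (*-assoc (2 * n) k (q ^ α)) ⟩
        2 * n * k * q ^ α         ≤⟨ *-monoˡ-≤ (q ^ α) 2nk≤ ⟩
        2 ^ Y * q ^ α             ≤⟨ late ⟩
        (q + γ) ^ α ∎)
      where
      late : 2 ^ Y * q ^ α ≤ (q + γ) ^ α
      late = late-parameters 1024 k Y α q (s≤s z≤n) (s≤s z≤n) (≤-trans (s≤s z≤n) (m≤n+m 11 (2 * l))) (capacity-def n) (begin
        2 * (q + γ)                   ≡⟨ cong (2 *_) q+γ≡m ⟩
        2 * m                         ≤⟨ *-monoʳ-≤ 2 (<⇒≤ upper) ⟩
        2 * (2 * (256 * k * α))       ≡⟨ e′ 256 k α ⟩
        4 * 256 * k * α               ≡⟨ cong (λ c → c * k * α) 4*256 ⟩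
        1024 * k * α ∎)
        where
        4*256 : 4 * 256 ≡ 1024
        4*256 = refl
        e′ : ∀ c k α → 2 * (2 * (c * k * α)) ≡ 4 * c * k * α
        e′ = solve-∀

    rare : n * ∑ perms bad ≤ length perms
    rare = begin
      n * ∑ perms bad                     ≡⟨ cong (n *_) (∑-+ perms (early s 0) (stuck γ α [])) ⟩
      n * (∑ perms (early s 0) + ∑ perms (stuck γ α [])) ≤⟨ halves n _ _ _ early-rare stuck-rare ⟩
      m !                                 ≡⟨ sym (length-permutations E) ⟩
      length perms ∎
      where
      halves : ∀ n a b f → 2 * n * a ≤ f → 2 * n * b ≤ f → n * (a + b) ≤ f
      halves n a b f p q = *-cancelˡ-≤ 2 (≤-by (+-mono-≤ p q) (e₁ n a b) (cong (f +_) (sym (+-identityʳ f))))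
        where
        e₁ : ∀ n a b → 2 * (n * (a + b)) ≡ 2 * n * a + 2 * n * b
        e₁ = solve-∀

    α∈streaks : α ∈ streaks n
    α∈streaks = there (∈-map⁺ (2 ^_) (∈-upTo⁺ e<))

    good : ∀ {σ} → (σ↭ : σ ↭ E) → bad σ ≡ 0 → 6 * μ ≤ 11 * length (Correctness.result G M-matching σ↭)
    good {σ} σ↭ b = Correctness.many-edges G M-matching σ↭ α∈streaks time few (m+n≡0⇒n≡0 (early s 0 σ) b)
      where
      few : 8 * shared M (take s σ) ≤ μ
      few = ≤-trans (*-monoʳ-≤ 8 (≤-pred (≰⇒> λ z≤ → contradiction (trans (sym (m+n≡0⇒m≡0 _ b)) (𝟙-yes (z ≤? shared M (take s σ)) z≤)) λ ())))
        (≤-trans (≤-reflexive (*-comm 8 (μ / 8))) (m/n*n≤m μ 8))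

theorem3 : Σ StreamAlg λ A → SemiStreaming A × Σ (ℕ → ℚ) λ ε → IsLittleO1 ε × ∃ λ d → 1 ≤ d × (∀ n → 1 ≤ n → (G : Graph n) → ∀ μ → MaxMatchingSize G μ → HighProb G d (Good A n G (ε n) μ))
-- The error term is taken to be 0, and d = 1: the two failure events have probability at most 1 /
-- (2 n) each.
theorem3 = algorithm , semiStreaming , (λ _ → 0ℚ) , (λ δ 0<δ → 0 , λ n _ → ℚ.<⇒≤ 0<δ) , 1 , ≤-refl , main
  where
  algorithm = Machine.algorithm machine
  main : ∀ n → 1 ≤ n → (G : Graph n) → ∀ μ → MaxMatchingSize G μ → HighProb G 1 (Good algorithm n G 0ℚ μ)
  main n 1≤n G μ ((M , M-matching , refl) , M-max) = by (length (edges G) ≤? capacity n)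
    where
    good : ∀ {σ} (σ↭ : σ ↭ edges G) → 6 * length M ≤ 11 * length (Correctness.result G M-matching σ↭) → Good algorithm n G 0ℚ (length M) σ
    good σ↭ h = subst (λ N → IsMatching G N × ((pos 6 ℚ./ 11 ℚ.- 0ℚ) ℚ.* toℚ (length M) ℚ.≤ toℚ (length N))) (sym (Correctness.run≡ G M-matching σ↭))
      (Correctness.result-matching G M-matching σ↭ , ratio (length M) (length (Correctness.result G M-matching σ↭)) h)
    by : Dec (length (edges G) ≤ capacity n) → HighProb G 1 (Good algorithm n G 0ℚ (length M))
    by (yes sparse) = high-prob G (λ _ → 0) 1≤n
      (λ σ↭ _ → good σ↭ (*-mono-≤ (m≤m+n 6 5) (Correctness.few-edges G M-matching σ↭ sparse)))
      (≤-trans (≤-reflexive (trans (cong (n *_) (∑-zero (permutations (edges G)) (λ _ → refl))) (*-zeroʳ n))) z≤n)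
    by (no ¬sparse) =
      let e , e< , lower , upper = dyadic (256 * Many.k) Many.m (2 * ℓ n + 3) Many.256k≤m Many.m<dyadic
          i , y , time , 2s≤m , slow , small = early-parameters (suc (ℓ n)) Many.μ (Many.k * 2 ^ e) Many.m (s≤s z≤n) Many.16l≤μ
             (≤-trans (≤-reflexive (sym (*-assoc 256 Many.k (2 ^ e)))) lower) Many.256μ≤m
      in high-prob G (Many.Choice.bad {e} e< lower upper {i} {y} time 2s≤m slow small) 1≤n
           (λ σ↭ b → good σ↭ (Many.Choice.good {e} e< lower upper {i} {y} time 2s≤m slow small σ↭ b))
           (Many.Choice.rare {e} e< lower upper {i} {y} time 2s≤m slow small)
      where module Many = Dense 1≤n G M-matching M-max (≰⇒> ¬sparse)
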